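{- The algebra $\mathrm{QSym}$ is graded by the rank of the compositions indexing the basis $\{N_\alpha\}$; that is, for all compositions $\alpha,\beta$, the product $N_\alpha N_\beta$ lies in the span of the $N_\nu$ with $r(\nu)=r(\alpha)+r(\beta)$. Furthermore, the structure constants for $\{N_\alpha\}$ are nonnegative: for all compositions $\alpha,\beta$, in the expansion $$N_\alpha N_\beta=\sum_\nu c^\nu_{\alpha,\beta}N_\nu,$$ all the constants $c^\nu_{\alpha,\beta}$ are nonnegative integers.
   Context: A composition $\alpha=(\alpha_1,\dots,\alpha_m)$ is a finite (possibly empty) sequence of positive integers; $\ell(\alpha)=m$ is its length and $|\alpha|=\alpha_1+\cdots+\alpha_m$ its weight. The empty composition is denoted $\mathbf{0}$. The rank of $\alpha$ is $r(\alpha)=\alpha_1+\alpha_3+\alpha_5+\cdots$ (sum of odd-indexed parts). For compositions of the same weight $n$, $\beta$ refines $\alpha$ ($\beta\preccurlyeq\alpha$) if the set of proper partial sums of $\alpha$ (a subset of $\{1,\dots,n-1\}$) is contained in that of $\beta$. $\mathrm{QSym}$ is the ring of quasisymmetric functions in the ordered variables $x_1,x_2,\dots$, with monomial basis $\mathbf{x}^\alpha=\sum_{1\le i_1<\cdots<i_m}x_{i_1}^{\alpha_1}\cdots x_{i_m}^{\alpha_m}$ and fundamental basis $L_\alpha=\sum_{\beta\preccurlyeq\alpha}\mathbf{x}^\beta$ (with $L_{\mathbf 0}=1$). A permutation of a finite set $X$ of positive integers is a sequence $\pi$ listing each element of $X$ exactly once; $C(\pi)$ is the composition whose parts are the lengths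 of the successive maximal increasing runs of $\pi$. A labeled poset $P$ is a partial order $\le_P$ on a finite set of positive integers (the labels). $\mathcal{L}(P)$ is the set of linear extensions of $P$, i.e. permutations of the label set in which $x$ appears before $y$ whenever $x<_P y$. The quasisymmetric function of $P$ is $F(P)=\sum_{\pi\in\mathcal{L}(P)}L_{C(\pi)}$. $P\oplus Q$ denotes the ordinal sum of posets (all elements of $P$ lie below all elements of $Q$). For a nonempty composition $\alpha$ with $\ell(\alpha)=m$, let $P_\alpha=A_1\oplus\cdots\oplus A_m$, where $A_i$ is an antichain with $\alpha_i$ elements, labeled by $1,\dots,|\alpha|$ as follows: first the elements of $A_2,A_4,\dots$ are numbered consecutively, followed by the elements of $A_1,A_3,\dots$. Define $N_\alpha=F(P_\alpha)$, and $N_{\mathbf 0}=1$. The set $\{N_\alpha\}$, over all compositions $\alpha$, is a $\mathbb{Z}$-basis of $\mathrm{QSym}$. -}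

module Defs where

open import Data.Bool.Base using (if_then_else_)
open import Data.Empty using (⊥; ⊥-elim)
open import Data.Integer.Base as ℤ using (ℤ; 0ℤ; 1ℤ)
open import Data.List.Base
  using (List; []; _∷_; _++_; map; foldr; filter; concatMap; cartesianProductWith; applyUpTo; upTo)
import Data.List.Membership.DecPropositional as DecMembership
open import Data.List.Membership.Propositional using (_∈_)
open import Data.List.Membership.Propositional.Properties
  using (∈-applyUpTo⁻; ∈-++⁺ˡ; ∈-++⁺ʳ; ∈-++⁻)
open import Data.List.Properties using (≡-dec)
open import Data.List.Relation.Binary.Disjoint.Propositional using (Disjoint)
import Data.List.Relation.Binary.Sublist.DecPropositional as DecSublist
import Data.List.Relation.Binary.Subset.DecPropositional as DecSubset
open import Data.List.Relation.Unary.All as All using (All; []; _∷_)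
import Data.List.Relation.Unary.All.Properties as All
open import Data.List.Relation.Unary.AllPairs as AllPairs using (AllPairs; []; _∷_)
open import Data.List.Relation.Unary.Unique.Propositional using (Unique)
import Data.List.Relation.Unary.Unique.Propositional.Properties as Unique
open import Data.Nat.ListAction using (sum)
open import Data.Nat.Base using (ℕ; zero; suc; _+_; _∸_; _≤_; _<_; NonZero; s≤s)
open import Data.Nat.Properties
  using (_≟_; _<?_; m≤m+n; +-assoc; +-monoʳ-<; +-cancelˡ-≡; suc-injective
        ; ≤-trans; ≤-<-trans; ≤-refl; ≤-reflexive; <⇒≢; <⇒≱)
open import Data.Product.Base using (∃; _×_; _,_; proj₁; proj₂)
open import Data.Sum.Base using (_⊎_; inj₁; inj₂)
open import Level using (0ℓ)
open import Relation.Binary.Core using (Rel)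
open import Relation.Binary.Definitions using (Decidable; Transitive; Irreflexive)
open import Relation.Binary.PropositionalEquality
  using (_≡_; _≢_; refl; trans; isEquivalence; resp₂)
open import Relation.Binary.Structures using (IsStrictPartialOrder)
open import Relation.Nullary.Decidable
  using (Dec; no; does; ¬?; _×-dec_; _⊎-dec_; _→-dec_; map′)
open import Relation.Unary using (Pred)

module Membership = DecMembership _≟_
module Sublist = DecSublist _≟_
module Subset = DecSubset _≟_

------------------------------------------------------------------------
-- Compositions

-- Positivity is irrelevant, so compositions with the same parts are equal.
record Composition : Set where
  constructor _,_
  field
    parts     : List ℕ
    .positive : All NonZero parts

open Composition public

𝟎 : Composition
𝟎 = [] , []

weight : Composition → ℕ
weight α = sum (parts α)

mutual
  oddSum : List ℕ → ℕ
  oddSum []       = 0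
  oddSum (a ∷ as) = a + evenSum as

  evenSum : List ℕ → ℕ
  evenSum []       = 0
  evenSum (_ ∷ as) = oddSum as

rank : Composition → ℕ
rank α = oddSum (parts α)

one∷ : Composition → Composition
one∷ (as , p) = 1 ∷ as , (_ ∷ p)

-- Adds one to the first part.
incr : Composition → Composition
incr ([]     , _) = 1 ∷ [] , (_ ∷ [])
incr (a ∷ as , p) = suc a ∷ as , (_ ∷ All.tail p)

-- All compositions of n, each exactly once.
compositions : ℕ → List Composition
compositions 0             = 𝟎 ∷ []
compositions 1             = one∷ 𝟎 ∷ []
compositions (suc (suc n)) =
  map one∷ (compositions (suc n)) ++ map incr (compositions (suc n))

properPartialSums : List ℕ → List ℕ
properPartialSums []           = []
properPartialSums (_ ∷ [])     = []
properPartialSums (a ∷ b ∷ as) = a ∷ map (a +_) (properPartialSums (b ∷ as))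

infix 4 _≼_ _≼?_

-- β ≼ α means that β refines α.
_≼_ : Rel Composition 0ℓ
β ≼ α = weight β ≡ weight α
      × properPartialSums (parts α) Subset.⊆ properPartialSums (parts β)

_≼?_ : Decidable _≼_
β ≼? α = (weight β ≟ weight α)
  ×-dec (properPartialSums (parts α) Subset.⊆? properPartialSums (parts β))

------------------------------------------------------------------------
-- Formal power series over ℤ in the variables x₁, x₂, …

-- The list (e₁ ∷ … ∷ eₖ ∷ []) encodes x₁^e₁ ⋯ xₖ^eₖ.  Lists that differ only
-- by trailing zeros encode the same monomial; the series below take equal
-- values on them.
Monomial : Set
Monomial = List ℕ

-- A series is given by its coefficients.
Series : Set
Series = Monomial → ℤ

infix 4 _≈_
_≈_ : Rel Series 0ℓ
f ≈ g = ∀ e → f e ≡ g e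

∑ : {A : Set} → List A → (A → Series) → Series
∑ xs f e = foldr ℤ._+_ 0ℤ (map (λ x → f x e) xs)

infixr 8 _·_
_·_ : ℤ → Series → Series
(k · f) e = k ℤ.* f e

-- All ways of writing a monomial as a product of two monomials.
factorizations : Monomial → List (Monomial × Monomial)
factorizations []      = ([] , []) ∷ []
factorizations (k ∷ e) =
  cartesianProductWith (λ { i (a , b) → (i ∷ a , (k ∸ i) ∷ b) })
    (upTo (suc k)) (factorizations e)

infixl 7 _⊛_
_⊛_ : Series → Series → Series
(f ⊛ g) e =
  foldr ℤ._+_ 0ℤ (map (λ { (a , b) → f a ℤ.* g b }) (factorizations e))

------------------------------------------------------------------------
-- Monomial and fundamental quasisymmetric functions

-- A monomial occurs in ∑_{i₁<⋯<iₘ} x_{i₁}^α₁ ⋯ x_{iₘ}^αₘ, and then exactly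
-- once, iff its sequence of nonzero exponents is α.
𝐱^ : Composition → Series
𝐱^ α e = if does (≡-dec _≟_ (filter (λ k → ¬? (k ≟ 0)) e) (parts α)) then 1ℤ else 0ℤ

L : Composition → Series
L α = ∑ (filter (_≼? α) (compositions (weight α))) 𝐱^

------------------------------------------------------------------------
-- Permutations

insertions : ℕ → List ℕ → List (List ℕ)
insertions x []       = (x ∷ []) ∷ []
insertions x (y ∷ ys) = (x ∷ y ∷ ys) ∷ map (y ∷_) (insertions x ys)

-- For a list without repetitions, all its rearrangements, each exactly once.
permutations : List ℕ → List (List ℕ)
permutations []       = [] ∷ []
permutations (x ∷ xs) = concatMap (insertions x) (permutations xs)

-- Lengths of the maximal increasing runs.
C : List ℕ → Composition
C []          = 𝟎
C (x ∷ [])    = one∷ 𝟎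
C (x ∷ y ∷ π) = if does (x <? y) then incr (C (y ∷ π)) else one∷ (C (y ∷ π))

------------------------------------------------------------------------
-- Labeled posets

-- A partial order on a finite set of positive integers, given by its strict
-- part: a strict partial order on ℕ relating only labels.
record LabeledPoset : Set₁ where
  field
    labels               : List ℕ
    unique               : Unique labels
    positiveLabels       : All NonZero labels
    _≺_                  : Rel ℕ 0ℓ
    _≺?_                 : Decidable _≺_
    isStrictPartialOrder : IsStrictPartialOrder _≡_ _≺_
    support              : ∀ {x y} → x ≺ y → x ∈ labels × y ∈ labels

  -- For a permutation π of the labels, x ∷ y ∷ [] is a sublist of π iff x
  -- appears before y in π.
  IsLinearExtension : List ℕ → Set
  IsLinearExtension π = ∀ {x y} → x ≺ y → (x ∷ y ∷ []) Sublist.⊆ π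

  isLinearExtension? : ∀ π → Dec (IsLinearExtension π)
  isLinearExtension? π = map′
    (λ h {x} {y} x≺y → let (x∈ , y∈) = support x≺y in
       All.lookup (All.lookup h x∈) y∈ x≺y)
    (λ h → All.tabulate λ _ → All.tabulate λ _ → h)
    (All.all? (λ x → All.all? (λ y →
       (x ≺? y) →-dec ((x ∷ y ∷ []) Sublist.⊆? π)) labels) labels)

  linearExtensions : List (List ℕ)
  linearExtensions = filter isLinearExtension? (permutations labels)

open LabeledPoset public using (labels; IsLinearExtension; linearExtensions)

F : LabeledPoset → Series
F P = ∑ (linearExtensions P) (λ π → L (C π))

-- The antichain with the k labels s + 1, …, s + k.
antichain : ℕ → ℕ → LabeledPoset
antichain s k = record
  { labels               = applyUpTo (λ i → suc (s + i)) k
  ; unique               = Unique.applyUpTo⁺₁ _ k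
      (λ i<j _ eq → <⇒≢ i<j (+-cancelˡ-≡ s _ _ (suc-injective eq)))
  ; positiveLabels       = All.applyUpTo⁺₂ _ k (λ _ → _)
  ; _≺_                  = λ _ _ → ⊥
  ; _≺?_                 = λ _ _ → no λ ()
  ; isStrictPartialOrder = record
      { isEquivalence = isEquivalence
      ; irrefl        = λ _ ()
      ; trans         = λ ()
      ; <-resp-≈      = resp₂ _
      }
  ; support              = λ ()
  }

DisjointLabels : LabeledPoset → LabeledPoset → Set
DisjointLabels P Q = Disjoint (labels P) (labels Q)

-- Ordinal sum.
_⊕_[_] : (P Q : LabeledPoset) → DisjointLabels P Q → LabeledPoset
P ⊕ Q [ P#Q ] = record
  { labels               = P.labels ++ Q.labels
  ; unique               = Unique.++⁺ P.unique Q.unique P#Q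
  ; positiveLabels       = All.++⁺ P.positiveLabels Q.positiveLabels
  ; _≺_                  = _⊏_
  ; _≺?_                 = λ x y → (x P.≺? y) ⊎-dec (x Q.≺? y)
      ⊎-dec ((x Membership.∈? P.labels) ×-dec (y Membership.∈? Q.labels))
  ; isStrictPartialOrder = record
      { isEquivalence = isEquivalence
      ; irrefl        = irrefl
      ; trans         = transitive
      ; <-resp-≈      = resp₂ _⊏_
      }
  ; support              = supp
  }
  where
  module P = LabeledPoset P
  module Q = LabeledPoset Q
  module P< = IsStrictPartialOrder P.isStrictPartialOrder
  module Q< = IsStrictPartialOrder Q.isStrictPartialOrder

  _⊏_ : Rel ℕ 0ℓ
  x ⊏ y = x P.≺ y ⊎ x Q.≺ y ⊎ (x ∈ P.labels × y ∈ Q.labels)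

  irrefl : Irreflexive _≡_ _⊏_
  irrefl eq   (inj₁ p)                = P<.irrefl eq p
  irrefl eq   (inj₂ (inj₁ q))         = Q<.irrefl eq q
  irrefl refl (inj₂ (inj₂ (x∈ , y∈))) = P#Q (x∈ , y∈)

  transitive : Transitive _⊏_
  transitive (inj₁ p)               (inj₁ p′)               = inj₁ (P<.trans p p′)
  transitive (inj₁ p)               (inj₂ (inj₁ q))         =
    ⊥-elim (P#Q (proj₂ (P.support p) , proj₁ (Q.support q)))
  transitive (inj₁ p)               (inj₂ (inj₂ (_ , z∈)))  =
    inj₂ (inj₂ (proj₁ (P.support p) , z∈))
  transitive (inj₂ (inj₁ q))        (inj₁ p)                =
    ⊥-elim (P#Q (proj₁ (P.support p) , proj₂ (Q.support q)))
  transitive (inj₂ (inj₁ q))        (inj₂ (inj₁ q′))        = inj₂ (inj₁ (Q<.trans q q′))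
  transitive (inj₂ (inj₁ q))        (inj₂ (inj₂ (y∈ , _)))  =
    ⊥-elim (P#Q (y∈ , proj₂ (Q.support q)))
  transitive (inj₂ (inj₂ (_ , y∈))) (inj₁ p)                =
    ⊥-elim (P#Q (proj₁ (P.support p) , y∈))
  transitive (inj₂ (inj₂ (x∈ , _))) (inj₂ (inj₁ q))         =
    inj₂ (inj₂ (x∈ , proj₂ (Q.support q)))
  transitive (inj₂ (inj₂ (_ , y∈))) (inj₂ (inj₂ (y∈′ , _))) = ⊥-elim (P#Q (y∈′ , y∈))

  supp : ∀ {x y} → x ⊏ y → x ∈ P.labels ++ Q.labels × y ∈ P.labels ++ Q.labels
  supp (inj₁ p)                = let (x∈ , y∈) = P.support p in ∈-++⁺ˡ x∈ , ∈-++⁺ˡ y∈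
  supp (inj₂ (inj₁ q))         =
    let (x∈ , y∈) = Q.support q in ∈-++⁺ʳ P.labels x∈ , ∈-++⁺ʳ P.labels y∈
  supp (inj₂ (inj₂ (x∈ , y∈))) = ∈-++⁺ˡ x∈ , ∈-++⁺ʳ P.labels y∈

mutual
  ⨁ : (Ps : List LabeledPoset) → AllPairs DisjointLabels Ps → LabeledPoset
  ⨁ []       []       = antichain 0 0
  ⨁ (P ∷ Ps) (d ∷ ds) = P ⊕ ⨁ Ps ds [ ⨁-disjoint P Ps d ds ]

  ⨁-disjoint : ∀ P Ps → All (DisjointLabels P) Ps → (ds : AllPairs DisjointLabels Ps) →
               DisjointLabels P (⨁ Ps ds)
  ⨁-disjoint P []       []       []       (_ , ())
  ⨁-disjoint P (Q ∷ Qs) (d ∷ ds) (e ∷ es) (x∈P , x∈) with ∈-++⁻ (labels Q) x∈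
  ... | inj₁ x∈Q = d (x∈P , x∈Q)
  ... | inj₂ x∈Qs = ⨁-disjoint P Qs ds es (x∈P , x∈Qs)

------------------------------------------------------------------------
-- The posets P_α

-- The antichains of the given sizes, labeled consecutively from o + 1 in odd
-- positions and from e + 1 in even positions; the first antichain is in odd
-- (respectively even) position.
mutual
  oddFirst : (o e : ℕ) → List ℕ → List LabeledPoset
  oddFirst o e []       = []
  oddFirst o e (a ∷ as) = antichain o a ∷ evenFirst (o + a) e as

  evenFirst : (o e : ℕ) → List ℕ → List LabeledPoset
  evenFirst o e []       = []
  evenFirst o e (a ∷ as) = antichain e a ∷ oddFirst o (e + a) as

∈-antichain : ∀ {s k x} → x ∈ labels (antichain s k) → s < x × x ≤ s + k
∈-antichain {s} x∈ with ∈-applyUpTo⁻ _ x∈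
... | i , i<k , refl = s≤s (m≤m+n s i) , +-monoʳ-< s i<k

LabelsIn : (e E o : ℕ) → LabeledPoset → Set
LabelsIn e E o P = ∀ x → x ∈ labels P → (e < x × x ≤ e + E) ⊎ o < x

mutual
  oddFirst-labels : ∀ o e as → All (LabelsIn e (evenSum as) o) (oddFirst o e as)
  oddFirst-labels o e []       = []
  oddFirst-labels o e (a ∷ as) =
    (λ _ x∈ → inj₂ (proj₁ (∈-antichain {o} x∈))) ∷
    All.map (λ h x x∈ → weaken (h x x∈)) (evenFirst-labels (o + a) e as)
    where
    weaken : ∀ {x} {A : Set} → A ⊎ o + a < x → A ⊎ o < x
    weaken (inj₁ p) = inj₁ p
    weaken (inj₂ q) = inj₂ (≤-<-trans (m≤m+n o a) q)

  evenFirst-labels : ∀ o e as → All (LabelsIn e (oddSum as) o) (evenFirst o e as)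
  evenFirst-labels o e []       = []
  evenFirst-labels o e (a ∷ as) =
    (λ _ x∈ → let (l , u) = ∈-antichain {e} x∈ in
       inj₁ (l , ≤-trans u (≤-trans (m≤m+n _ _) (≤-reflexive (+-assoc e a _))))) ∷
    All.map (λ h x x∈ → weaken (h x x∈)) (oddFirst-labels o (e + a) as)
    where
    weaken : ∀ {x B} → (e + a < x × x ≤ e + a + B) ⊎ o < x →
             (e < x × x ≤ e + (a + B)) ⊎ o < x
    weaken {B = B} (inj₁ (l , u)) =
      inj₁ (≤-<-trans (m≤m+n e a) l , ≤-trans u (≤-reflexive (+-assoc e a B)))
    weaken (inj₂ q) = inj₂ q

mutual
  oddFirst-disjoint : ∀ o e as → e + evenSum as ≤ o → AllPairs DisjointLabels (oddFirst o e as)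
  oddFirst-disjoint o e []       _  = []
  oddFirst-disjoint o e (a ∷ as) le =
    All.map (λ { h (x∈ , x∈′) → let (l , u) = ∈-antichain {o} x∈ in clash l u (h _ x∈′) })
      (evenFirst-labels (o + a) e as) ∷
    evenFirst-disjoint (o + a) e as (≤-trans le (m≤m+n o a))
    where
    clash : ∀ {x} → o < x → x ≤ o + a → (e < x × x ≤ e + oddSum as) ⊎ o + a < x → ⊥
    clash l u (inj₁ (_ , v)) = <⇒≱ l (≤-trans v le)
    clash l u (inj₂ q)       = <⇒≱ q u

  evenFirst-disjoint : ∀ o e as → e + oddSum as ≤ o → AllPairs DisjointLabels (evenFirst o e as)
  evenFirst-disjoint o e []       _  = []
  evenFirst-disjoint o e (a ∷ as) le =
    All.map (λ { h (x∈ , x∈′) → clash (proj₂ (∈-antichain {e} x∈)) (h _ x∈′) })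
      (oddFirst-labels o (e + a) as) ∷
    oddFirst-disjoint o (e + a) as (≤-trans (≤-reflexive (+-assoc e a _)) le)
    where
    clash : ∀ {x} → x ≤ e + a → (e + a < x × x ≤ e + a + evenSum as) ⊎ o < x → ⊥
    clash u (inj₁ (l , _)) = <⇒≱ l u
    clash u (inj₂ q)       =
      <⇒≱ q (≤-trans u (≤-trans (m≤m+n _ _) (≤-trans (≤-reflexive (+-assoc e a _)) le)))

-- Even-position antichains get the labels 1, …, evenSum, odd-position ones the
-- remaining labels.
Poset : Composition → LabeledPoset
Poset α = ⨁ (oddFirst (evenSum (parts α)) 0 (parts α))
            (oddFirst-disjoint (evenSum (parts α)) 0 (parts α) ≤-refl)

-- For the empty composition this is F of the empty poset; see N-𝟎.
N : Composition → Series
N α = F (Poset α)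

-- The constant series 1.
1ˢ : Series
1ˢ e = if does (All.all? (_≟ 0) e) then 1ℤ else 0ℤ

N-𝟎 : N 𝟎 ≈ 1ˢ
N-𝟎 []          = refl
N-𝟎 (zero  ∷ e) = N-𝟎 e
N-𝟎 (suc k ∷ e) = refl

------------------------------------------------------------------------
-- Expansions in the family N

-- c is a finitely supported family of coefficients with f = ∑_ν c_ν N_ν; S is
-- any finite set of compositions containing the support.
IsExpansion : Series → (Composition → ℤ) → Set
IsExpansion f c = ∃ λ S →
  Unique S × (∀ ν → c ν ≢ 0ℤ → ν ∈ S) × f ≈ ∑ S (λ ν → c ν · N ν)

-- The ℤ-linear span of the N_ν with ν satisfying R.
Span : Pred Composition 0ℓ → Pred Series 0ℓ
Span R f = ∃ λ c → IsExpansion f c × (∀ ν → c ν ≢ 0ℤ → R ν)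

{-# OPTIONS --safe #-}

-- Cut a linear extension of P_α into segments of lengths e₁, e₂, …: the
-- coefficient of x^e in N_α counts those extensions whose segments all increase.
-- In such a segment the elements of even antichains precede those of odd ones, so
-- each variable offers an even slot followed by an odd slot, and N_α counts the ways
-- of filling the slots with the blocks of α in their order.  Superposing a filling
-- for α with one for β and cutting at the changes of parity groups the fillings by
-- ordered set partitions of the two label sets, whose block sizes form a composition
-- ν with r(ν) = r(α) + r(β); hence N_α N_β is the sum of these N_ν.
--
-- An arbitrary expansion agrees with this one because the N_ν are independent.
-- Count the permutations that ascend through the odd antichains of P_ν, descend
-- through the even ones, and ascend from each even one to the next odd one: this
-- functional is 1 on N_ν and vanishes on N_μ for all μ lexicographically smaller
-- than ν.

module Submission where

open import Defs
open import Algebra.Properties.AbelianGroup using (∙-cancelˡ)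
import Algebra.Properties.CommutativeSemigroup as CommutativeSemigroup
open import Data.Bool.Base using (Bool; true; false; if_then_else_; _∧_; not)
open import Data.Bool.ListAction using (all)
open import Data.Bool.Properties using (∧-assoc; ∧-zeroʳ)
open import Data.Empty using (⊥)
open import Data.Integer.Base using (ℤ; 0ℤ; 1ℤ; -1ℤ; _≤_; +≤+)
  renaming (_+_ to _+ℤ_; _*_ to _*ℤ_; _-_ to _-ℤ_; -_ to -ℤ_; +_ to +ℕ_)
import Data.Integer.Properties as ℤ
open import Data.List.Base
  using (List; []; _∷_; _++_; map; foldr; filter; concatMap; cartesianProductWith; deduplicate
        ; length; null; take; drop; upTo; applyUpTo)
import Data.List.Membership.DecPropositional as DecMembership
open import Data.List.Membership.Propositional using (_∈_; find)
open import Data.List.Membership.Propositional.Properties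
  using (∈-map⁺; ∈-map⁻; ∈-++⁻; ∈-concatMap⁻; ∈-deduplicate⁺)
open import Data.List.Properties using (≡-dec; map-∘; filter-notAll; length-applyUpTo)
open import Data.List.Relation.Binary.Lex.Strict using (Lex-<; this; next; halt; <-strictTotalOrder)
open import Data.List.Relation.Binary.Permutation.Propositional
  using (_↭_; ↭-refl; ↭-sym; ↭-trans; prep; swap; ↭⇒↭ₛ)
open import Data.List.Relation.Binary.Permutation.Propositional.Properties
  using (All-resp-↭; ∈-resp-↭; ↭-length)
import Data.List.Relation.Binary.Permutation.Setoid.Properties as Permutation
open import Data.List.Relation.Binary.Pointwise using (Pointwise-≡⇒≡; ≡⇒Pointwise-≡)
open import Data.List.Relation.Binary.Sublist.Propositional
  using ([]; _∷_; _∷ʳ_; from∈; to∈; lookup) renaming (_⊆_ to _⊑_)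
open import Data.List.Relation.Binary.Sublist.Propositional.Properties using (∷ˡ⁻; All-resp-⊆)
open import Data.List.Relation.Binary.Subset.Propositional using (_⊆_)
open import Data.List.Relation.Unary.All as All using (All; []; _∷_)
open import Data.List.Relation.Unary.AllPairs using (AllPairs; []; _∷_)
import Data.List.Relation.Unary.AllPairs.Properties as AllPairs
open import Data.List.Relation.Unary.Any as Any using (here; there)
open import Data.List.Relation.Unary.Unique.DecPropositional.Properties using (deduplicate-!)
open import Data.List.Relation.Unary.Unique.Propositional using (Unique)
open import Data.Nat.Base as ℕ using (ℕ; zero; suc; _+_; _∸_; NonZero; _≡ᵇ_)
open import Data.Nat.Combinatorics
  using (nCn≡1; k>n⇒nCk≡0; nCk≡nC[n∸k]; nCk+nC[k+1]≡[n+1]C[k+1]) renaming (_C_ to _choose_)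
open import Data.Nat.Induction using (<-wellFounded)
open import Data.Nat.ListAction using (sum)
import Data.Nat.Properties as ℕ
open import Data.Product.Base using (_×_; _,_; proj₁; proj₂; ∃; uncurry; map₁; map₂)
open import Data.Sum.Base using (_⊎_; inj₁; inj₂)
open import Function.Base using (_∘_)
open import Function.Bundles using (mk⇔)
open import Induction.WellFounded using (Acc; acc)
open import Level using (0ℓ)
open import Relation.Binary.Bundles using (StrictTotalOrder)
open import Relation.Binary.Definitions using (DecidableEquality; tri<; tri≈; tri>)
open import Relation.Binary.PropositionalEquality hiding (resp)
open import Relation.Binary.Structures using (IsStrictPartialOrder)
open import Relation.Nullary.Decidable
  using (Dec; yes; no; does; ¬?; _×-dec_; map′; recompute; dec-true; dec-false; does-⇔)
open import Relation.Nullary.Negation using (¬_; contradiction)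
open import Relation.Unary using (Pred; Decidable)
open CommutativeSemigroup ℕ.+-commutativeSemigroup using () renaming (interchange to +-interchange)
open CommutativeSemigroup ℤ.+-commutativeSemigroup using () renaming (interchange to +ℤ-interchange)
open CommutativeSemigroup ℤ.*-commutativeSemigroup using () renaming (interchange to *-interchange)
open ≡-Reasoning

-- The bijection behind the product is never built: both sides are integer sums over finite lists
-- with repetitions, and identities between sums replace it. Its content is local to one slot. Let
-- the two fillings put pieces `i` and `j` into the current slot. What is left of their blocks can
-- resume two slots later at the earliest, and there it joins the same block of the superposition
-- exactly when the slot in between stays empty in both. So choosing a block of ν first and then its
-- part in the slot, or choosing the parts of both factors first and superposing the rest, gives the
-- same sum: the binomial coproduct is compatible with the addition of block sizes
-- (`Σ-splits-bialgebra`).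
--
-- The functionals vanish for two reasons. The labels of an odd antichain exceed those of the next
-- even one, so an increasing segment cannot leave it; the labels of an even antichain lie below
-- those of the next odd one, so a run of descents cannot leave it. Hence a smaller or missing part
-- at the first difference leaves nothing to count.

private
  variable
    A B : Set

-- Finite sums of integers

Σ : List A → (A → ℤ) → ℤ
Σ xs φ = foldr _+ℤ_ 0ℤ (map φ xs)

syntax Σ xs (λ x → φ) = Σ[ x ← xs ] φ

⟦_⟧ : Bool → ℤ
⟦ b ⟧ = if b then 1ℤ else 0ℤ

⟦∧⟧ : ∀ b c → ⟦ b ∧ c ⟧ ≡ ⟦ b ⟧ *ℤ ⟦ c ⟧
⟦∧⟧ true  c = sym (ℤ.*-identityˡ _)
⟦∧⟧ false c = refl

Σ-cong∈ : ∀ (xs : List A) {φ ψ : A → ℤ} → (∀ {x} → x ∈ xs → φ x ≡ ψ x) → Σ xs φ ≡ Σ xs ψ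
Σ-cong∈ []       eq = refl
Σ-cong∈ (x ∷ xs) eq = cong₂ _+ℤ_ (eq (here refl)) (Σ-cong∈ xs (eq ∘ there))

Σ-cong : ∀ (xs : List A) {φ ψ : A → ℤ} → (∀ x → φ x ≡ ψ x) → Σ xs φ ≡ Σ xs ψ
Σ-cong xs eq = Σ-cong∈ xs (λ {x} _ → eq x)

Σ-++ : ∀ (xs : List A) {ys} (φ : A → ℤ) → Σ (xs ++ ys) φ ≡ Σ xs φ +ℤ Σ ys φ
Σ-++ []       φ = sym (ℤ.+-identityˡ _)
Σ-++ (x ∷ xs) φ = trans (cong (φ x +ℤ_) (Σ-++ xs φ)) (sym (ℤ.+-assoc (φ x) _ _))

Σ-map : ∀ (f : A → B) xs (φ : B → ℤ) → Σ (map f xs) φ ≡ Σ xs (φ ∘ f)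
Σ-map f []       φ = refl
Σ-map f (x ∷ xs) φ = cong (φ (f x) +ℤ_) (Σ-map f xs φ)

Σ-concatMap : ∀ (f : A → List B) xs (φ : B → ℤ) →
              Σ (concatMap f xs) φ ≡ Σ[ x ← xs ] Σ (f x) φ
Σ-concatMap f []       φ = refl
Σ-concatMap f (x ∷ xs) φ =
  trans (Σ-++ (f x) φ) (cong (Σ (f x) φ +ℤ_) (Σ-concatMap f xs φ))

Σ-zero : ∀ (xs : List A) {φ : A → ℤ} → (∀ {x} → x ∈ xs → φ x ≡ 0ℤ) → Σ xs φ ≡ 0ℤ
Σ-zero []       eq = refl
Σ-zero (x ∷ xs) eq = cong₂ _+ℤ_ (eq (here refl)) (Σ-zero xs (eq ∘ there))

Σ-+ : ∀ (xs : List A) (φ ψ : A → ℤ) → Σ[ x ← xs ] (φ x +ℤ ψ x) ≡ Σ xs φ +ℤ Σ xs ψ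
Σ-+ []       φ ψ = refl
Σ-+ (x ∷ xs) φ ψ =
  trans (cong (φ x +ℤ ψ x +ℤ_) (Σ-+ xs φ ψ)) (+ℤ-interchange (φ x) (ψ x) _ _)

Σ-*ˡ : ∀ k (xs : List A) (φ : A → ℤ) → k *ℤ Σ xs φ ≡ Σ[ x ← xs ] (k *ℤ φ x)
Σ-*ˡ k []       φ = ℤ.*-zeroʳ k
Σ-*ˡ k (x ∷ xs) φ =
  trans (ℤ.*-distribˡ-+ k (φ x) _) (cong (k *ℤ φ x +ℤ_) (Σ-*ˡ k xs φ))

Σ-*ʳ : ∀ (xs : List A) (φ : A → ℤ) k → Σ xs φ *ℤ k ≡ Σ[ x ← xs ] (φ x *ℤ k)
Σ-*ʳ xs φ k = trans (ℤ.*-comm _ k)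
  (trans (Σ-*ˡ k xs φ) (Σ-cong xs (λ x → ℤ.*-comm k (φ x))))

Σ-swap : ∀ (xs : List A) (ys : List B) (φ : A → B → ℤ) →
         Σ[ x ← xs ] Σ[ y ← ys ] φ x y ≡ Σ[ y ← ys ] Σ[ x ← xs ] φ x y
Σ-swap []       ys φ = sym (Σ-zero ys {λ _ → 0ℤ} (λ _ → refl))
Σ-swap (x ∷ xs) ys φ =
  trans (cong (Σ ys (φ x) +ℤ_) (Σ-swap xs ys φ)) (sym (Σ-+ ys (φ x) (λ y → Σ[ x ← xs ] φ x y)))

Σ-*-Σ : ∀ (xs : List A) (ys : List B) (φ : A → ℤ) (ψ : B → ℤ) →
        Σ xs φ *ℤ Σ ys ψ ≡ Σ[ x ← xs ] Σ[ y ← ys ] (φ x *ℤ ψ y)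
Σ-*-Σ xs ys φ ψ = trans (Σ-*ʳ xs φ _) (Σ-cong xs (λ x → Σ-*ˡ (φ x) ys ψ))

Σ-filter : ∀ {P : Pred A 0ℓ} (P? : Decidable P) xs (φ : A → ℤ) →
           Σ (filter P? xs) φ ≡ Σ[ x ← xs ] (⟦ does (P? x) ⟧ *ℤ φ x)
Σ-filter P? []       φ = refl
Σ-filter P? (x ∷ xs) φ with does (P? x)
... | true  = cong₂ _+ℤ_ (sym (ℤ.*-identityˡ (φ x))) (Σ-filter P? xs φ)
... | false = trans (Σ-filter P? xs φ) (sym (ℤ.+-identityˡ _))

Σ₂ : List (A × B) → (A → B → ℤ) → ℤ
Σ₂ ps φ = Σ ps (uncurry φ)

syntax Σ₂ ps (λ x y → φ) = Σ[ x , y ← ps ] φ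

Σ₂-cong : ∀ (ps : List (A × B)) {φ ψ : A → B → ℤ} →
          (∀ x y → φ x y ≡ ψ x y) → Σ₂ ps φ ≡ Σ₂ ps ψ
Σ₂-cong ps eq = Σ-cong ps (λ { (x , y) → eq x y })

-- Selections and splittings

selections : List A → List (List A × List A)
selections []       = ([] , []) ∷ []
selections (x ∷ xs) = map (map₁ (x ∷_)) (selections xs) ++
                      map (map₂ (x ∷_)) (selections xs)

-- The ways of distributing a distinguishable elements over two groups, recorded by
-- the group sizes, so that (i , r) occurs (i + r) choose i times.
splits : ℕ → List (ℕ × ℕ)
splits zero    = (0 , 0) ∷ []
splits (suc a) = map (map₁ suc) (splits a) ++ map (map₂ suc) (splits a)

Σ-selections-∷ : ∀ (x : A) xs (φ : List A → List A → ℤ) →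
  Σ₂ (selections (x ∷ xs)) φ ≡
  Σ[ ys , zs ← selections xs ] φ (x ∷ ys) zs +ℤ Σ[ ys , zs ← selections xs ] φ ys (x ∷ zs)
Σ-selections-∷ x xs φ = trans (Σ-++ (map _ (selections xs)) _)
  (cong₂ _+ℤ_ (Σ-map _ (selections xs) _) (Σ-map _ (selections xs) _))

Σ-splits-suc : ∀ a (φ : ℕ → ℕ → ℤ) →
  Σ₂ (splits (suc a)) φ ≡
  Σ[ i , r ← splits a ] φ (suc i) r +ℤ Σ[ i , r ← splits a ] φ i (suc r)
Σ-splits-suc a φ = trans (Σ-++ (map _ (splits a)) _)
  (cong₂ _+ℤ_ (Σ-map _ (splits a) _) (Σ-map _ (splits a) _))

Σ-splits-cong : ∀ a {φ ψ : ℕ → ℕ → ℤ} → (∀ i r → i + r ≡ a → φ i r ≡ ψ i r) →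
                Σ₂ (splits a) φ ≡ Σ₂ (splits a) ψ
Σ-splits-cong zero    eq = cong (_+ℤ 0ℤ) (eq 0 0 refl)
Σ-splits-cong (suc a) {φ} {ψ} eq = begin
  Σ₂ (splits (suc a)) φ
    ≡⟨ Σ-splits-suc a φ ⟩
  Σ[ i , r ← splits a ] φ (suc i) r +ℤ Σ[ i , r ← splits a ] φ i (suc r)
    ≡⟨ cong₂ _+ℤ_ (Σ-splits-cong a λ i r p → eq (suc i) r (cong suc p))
                  (Σ-splits-cong a λ i r p → eq i (suc r) (trans (ℕ.+-suc i r) (cong suc p))) ⟩
  Σ[ i , r ← splits a ] ψ (suc i) r +ℤ Σ[ i , r ← splits a ] ψ i (suc r)
    ≡⟨ Σ-splits-suc a ψ ⟨
  Σ₂ (splits (suc a)) ψ ∎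

Σ-selections-length : ∀ (xs : List A) (φ : ℕ → ℕ → ℤ) →
  Σ[ ys , zs ← selections xs ] φ (length ys) (length zs) ≡ Σ₂ (splits (length xs)) φ
Σ-selections-length []       φ = refl
Σ-selections-length (x ∷ xs) φ = begin
  Σ[ ys , zs ← selections (x ∷ xs) ] φ (length ys) (length zs)
    ≡⟨ Σ-selections-∷ x xs (λ ys zs → φ (length ys) (length zs)) ⟩
  _ ≡⟨ cong₂ _+ℤ_ (Σ-selections-length xs (λ i r → φ (suc i) r))
                  (Σ-selections-length xs (λ i r → φ i (suc r))) ⟩
  _ ≡⟨ Σ-splits-suc (length xs) φ ⟨
  Σ₂ (splits (suc (length xs))) φ ∎

-- Both sides distribute `a` elements over three groups. `splits a` lists the terms of the coproduct
-- of x^a in the polynomial ring with x primitive, and this is coassociativity.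
splits-coassoc : ∀ a (φ : ℕ → ℕ → ℕ → ℤ) →
  Σ[ m , r ← splits a ] Σ[ p , q ← splits m ] φ p q r ≡
  Σ[ p , m ← splits a ] Σ[ q , r ← splits m ] φ p q r
splits-coassoc zero    φ = refl
splits-coassoc (suc a) φ = begin
  Σ[ m , r ← splits (suc a) ] Σ[ p , q ← splits m ] φ p q r
    ≡⟨ Σ-splits-suc a _ ⟩
  Σ[ m , r ← splits a ] Σ[ p , q ← splits (suc m) ] φ p q r +ℤ Z
    ≡⟨ cong (_+ℤ Z) (Σ₂-cong (splits a) λ m r → Σ-splits-suc m (λ p q → φ p q r)) ⟩
  Σ[ m , r ← splits a ] (Σ[ p , q ← splits m ] φ (suc p) q r +ℤ
                         Σ[ p , q ← splits m ] φ p (suc q) r) +ℤ Z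
    ≡⟨ cong (_+ℤ Z) (Σ-+ (splits a) _ _) ⟩
  _ ≡⟨ ℤ.+-assoc (Σ[ m , r ← splits a ] Σ[ p , q ← splits m ] φ (suc p) q r) _ Z ⟩
  _ ≡⟨ cong₂ _+ℤ_ (splits-coassoc a (λ p q r → φ (suc p) q r))
         (cong₂ _+ℤ_ (splits-coassoc a (λ p q r → φ p (suc q) r))
                     (splits-coassoc a (λ p q r → φ p q (suc r)))) ⟩
  _ ≡⟨ cong (Y +ℤ_) (Σ-+ (splits a) _ _) ⟨
  Y +ℤ Σ[ p , m ← splits a ] (Σ[ q , r ← splits m ] φ p (suc q) r +ℤ
                              Σ[ q , r ← splits m ] φ p q (suc r))
    ≡⟨ cong (Y +ℤ_) (Σ₂-cong (splits a) λ p m → Σ-splits-suc m (φ p)) ⟨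
  Y +ℤ Σ[ p , m ← splits a ] Σ[ q , r ← splits (suc m) ] φ p q r
    ≡⟨ Σ-splits-suc a _ ⟨
  Σ[ p , m ← splits (suc a) ] Σ[ q , r ← splits m ] φ p q r ∎
  where
  Y = Σ[ p , m ← splits a ] Σ[ q , r ← splits m ] φ (suc p) q r
  Z = Σ[ m , r ← splits a ] Σ[ p , q ← splits m ] φ p q (suc r)

-- Multiplicativity of the same coproduct on x^a times x^b.
splits-+ : ∀ a b (φ : ℕ → ℕ → ℤ) →
  Σ₂ (splits (a + b)) φ ≡
  Σ[ i , r ← splits a ] Σ[ j , s ← splits b ] φ (i + j) (r + s)
splits-+ zero    b φ = sym (ℤ.+-identityʳ _)
splits-+ (suc a) b φ = begin
  Σ₂ (splits (suc (a + b))) φ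
    ≡⟨ Σ-splits-suc (a + b) φ ⟩
  _ ≡⟨ cong₂ _+ℤ_ (splits-+ a b (λ i r → φ (suc i) r)) (splits-+ a b (λ i r → φ i (suc r))) ⟩
  _ ≡⟨ Σ-splits-suc a _ ⟨
  Σ[ i , r ← splits (suc a) ] Σ[ j , s ← splits b ] φ (i + j) (r + s) ∎

-- Slots

-- A state a₀ ∷ a₁ ∷ … lists the sizes of the blocks still to be placed, with
-- parities alternating from that of the current slot; a leading 0 means that the
-- next block has the other parity.
hd : List ℕ → ℕ
hd []      = 0
hd (a ∷ _) = a

tl : List ℕ → List ℕ
tl []       = []
tl (_ ∷ as) = as

-- A remainder keeps the parity of the slot just passed, so it has to sit out the next one; the 0
-- records this.
advance : ℕ → List ℕ → List ℕ
advance zero    as = as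
advance (suc r) as = 0 ∷ suc r ∷ as

-- The ways of filling the current slot: the number of elements placed in it, and
-- the state in front of the next slot.
slot : List ℕ → List (ℕ × List ℕ)
slot s = map (map₂ (λ r → advance r (tl s))) (splits (hd s))

skip : List ℕ → List ℕ
skip s = advance (hd s) (tl s)

Σ-slot : ∀ s (φ : ℕ → List ℕ → ℤ) →
      Σ₂ (slot s) φ ≡ Σ[ i , r ← splits (hd s) ] φ i (advance r (tl s))
Σ-slot s φ = Σ-map _ (splits (hd s)) _

-- The second component excludes exactly `0 ∷ []`, a finished state that would look unfinished.
Valid : List ℕ → Set
Valid s = All NonZero (tl s) × null (skip s) ≡ null s

sum-advance : ∀ r as → sum (advance r as) ≡ r + sum as
sum-advance zero    as = refl
sum-advance (suc r) as = refl

sum-hd-tl : ∀ s → hd s + sum (tl s) ≡ sum s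
sum-hd-tl []      = refl
sum-hd-tl (a ∷ s) = refl

advance-valid : ∀ r {as} → All NonZero as → Valid (advance r as)
advance-valid (suc r) ps                   = _∷_ {x = suc r} _ ps , refl
advance-valid zero    []                   = [] , refl
advance-valid zero    (_∷_ {x = suc a} p ps) = ps , refl

Σ-slot-cong : ∀ {s} {φ ψ : ℕ → List ℕ → ℤ} → Valid s →
  (∀ i s′ → Valid s′ → i + sum s′ ≡ sum s → φ i s′ ≡ ψ i s′) → Σ₂ (slot s) φ ≡ Σ₂ (slot s) ψ
Σ-slot-cong {s} {φ} {ψ} (ps , _) eq = begin
  Σ₂ (slot s) φ ≡⟨ Σ-slot s φ ⟩
  _ ≡⟨ Σ-splits-cong (hd s) (λ i r i+r≡hd → eq i _ (advance-valid r ps) (begin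
         i + sum (advance r (tl s)) ≡⟨ cong (i +_) (sum-advance r (tl s)) ⟩
         i + (r + sum (tl s))       ≡⟨ ℕ.+-assoc i r _ ⟨
         i + r + sum (tl s)         ≡⟨ cong (_+ sum (tl s)) i+r≡hd ⟩
         hd s + sum (tl s)          ≡⟨ sum-hd-tl s ⟩
         sum s                      ∎)) ⟩
  _ ≡⟨ Σ-slot s ψ ⟨
  Σ₂ (slot s) ψ ∎

Σ-splits-zero : ∀ a (φ : ℕ → ℤ) → Σ[ i , r ← splits a ] (⟦ i ≡ᵇ 0 ⟧ *ℤ φ r) ≡ φ a
Σ-splits-zero zero    φ = trans (ℤ.+-identityʳ _) (ℤ.*-identityˡ (φ 0))
Σ-splits-zero (suc a) φ = begin
  Σ[ i , r ← splits (suc a) ] (⟦ i ≡ᵇ 0 ⟧ *ℤ φ r) ≡⟨ Σ-splits-suc a _ ⟩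
  _ ≡⟨ cong (_+ℤ Σ[ i , r ← splits a ] (⟦ i ≡ᵇ 0 ⟧ *ℤ φ (suc r)))
         (Σ-zero (splits a) (λ {p} _ → refl)) ⟩
  _ ≡⟨ ℤ.+-identityˡ _ ⟩
  _ ≡⟨ Σ-splits-zero a (φ ∘ suc) ⟩
  φ (suc a) ∎

Σ-slot-zero : ∀ s (φ : List ℕ → ℤ) → Σ[ i , s′ ← slot s ] (⟦ i ≡ᵇ 0 ⟧ *ℤ φ s′) ≡ φ (skip s)
Σ-slot-zero s φ = trans (Σ-slot s _) (Σ-splits-zero (hd s) (λ r → φ (advance r (tl s))))

-- The skipped slot is the one that a positive remainder has to sit out; afterwards the remainder is
-- current again. For `r = 0` the next block is passed over, and both sides place nothing.
Σ-slot-skip-advance : ∀ r {as} → All NonZero as → (φ : ℕ → List ℕ → ℤ) →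
  Σ₂ (slot (skip (advance r as))) φ ≡ Σ[ p , q ← splits r ] φ p (advance q as)
Σ-slot-skip-advance (suc r) ps φ = Σ-slot (suc r ∷ _) φ
Σ-slot-skip-advance zero [] φ = refl
Σ-slot-skip-advance zero (_∷_ {x = suc a} p ps) φ = refl

infixr 5 _◂_
-- Normalises `0 ∷ []`, which `Valid` forbids, to the finished state.
_◂_ : ℕ → List ℕ → List ℕ
zero ◂ [] = []
k    ◂ s  = k ∷ s

Σ-slot-◂ : ∀ k s (φ : ℕ → List ℕ → ℤ) →
        Σ₂ (slot (k ◂ s)) φ ≡ Σ[ i , r ← splits k ] φ i (advance r s)
Σ-slot-◂ zero    []      φ = refl
Σ-slot-◂ zero    (x ∷ s) φ = refl
Σ-slot-◂ (suc k) s       φ = Σ-slot (suc k ∷ s) φ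

-- Superpositions
grow : ℕ → List (List ℕ) → List (List ℕ)
grow zero    νs = []
grow (suc k) νs = map (suc k ∷_) νs

bothEmpty : List ℕ → List ℕ → Bool
bothEmpty s t = null s ∧ null t

-- The block sizes of the superpositions of s and t in which the current slot gets a
-- nonempty block.  The first argument bounds the recursion depth; every bound that
-- is at least sum s + sum t gives the same result.
mutual
  M° : ℕ → List ℕ → List ℕ → List (List ℕ)
  M° n s t = if bothEmpty s t then [] ∷ [] else M⁺ n s t

  M⁺ : ℕ → List ℕ → List ℕ → List (List ℕ)
  M⁺ zero    s t = []
  M⁺ (suc n) s t = concatMap (λ { (i , s′) → concatMap (λ { (j , t′) →
                     grow (i + j) (M° n s′ t′) }) (slot t) }) (slot s)

Σ-M⁺-suc : ∀ n s t ψ → Σ (M⁺ (suc n) s t) ψ ≡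
  Σ[ i , s′ ← slot s ] Σ[ j , t′ ← slot t ] Σ (grow (i + j) (M° n s′ t′)) ψ
Σ-M⁺-suc n s t ψ = trans (Σ-concatMap _ (slot s) ψ)
  (Σ₂-cong (slot s) λ i s′ → Σ-concatMap _ (slot t) ψ)

-- The premise `k ≡ suc k′` tells `M⁺-fuel` that an element has been placed before it calls its
-- induction hypothesis.
Σ-grow-cong : ∀ k {νs νs′} {ψ ψ′ : List ℕ → ℤ} →
  (∀ {k′} → k ≡ suc k′ → ∀ φ → Σ νs φ ≡ Σ νs′ φ) → (∀ ν → ψ (k ∷ ν) ≡ ψ′ (k ∷ ν)) →
  Σ (grow k νs) ψ ≡ Σ (grow k νs′) ψ′
Σ-grow-cong zero    h eq = refl
Σ-grow-cong (suc k) {νs} {νs′} {ψ} {ψ′} h eq = begin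
  Σ (map (suc k ∷_) νs) ψ      ≡⟨ Σ-map (suc k ∷_) νs ψ ⟩
  Σ[ ν ← νs ] ψ (suc k ∷ ν)    ≡⟨ h refl _ ⟩
  Σ[ ν ← νs′ ] ψ (suc k ∷ ν)   ≡⟨ Σ-cong νs′ eq ⟩
  Σ[ ν ← νs′ ] ψ′ (suc k ∷ ν)  ≡⟨ Σ-map (suc k ∷_) νs′ ψ′ ⟨
  Σ (map (suc k ∷_) νs′) ψ′    ∎

-- A recursive call survives `grow` only if `i + j` is positive, so the total size drops with each
-- call that counts. At total size 0 every candidate block is empty and both sums vanish.
M⁺-fuel : ∀ n {s t} ψ → Valid s → Valid t → sum s + sum t ℕ.≤ n →
          Σ (M⁺ n s t) ψ ≡ Σ (M⁺ (suc n) s t) ψ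
M⁺-fuel zero {s} {t} ψ vs vt le = sym (begin
  Σ (M⁺ 1 s t) ψ ≡⟨ Σ-M⁺-suc 0 s t ψ ⟩
  _ ≡⟨ Σ-slot-cong vs (λ i s′ _ p → trans (Σ-slot-cong vt (λ j t′ _ q →
         cong (λ k → Σ (grow k (M° 0 s′ t′)) ψ) (cong₂ _+_ 
           (ℕ.m+n≡0⇒m≡0 i (trans p (ℕ.m+n≡0⇒m≡0 (sum s) (ℕ.n≤0⇒n≡0 le))))
           (ℕ.m+n≡0⇒m≡0 j (trans q (ℕ.m+n≡0⇒n≡0 (sum s) (ℕ.n≤0⇒n≡0 le)))))))
           (Σ-zero (slot t) {λ _ → 0ℤ} (λ _ → refl))) ⟩
  _ ≡⟨ Σ-zero (slot s) {λ _ → 0ℤ} (λ _ → refl) ⟩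
  0ℤ ∎)
M⁺-fuel (suc n) {s} {t} ψ vs vt le = begin
  Σ (M⁺ (suc n) s t) ψ ≡⟨ Σ-M⁺-suc n s t ψ ⟩
  _ ≡⟨ Σ-slot-cong vs (λ i s′ vs′ p → Σ-slot-cong vt (λ j t′ vt′ q →
         Σ-grow-cong (i + j) (λ i+j≡suc φ → M°-fuel φ vs′ vt′ (bound i j p q i+j≡suc)) (λ _ → refl))) ⟩
  _ ≡⟨ Σ-M⁺-suc (suc n) s t ψ ⟨
  Σ (M⁺ (suc (suc n)) s t) ψ ∎
  where
  bound : ∀ i j {x y k} → i + x ≡ sum s → j + y ≡ sum t → i + j ≡ suc k → x + y ℕ.≤ n
  bound i j {x} {y} {k} p q eq = ℕ.≤-trans (ℕ.m≤n+m (x + y) k) (ℕ.s≤s⁻¹ (subst (ℕ._≤ suc n) (begin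
    sum s + sum t     ≡⟨ cong₂ _+_ p q ⟨
    (i + x) + (j + y) ≡⟨ +-interchange i x j y ⟩
    (i + j) + (x + y) ≡⟨ cong (_+ (x + y)) eq ⟩
    suc k + (x + y)   ∎) le))

  M°-fuel : ∀ {s t} φ → Valid s → Valid t → sum s + sum t ℕ.≤ n →
            Σ (M° n s t) φ ≡ Σ (M° (suc n) s t) φ
  M°-fuel {s} {t} φ vs vt le with bothEmpty s t
  ... | true  = refl
  ... | false = M⁺-fuel n φ vs vt le

-- Unfolding without spending fuel: all later identities can keep one fixed `n`.
Σ-M⁺ : ∀ n {s t} ψ → Valid s → Valid t → sum s + sum t ℕ.≤ n → Σ (M⁺ n s t) ψ ≡
  Σ[ i , s′ ← slot s ] Σ[ j , t′ ← slot t ] Σ (grow (i + j) (M° n s′ t′)) ψ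
Σ-M⁺ n {s} {t} ψ vs vt le = trans (M⁺-fuel n ψ vs vt le) (Σ-M⁺-suc n s t ψ)

Σ-slot-cong₂ : ∀ {s t} {φ ψ : ℕ → List ℕ → ℕ → List ℕ → ℤ} n → Valid s → Valid t → sum s + sum t ℕ.≤ n →
  (∀ i s′ j t′ → Valid s′ → Valid t′ → sum s′ + sum t′ ℕ.≤ n → φ i s′ j t′ ≡ ψ i s′ j t′) →
  Σ[ i , s′ ← slot s ] Σ[ j , t′ ← slot t ] φ i s′ j t′ ≡
  Σ[ i , s′ ← slot s ] Σ[ j , t′ ← slot t ] ψ i s′ j t′
Σ-slot-cong₂ n vs vt le eq =
  Σ-slot-cong vs (λ i s′ vs′ p → Σ-slot-cong vt (λ j t′ vt′ q → eq i s′ j t′ vs′ vt′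
    (ℕ.≤-trans (ℕ.+-mono-≤ (subst (sum s′ ℕ.≤_) p (ℕ.m≤n+m _ i))
                           (subst (sum t′ ℕ.≤_) q (ℕ.m≤n+m _ j))) le)))

Σ-slot-+ : ∀ s t (φ ψ : ℕ → List ℕ → ℕ → List ℕ → ℤ) →
  Σ[ i , s′ ← slot s ] Σ[ j , t′ ← slot t ] (φ i s′ j t′ +ℤ ψ i s′ j t′) ≡
  Σ[ i , s′ ← slot s ] Σ[ j , t′ ← slot t ] φ i s′ j t′ +ℤ
  Σ[ i , s′ ← slot s ] Σ[ j , t′ ← slot t ] ψ i s′ j t′
Σ-slot-+ s t φ ψ = trans (Σ₂-cong (slot s) (λ i s′ → Σ-+ (slot t) _ _)) (Σ-+ (slot s) _ _)

-- The sum of ψ over the superpositions of s and t in which the current slot may stay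
-- empty.
𝓜 : ℕ → List ℕ → List ℕ → (List ℕ → ℤ) → ℤ
𝓜 n s t ψ = Σ[ i , s′ ← slot s ] Σ[ j , t′ ← slot t ] Σ[ ν ← M° n s′ t′ ] ψ ((i + j) ◂ ν)

𝓜-cong : ∀ n s t {ψ ψ′} → (∀ ν → ψ ν ≡ ψ′ ν) → 𝓜 n s t ψ ≡ 𝓜 n s t ψ′
𝓜-cong n s t eq = Σ₂-cong (slot s) λ i s′ → Σ₂-cong (slot t) λ j t′ →
  Σ-cong (M° n s′ t′) λ ν → eq _

⟦+≡0⟧ : ∀ i j → ⟦ i + j ≡ᵇ 0 ⟧ ≡ ⟦ i ≡ᵇ 0 ⟧ *ℤ ⟦ j ≡ᵇ 0 ⟧
⟦+≡0⟧ zero    j = sym (ℤ.*-identityˡ _)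
⟦+≡0⟧ (suc i) j = refl

Σ-◂ : ∀ k νs (ψ : List ℕ → ℤ) →
  Σ[ ν ← νs ] ψ (k ◂ ν) ≡ Σ (grow k νs) ψ +ℤ ⟦ k ≡ᵇ 0 ⟧ *ℤ Σ[ ν ← νs ] ψ (0 ◂ ν)
Σ-◂ zero    νs ψ = sym (trans (ℤ.+-identityˡ _) (ℤ.*-identityˡ _))
Σ-◂ (suc k) νs ψ = sym (trans (ℤ.+-identityʳ _) (Σ-map (suc k ∷_) νs ψ))

Σ-M⁺-∷ : ∀ n {s t} {ψ ψ′ : List ℕ → ℤ} → Valid s → Valid t → sum s + sum t ℕ.≤ n →
  (∀ k ν → ψ (k ∷ ν) ≡ ψ′ (k ∷ ν)) → Σ (M⁺ n s t) ψ ≡ Σ (M⁺ n s t) ψ′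
Σ-M⁺-∷ n {s} {t} {ψ} {ψ′} vs vt le eq = begin
  Σ (M⁺ n s t) ψ ≡⟨ Σ-M⁺ n ψ vs vt le ⟩
  _ ≡⟨ Σ₂-cong (slot s) (λ i s′ → Σ₂-cong (slot t) (λ j t′ →
         Σ-grow-cong (i + j) {M° n s′ t′} (λ _ _ → refl) (eq _))) ⟩
  _ ≡⟨ Σ-M⁺ n ψ′ vs vt le ⟨
  Σ (M⁺ n s t) ψ′ ∎

-- The two terms separate a nonempty current slot from an empty one; the latter forces `i = j = 0`,
-- which leaves both factors in their skipped states.
𝓜-M⁺ : ∀ n {s t} ψ → Valid s → Valid t → sum s + sum t ℕ.≤ n → 𝓜 n s t ψ ≡
  Σ (M⁺ n s t) ψ +ℤ Σ[ ν ← M° n (skip s) (skip t) ] ψ (0 ◂ ν)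
𝓜-M⁺ n {s} {t} ψ vs vt le = begin
  𝓜 n s t ψ
    ≡⟨ Σ₂-cong (slot s) (λ i s′ → Σ₂-cong (slot t) (λ j t′ → Σ-◂ (i + j) (M° n s′ t′) ψ)) ⟩
  _ ≡⟨ Σ-slot-+ s t _ _ ⟩
  _ ≡⟨ cong₂ _+ℤ_ (sym (Σ-M⁺ n ψ vs vt le)) (begin
    Σ[ i , s′ ← slot s ] Σ[ j , t′ ← slot t ] (⟦ i + j ≡ᵇ 0 ⟧ *ℤ X s′ t′)
      ≡⟨ Σ₂-cong (slot s) (λ i s′ → Σ₂-cong (slot t) (λ j t′ →
           trans (cong (_*ℤ X s′ t′) (⟦+≡0⟧ i j)) (ℤ.*-assoc ⟦ i ≡ᵇ 0 ⟧ _ _))) ⟩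
    Σ[ i , s′ ← slot s ] Σ[ j , t′ ← slot t ] (⟦ i ≡ᵇ 0 ⟧ *ℤ (⟦ j ≡ᵇ 0 ⟧ *ℤ X s′ t′))
      ≡⟨ Σ₂-cong (slot s) (λ i s′ → trans (sym (Σ-*ˡ ⟦ i ≡ᵇ 0 ⟧ (slot t) _))
           (cong (⟦ i ≡ᵇ 0 ⟧ *ℤ_) (Σ-slot-zero t (X s′)))) ⟩
    Σ[ i , s′ ← slot s ] (⟦ i ≡ᵇ 0 ⟧ *ℤ X s′ (skip t))
      ≡⟨ Σ-slot-zero s (λ s′ → X s′ (skip t)) ⟩
    X (skip s) (skip t) ∎) ⟩
  Σ (M⁺ n s t) ψ +ℤ X (skip s) (skip t) ∎
  where
  X : List ℕ → List ℕ → ℤ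
  X s′ t′ = Σ[ ν ← M° n s′ t′ ] ψ (0 ◂ ν)

sum-skip : ∀ s → sum (skip s) ≡ sum s
sum-skip s = trans (sum-advance (hd s) (tl s)) (sum-hd-tl s)

skip-valid : ∀ {s} → Valid s → Valid (skip s)
skip-valid {s} (ps , _) = advance-valid (hd s) ps

skip-≤ : ∀ {n} s t → sum s + sum t ℕ.≤ n → sum (skip s) + sum (skip t) ℕ.≤ n
skip-≤ {n} s t = subst (ℕ._≤ n) (sym (cong₂ _+_ (sum-skip s) (sum-skip t)))

bothEmpty-[] : ∀ s t → bothEmpty s t ≡ true → s ≡ [] × t ≡ []
bothEmpty-[] [] [] _ = refl , refl

M⁺-[] : ∀ n → M⁺ n [] [] ≡ []
M⁺-[] zero    = refl
M⁺-[] (suc n) = refl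

-- Only the current slot may be empty, so the first block sits in this slot or in the next. The
-- empty superposition, possible for finished states alone, is counted once, by `M°`.
𝓜-split : ∀ n {s t} ψ → Valid s → Valid t → sum s + sum t ℕ.≤ n → 𝓜 n s t ψ ≡
  Σ (M° n s t) ψ +ℤ Σ[ ν ← M⁺ n (skip s) (skip t) ] ψ (0 ∷ ν)
𝓜-split n {s} {t} ψ vs vt le with bothEmpty s t in eq
... | true with refl , refl ← bothEmpty-[] s t eq = begin
  𝓜 n [] [] ψ                  ≡⟨ ℤ.+-identityʳ _ ⟩
  ψ [] +ℤ 0ℤ +ℤ 0ℤ              ≡⟨ cong (λ νs → ψ [] +ℤ 0ℤ +ℤ Σ[ ν ← νs ] ψ (0 ∷ ν)) (M⁺-[] n) ⟨
  _                            ∎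
... | false = begin
  𝓜 n s t ψ
    ≡⟨ 𝓜-M⁺ n ψ vs vt le ⟩
  Σ (M⁺ n s t) ψ +ℤ Σ[ ν ← M° n (skip s) (skip t) ] ψ (0 ◂ ν)
    -- By `Valid`, skipping does not turn an unfinished state into a finished one, so `M°` is `M⁺`
    -- after the skip as well.
    ≡⟨ cong (λ b → Σ (M⁺ n s t) ψ +ℤ
               Σ[ ν ← (if b then [] ∷ [] else M⁺ n (skip s) (skip t)) ] ψ (0 ◂ ν))
         (trans (cong₂ _∧_ (proj₂ vs) (proj₂ vt)) eq) ⟩
  Σ (M⁺ n s t) ψ +ℤ Σ[ ν ← M⁺ n (skip s) (skip t) ] ψ (0 ◂ ν)
    ≡⟨ cong (Σ (M⁺ n s t) ψ +ℤ_)
         (Σ-M⁺-∷ n (skip-valid vs) (skip-valid vt) (skip-≤ s t le) (λ _ _ → refl)) ⟩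
  Σ (M⁺ n s t) ψ +ℤ Σ[ ν ← M⁺ n (skip s) (skip t) ] ψ (0 ∷ ν) ∎

-- A block of size `k` is used up by exactly one split, `(k , 0)`; `grow r` makes the remaining sum
-- ignore `r = 0`.
Σ-advance : ∀ k νs (φ : ℕ → List ℕ → ℤ) →
  Σ[ ν ← νs ] Σ[ i , r ← splits k ] φ i (advance r ν) ≡
  Σ νs (φ k) +ℤ Σ[ i , r ← splits k ] Σ[ ν ← grow r νs ] φ i (0 ∷ ν)
Σ-advance k νs φ = begin
  Σ[ ν ← νs ] Σ[ i , r ← splits k ] φ i (advance r ν)
    ≡⟨ Σ-swap νs (splits k) _ ⟩
  Σ[ i , r ← splits k ] Σ[ ν ← νs ] φ i (advance r ν)
    ≡⟨ lemma k φ ⟩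
  Σ νs (φ k) +ℤ Σ[ i , r ← splits k ] Σ[ ν ← grow r νs ] φ i (0 ∷ ν) ∎
  where
  lemma : ∀ k (φ : ℕ → List ℕ → ℤ) → Σ[ i , r ← splits k ] Σ[ ν ← νs ] φ i (advance r ν) ≡
    Σ νs (φ k) +ℤ Σ[ i , r ← splits k ] Σ[ ν ← grow r νs ] φ i (0 ∷ ν)
  lemma zero    φ = refl
  lemma (suc k) φ = begin
    Σ[ i , r ← splits (suc k) ] Σ[ ν ← νs ] φ i (advance r ν)
      ≡⟨ Σ-splits-suc k (λ i r → Σ[ ν ← νs ] φ i (advance r ν)) ⟩
    Σ[ i , r ← splits k ] Σ[ ν ← νs ] φ (suc i) (advance r ν) +ℤ
    Σ[ i , r ← splits k ] Σ[ ν ← νs ] φ i (0 ∷ suc r ∷ ν)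
      ≡⟨ cong₂ _+ℤ_ (lemma k (φ ∘ suc)) (Σ₂-cong (splits k) λ i r →
           sym (Σ-map (suc r ∷_) νs (λ ν → φ i (0 ∷ ν)))) ⟩
    Σ νs (φ (suc k)) +ℤ Σ[ i , r ← splits k ] Σ[ ν ← grow r νs ] φ (suc i) (0 ∷ ν) +ℤ
    Σ[ i , r ← splits k ] Σ[ ν ← grow (suc r) νs ] φ i (0 ∷ ν)
      ≡⟨ ℤ.+-assoc (Σ νs (φ (suc k))) _ _ ⟩
    _ ≡⟨ cong (Σ νs (φ (suc k)) +ℤ_) (Σ-splits-suc k (λ i r → Σ[ ν ← grow r νs ] φ i (0 ∷ ν))) ⟨
    Σ νs (φ (suc k)) +ℤ Σ[ i , r ← splits (suc k) ] Σ[ ν ← grow r νs ] φ i (0 ∷ ν) ∎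

-- On the left, `m` and `m′` elements form a joint block, which is then cut into a part `k` for the
-- current slot and a part `l` for later. On the right, the current parts `i` and `j` come first and
-- the later parts `p` and `q` are taken from what is left. Multiplicativity cuts the joint block
-- factor by factor; coassociativity reverses the order of choice.
Σ-splits-bialgebra : ∀ a b (H : ℕ → ℕ → ℕ → ℕ → ℤ) →
  Σ[ m , r ← splits a ] Σ[ m′ , r′ ← splits b ] Σ[ k , l ← splits (m + m′) ] H k l r r′ ≡
  Σ[ i , u ← splits a ] Σ[ j , v ← splits b ]
    Σ[ p , r ← splits u ] Σ[ q , r′ ← splits v ] H (i + j) (p + q) r r′
Σ-splits-bialgebra a b H = begin
  Σ[ m , r ← splits a ] Σ[ m′ , r′ ← splits b ] Σ[ k , l ← splits (m + m′) ] H k l r r′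
    ≡⟨ Σ₂-cong (splits a) (λ m r → Σ₂-cong (splits b) λ m′ r′ → splits-+ m m′ (λ k l → H k l r r′)) ⟩
  Σ[ m , r ← splits a ] Σ[ m′ , r′ ← splits b ]
    Σ[ i , p ← splits m ] Σ[ j , q ← splits m′ ] H (i + j) (p + q) r r′
    ≡⟨ Σ₂-cong (splits a) (λ m r → Σ-swap (splits b) (splits m) _) ⟩
  Σ[ m , r ← splits a ] Σ[ i , p ← splits m ]
    Σ[ m′ , r′ ← splits b ] Σ[ j , q ← splits m′ ] H (i + j) (p + q) r r′
    ≡⟨ splits-coassoc a (λ i p r → Σ[ m′ , r′ ← splits b ] Σ[ j , q ← splits m′ ] H (i + j) (p + q) r r′) ⟩
  Σ[ i , u ← splits a ] Σ[ p , r ← splits u ]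
    Σ[ m′ , r′ ← splits b ] Σ[ j , q ← splits m′ ] H (i + j) (p + q) r r′
    ≡⟨ Σ₂-cong (splits a) (λ i u → Σ₂-cong (splits u) λ p r →
         splits-coassoc b (λ j q r′ → H (i + j) (p + q) r r′)) ⟩
  Σ[ i , u ← splits a ] Σ[ p , r ← splits u ]
    Σ[ j , v ← splits b ] Σ[ q , r′ ← splits v ] H (i + j) (p + q) r r′
    ≡⟨ Σ₂-cong (splits a) (λ i u → Σ-swap (splits u) (splits b) _) ⟩
  Σ[ i , u ← splits a ] Σ[ j , v ← splits b ]
    Σ[ p , r ← splits u ] Σ[ q , r′ ← splits v ] H (i + j) (p + q) r r′ ∎

-- The left side first chooses a block and then the part of it that fills the slot;
-- the right side chooses in the opposite order.
𝓜-slot : ∀ n {s t} (φ : ℕ → List ℕ → ℤ) → Valid s → Valid t → sum s + sum t ℕ.≤ n →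
  𝓜 n s t (λ ν → Σ₂ (slot ν) φ) ≡
  Σ[ i , s′ ← slot s ] Σ[ j , t′ ← slot t ] 𝓜 n s′ t′ (φ (i + j))
𝓜-slot n {s} {t} φ vs vt le = begin
  𝓜 n s t (λ ν → Σ₂ (slot ν) φ)
    ≡⟨ Σ₂-cong (slot s) (λ i s′ → Σ₂-cong (slot t) λ j t′ → trans
         (Σ-cong (M° n s′ t′) λ ν → Σ-slot-◂ (i + j) ν φ)
         (Σ-advance (i + j) (M° n s′ t′) φ)) ⟩
  _ ≡⟨ Σ-slot-+ s t _ _ ⟩
  _ ≡⟨ cong (Σ[ i , s′ ← slot s ] Σ[ j , t′ ← slot t ] Σ (M° n s′ t′) (φ (i + j)) +ℤ_) delayed ⟩
  _ ≡⟨ Σ-slot-+ s t _ _ ⟨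
  Σ[ i , s′ ← slot s ] Σ[ j , t′ ← slot t ] (Σ (M° n s′ t′) (φ (i + j)) +ℤ
    Σ[ ν ← M⁺ n (skip s′) (skip t′) ] φ (i + j) (0 ∷ ν))
    ≡⟨ Σ-slot-cong₂ n vs vt le (λ i s′ j t′ vs′ vt′ le′ → 𝓜-split n (φ (i + j)) vs′ vt′ le′) ⟨
  Σ[ i , s′ ← slot s ] Σ[ j , t′ ← slot t ] 𝓜 n s′ t′ (φ (i + j)) ∎
  where
  a  = hd s
  b  = hd t
  as = tl s
  bs = tl t
  H : ℕ → ℕ → ℕ → ℕ → ℤ
  H k l r r′ = Σ[ ν ← grow l (M° n (advance r as) (advance r′ bs)) ] φ k (0 ∷ ν)
  -- The terms in which a piece of the current block waits: it is completed two slots later, hence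
  -- the superpositions of the skipped states. The terms that use the block up already agree with
  -- the `M°` term of `𝓜-split`.
  delayed :
    Σ[ i , s′ ← slot s ] Σ[ j , t′ ← slot t ]
      Σ[ k , l ← splits (i + j) ] Σ[ ν ← grow l (M° n s′ t′) ] φ k (0 ∷ ν) ≡
    Σ[ i , s′ ← slot s ] Σ[ j , t′ ← slot t ]
      Σ[ ν ← M⁺ n (skip s′) (skip t′) ] φ (i + j) (0 ∷ ν)
  delayed = begin
    _ ≡⟨ Σ-slot s _ ⟩
    _ ≡⟨ Σ₂-cong (splits a) (λ i r → Σ-slot t _) ⟩
    Σ[ m , r ← splits a ] Σ[ m′ , r′ ← splits b ] Σ[ k , l ← splits (m + m′) ] H k l r r′
      ≡⟨ Σ-splits-bialgebra a b H ⟩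
    Σ[ i , u ← splits a ] Σ[ j , v ← splits b ]
      Σ[ p , r ← splits u ] Σ[ q , r′ ← splits v ] H (i + j) (p + q) r r′
      ≡⟨ Σ₂-cong (splits a) (λ i u → Σ₂-cong (splits b) λ j v → trans
           (Σ₂-cong (splits u) λ p r → sym (Σ-slot-skip-advance v (proj₁ vt) _))
           (sym (Σ-slot-skip-advance u (proj₁ vs) _))) ⟩
    Σ[ i , u ← splits a ] Σ[ j , v ← splits b ]
      Σ[ p , s″ ← slot (skip (advance u as)) ] Σ[ q , t″ ← slot (skip (advance v bs)) ]
        Σ[ ν ← grow (p + q) (M° n s″ t″) ] φ (i + j) (0 ∷ ν)
      ≡⟨ Σ₂-cong (splits a) (λ i u → sym (Σ-slot t _)) ⟩
    _ ≡⟨ Σ-slot s _ ⟨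
    Σ[ i , s′ ← slot s ] Σ[ j , t′ ← slot t ]
      Σ[ p , s″ ← slot (skip s′) ] Σ[ q , t″ ← slot (skip t′) ]
        Σ[ ν ← grow (p + q) (M° n s″ t″) ] φ (i + j) (0 ∷ ν)
      ≡⟨ Σ-slot-cong₂ n vs vt le (λ i s′ j t′ vs′ vt′ le′ →
           Σ-M⁺ n _ (skip-valid vs′) (skip-valid vt′) (skip-≤ s′ t′ le′)) ⟨
    Σ[ i , s′ ← slot s ] Σ[ j , t′ ← slot t ]
      Σ[ ν ← M⁺ n (skip s′) (skip t′) ] φ (i + j) (0 ∷ ν) ∎

-- Variables as pairs of slots, and the product of filling counts

slotPair : List ℕ → List (ℕ × List ℕ)
slotPair s = concatMap (λ { (i , s′) → map (map₁ (i +_)) (slot s′) }) (slot s)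

Σ-slotPair : ∀ s (φ : ℕ → List ℕ → ℤ) →
  Σ₂ (slotPair s) φ ≡ Σ[ i , s′ ← slot s ] Σ[ j , s″ ← slot s′ ] φ (i + j) s″
Σ-slotPair s φ = trans (Σ-concatMap _ (slot s) _) (Σ₂-cong (slot s) λ i s′ → Σ-map _ (slot s′) _)

Σ-slotPair-cong₂ : ∀ {s t} {φ ψ : ℕ → List ℕ → ℕ → List ℕ → ℤ} n → Valid s → Valid t → sum s + sum t ℕ.≤ n →
  (∀ i s′ j t′ → Valid s′ → Valid t′ → sum s′ + sum t′ ℕ.≤ n → φ i s′ j t′ ≡ ψ i s′ j t′) →
  Σ[ i , s′ ← slotPair s ] Σ[ j , t′ ← slotPair t ] φ i s′ j t′ ≡
  Σ[ i , s′ ← slotPair s ] Σ[ j , t′ ← slotPair t ] ψ i s′ j t′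
Σ-slotPair-cong₂ {s} {t} {φ} {ψ} n vs vt le eq = begin
  Σ[ i , s′ ← slotPair s ] Σ[ j , t′ ← slotPair t ] φ i s′ j t′
    ≡⟨ expand φ ⟩
  _ ≡⟨ Σ-slot-cong₂ n vs vt le (λ i s′ j t′ vs′ vt′ le′ →
         Σ-slot-cong₂ n vs′ vt′ le′ (λ i′ s″ j′ t″ vs″ vt″ le″ →
           eq (i + i′) s″ (j + j′) t″ vs″ vt″ le″)) ⟩
  _ ≡⟨ expand ψ ⟨
  Σ[ i , s′ ← slotPair s ] Σ[ j , t′ ← slotPair t ] ψ i s′ j t′ ∎
  where
  expand : ∀ χ → Σ[ i , s′ ← slotPair s ] Σ[ j , t′ ← slotPair t ] χ i s′ j t′ ≡
    Σ[ i , s′ ← slot s ] Σ[ j , t′ ← slot t ] Σ[ i′ , s″ ← slot s′ ] Σ[ j′ , t″ ← slot t′ ]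
      χ (i + i′) s″ (j + j′) t″
  expand χ = begin
    _ ≡⟨ Σ-slotPair s _ ⟩
    _ ≡⟨ Σ₂-cong (slot s) (λ i s′ → Σ₂-cong (slot s′) λ i′ s″ → Σ-slotPair t _) ⟩
    _ ≡⟨ Σ₂-cong (slot s) (λ i s′ → Σ-swap (slot s′) (slot t) _) ⟩
    _ ∎

𝓜-slotPair : ∀ n {s t} (φ : ℕ → List ℕ → ℤ) → Valid s → Valid t → sum s + sum t ℕ.≤ n →
  𝓜 n s t (λ ν → Σ₂ (slotPair ν) φ) ≡
  Σ[ i , s′ ← slotPair s ] Σ[ j , t′ ← slotPair t ] 𝓜 n s′ t′ (φ (i + j))
𝓜-slotPair n {s} {t} φ vs vt le = begin
  𝓜 n s t (λ ν → Σ₂ (slotPair ν) φ)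
    ≡⟨ 𝓜-cong n s t (λ ν → Σ-slotPair ν φ) ⟩
  𝓜 n s t (λ ν → Σ[ k , ν′ ← slot ν ] Σ[ l , ν″ ← slot ν′ ] φ (k + l) ν″)
    ≡⟨ 𝓜-slot n _ vs vt le ⟩
  Σ[ i , s′ ← slot s ] Σ[ j , t′ ← slot t ]
    𝓜 n s′ t′ (λ ν → Σ[ l , ν′ ← slot ν ] φ (i + j + l) ν′)
    ≡⟨ Σ-slot-cong₂ n vs vt le (λ i s′ j t′ vs′ vt′ le′ → 𝓜-slot n (λ l → φ (i + j + l)) vs′ vt′ le′) ⟩
  Σ[ i , s′ ← slot s ] Σ[ j , t′ ← slot t ] Σ[ i′ , s″ ← slot s′ ] Σ[ j′ , t″ ← slot t′ ]
    𝓜 n s″ t″ (φ (i + j + (i′ + j′)))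
    ≡⟨ Σ₂-cong (slot s) (λ i s′ → Σ₂-cong (slot t) λ j t′ →
         Σ₂-cong (slot s′) λ i′ s″ → Σ₂-cong (slot t′) λ j′ t″ →
           cong (λ k → 𝓜 n s″ t″ (φ k)) (+-interchange i j i′ j′)) ⟩
  Σ[ i , s′ ← slot s ] Σ[ j , t′ ← slot t ] Σ[ i′ , s″ ← slot s′ ] Σ[ j′ , t″ ← slot t′ ]
    𝓜 n s″ t″ (φ (i + i′ + (j + j′)))
    ≡⟨ Σ₂-cong (slot s) (λ i s′ → Σ-swap (slot t) (slot s′) _) ⟩
  _ ≡⟨ Σ₂-cong (slot s) (λ i s′ → Σ₂-cong (slot s′) λ i′ s″ → sym (Σ-slotPair t _)) ⟩
  _ ≡⟨ Σ-slotPair s _ ⟨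
  Σ[ i , s′ ← slotPair s ] Σ[ j , t′ ← slotPair t ] 𝓜 n s′ t′ (φ (i + j)) ∎

-- Each variable has an even slot and then an odd one.  The first block of a
-- composition α is odd, so N α will be G (0 ◂ parts α).
G : List ℕ → Series
G s []      = ⟦ null s ⟧
G s (k ∷ e) = Σ[ i , s′ ← slotPair s ] (⟦ i ≡ᵇ k ⟧ *ℤ G s′ e)

Σ-cartesianProductWith : ∀ {A B C : Set} (f : A → B → C) xs ys (φ : C → ℤ) →
  Σ (cartesianProductWith f xs ys) φ ≡ Σ[ x ← xs ] Σ[ y ← ys ] φ (f x y)
Σ-cartesianProductWith f []       ys φ = refl
Σ-cartesianProductWith f (x ∷ xs) ys φ = trans (Σ-++ (map (f x) ys) φ)
  (cong₂ _+ℤ_ (Σ-map (f x) ys φ) (Σ-cartesianProductWith f xs ys φ))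

⊛-∷ : ∀ (f g : Series) k e →
  (f ⊛ g) (k ∷ e) ≡ Σ[ i ← upTo (suc k) ] ((f ∘ (i ∷_)) ⊛ (g ∘ ((k ∸ i) ∷_))) e
⊛-∷ f g k e = trans (Σ-cartesianProductWith _ (upTo (suc k)) (factorizations e) _)
  (Σ-cong (upTo (suc k)) λ i → Σ-cong (factorizations e) λ { (a , b) → refl })

⊛-Σ : ∀ {A B : Set} (xs : List A) (ys : List B) (c : A → ℤ) (d : B → ℤ)
      (f : A → Series) (g : B → Series) e →
  ((λ m → Σ[ x ← xs ] (c x *ℤ f x m)) ⊛ (λ m → Σ[ y ← ys ] (d y *ℤ g y m))) e ≡
  Σ[ x ← xs ] Σ[ y ← ys ] (c x *ℤ d y *ℤ (f x ⊛ g y) e)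
⊛-Σ xs ys c d f g e = begin
  _ ≡⟨ Σ-cong (factorizations e) (λ { (a , b) → refl }) ⟩
  Σ[ a , b ← factorizations e ] (Σ[ x ← xs ] (c x *ℤ f x a) *ℤ Σ[ y ← ys ] (d y *ℤ g y b))
    ≡⟨ Σ₂-cong (factorizations e) (λ a b → Σ-*-Σ xs ys _ _) ⟩
  Σ[ a , b ← factorizations e ] Σ[ x ← xs ] Σ[ y ← ys ] ((c x *ℤ f x a) *ℤ (d y *ℤ g y b))
    ≡⟨ Σ-swap (factorizations e) xs _ ⟩
  _ ≡⟨ Σ-cong xs (λ x → Σ-swap (factorizations e) ys _) ⟩
  Σ[ x ← xs ] Σ[ y ← ys ] Σ[ a , b ← factorizations e ] ((c x *ℤ f x a) *ℤ (d y *ℤ g y b))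
    ≡⟨ Σ-cong xs (λ x → Σ-cong ys λ y → trans
         (Σ-cong (factorizations e) λ { (a , b) → *-interchange (c x) _ (d y) _ })
         (sym (Σ-*ˡ (c x *ℤ d y) (factorizations e) _))) ⟩
  Σ[ x ← xs ] Σ[ y ← ys ] (c x *ℤ d y *ℤ (f x ⊛ g y) e) ∎

Σ-applyUpTo : ∀ {A : Set} (f : ℕ → A) n (φ : A → ℤ) → Σ (applyUpTo f n) φ ≡ Σ[ i ← upTo n ] φ (f i)
Σ-applyUpTo f zero    φ = refl
Σ-applyUpTo f (suc n) φ = cong (φ (f 0) +ℤ_)
  (trans (Σ-applyUpTo (f ∘ suc) n φ) (sym (Σ-applyUpTo suc n (φ ∘ f))))

-- Convolution of two point masses; the range `i ≤ k` makes the truncated `k ∸ i` an honest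
-- difference.
Σ-upTo-≡ᵇ : ∀ x y k → Σ[ i ← upTo (suc k) ] (⟦ x ≡ᵇ i ⟧ *ℤ ⟦ y ≡ᵇ k ∸ i ⟧) ≡ ⟦ x + y ≡ᵇ k ⟧
Σ-upTo-≡ᵇ zero y k = begin
  _ ≡⟨ cong₂ _+ℤ_ (ℤ.*-identityˡ ⟦ y ≡ᵇ k ⟧) (trans (Σ-applyUpTo suc k _) (Σ-zero (upTo k) (λ _ → refl))) ⟩
  _ ≡⟨ ℤ.+-identityʳ _ ⟩
  ⟦ y ≡ᵇ k ⟧ ∎
Σ-upTo-≡ᵇ (suc x) y zero    = refl
Σ-upTo-≡ᵇ (suc x) y (suc k) = begin
  _ ≡⟨ ℤ.+-identityˡ (Σ (applyUpTo suc (suc k)) λ i → ⟦ suc x ≡ᵇ i ⟧ *ℤ ⟦ y ≡ᵇ suc k ∸ i ⟧) ⟩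
  _ ≡⟨ Σ-applyUpTo suc (suc k) (λ i → ⟦ suc x ≡ᵇ i ⟧ *ℤ ⟦ y ≡ᵇ suc k ∸ i ⟧) ⟩
  _ ≡⟨ Σ-upTo-≡ᵇ x y k ⟩
  ⟦ x + y ≡ᵇ k ⟧ ∎

-- Induction over the variables. `𝓜-slotPair` moves both slots of the first variable from the
-- superposition to the factors, and the condition that `i + j` be its exponent unfolds into the
-- Cauchy product. Without variables, only the empty superposition counts.
𝓜-G : ∀ n {s t} e → Valid s → Valid t → sum s + sum t ℕ.≤ n →
      𝓜 n s t (λ ν → G ν e) ≡ (G s ⊛ G t) e
𝓜-G n {s} {t} [] vs vt le = begin
  𝓜 n s t (λ ν → ⟦ null ν ⟧)
    ≡⟨ 𝓜-split n _ vs vt le ⟩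
  Σ[ ν ← M° n s t ] ⟦ null ν ⟧ +ℤ Σ[ ν ← M⁺ n (skip s) (skip t) ] 0ℤ
    ≡⟨ cong₂ _+ℤ_ count (Σ-zero (M⁺ n (skip s) (skip t)) (λ _ → refl)) ⟩
  ⟦ bothEmpty s t ⟧ +ℤ 0ℤ
    ≡⟨ cong (_+ℤ 0ℤ) (⟦∧⟧ (null s) (null t)) ⟩
  ⟦ null s ⟧ *ℤ ⟦ null t ⟧ +ℤ 0ℤ ∎
  where
  count : Σ[ ν ← M° n s t ] ⟦ null ν ⟧ ≡ ⟦ bothEmpty s t ⟧
  count with bothEmpty s t
  ... | true  = refl
  ... | false = trans (Σ-M⁺-∷ n {ψ′ = λ _ → 0ℤ} vs vt le (λ _ _ → refl))
                      (Σ-zero (M⁺ n s t) (λ _ → refl))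
𝓜-G n {s} {t} (k ∷ e) vs vt le = begin
  𝓜 n s t (λ ν → Σ[ l , ν′ ← slotPair ν ] (⟦ l ≡ᵇ k ⟧ *ℤ G ν′ e))
    ≡⟨ 𝓜-slotPair n _ vs vt le ⟩
  Σ[ i , s′ ← slotPair s ] Σ[ j , t′ ← slotPair t ] 𝓜 n s′ t′ (λ ν → ⟦ i + j ≡ᵇ k ⟧ *ℤ G ν e)
    ≡⟨ Σ-slotPair-cong₂ n vs vt le (λ i s′ j t′ vs′ vt′ le′ → begin
         _ ≡⟨ 𝓜-*ˡ ⟦ i + j ≡ᵇ k ⟧ s′ t′ (λ ν → G ν e) ⟨
         _ ≡⟨ cong (⟦ i + j ≡ᵇ k ⟧ *ℤ_) (𝓜-G n e vs′ vt′ le′) ⟩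
         _ ≡⟨ cong (_*ℤ (G s′ ⊛ G t′) e) (Σ-upTo-≡ᵇ i j k) ⟨
         _ ≡⟨ Σ-*ʳ (upTo (suc k)) (λ l → ⟦ i ≡ᵇ l ⟧ *ℤ ⟦ j ≡ᵇ k ∸ l ⟧) ((G s′ ⊛ G t′) e) ⟩
         Σ[ l ← upTo (suc k) ] (⟦ i ≡ᵇ l ⟧ *ℤ ⟦ j ≡ᵇ k ∸ l ⟧ *ℤ (G s′ ⊛ G t′) e) ∎) ⟩
  _ ≡⟨ Σ₂-cong (slotPair s) (λ i s′ → Σ-swap (slotPair t) (upTo (suc k)) _) ⟩
  _ ≡⟨ Σ-swap (slotPair s) (upTo (suc k)) _ ⟩
  Σ[ l ← upTo (suc k) ] Σ[ i , s′ ← slotPair s ] Σ[ j , t′ ← slotPair t ]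
    (⟦ i ≡ᵇ l ⟧ *ℤ ⟦ j ≡ᵇ k ∸ l ⟧ *ℤ (G s′ ⊛ G t′) e)
    ≡⟨ Σ-cong (upTo (suc k)) (λ l → ⊛-Σ (slotPair s) (slotPair t)
         (λ p → ⟦ proj₁ p ≡ᵇ l ⟧) (λ q → ⟦ proj₁ q ≡ᵇ k ∸ l ⟧) (G ∘ proj₂) (G ∘ proj₂) e) ⟨
  Σ[ l ← upTo (suc k) ] ((G s ∘ (l ∷_)) ⊛ (G t ∘ ((k ∸ l) ∷_))) e
    ≡⟨ ⊛-∷ (G s) (G t) k e ⟨
  (G s ⊛ G t) (k ∷ e) ∎
  where
  𝓜-*ˡ : ∀ c s t ψ → c *ℤ 𝓜 n s t ψ ≡ 𝓜 n s t (λ ν → c *ℤ ψ ν)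
  𝓜-*ˡ c s t ψ = trans (Σ-*ˡ c (slot s) _) (Σ₂-cong (slot s) λ i s′ →
    trans (Σ-*ˡ c (slot t) _) (Σ₂-cong (slot t) λ j t′ → Σ-*ˡ c (M° n s′ t′) _))

-- The leading 0 of both factors forces the first even slot to stay empty, so `𝓜` collapses to the
-- superpositions of the compositions themselves.
G-product : ∀ {as bs} e → All NonZero as → All NonZero bs →
  (G (0 ◂ as) ⊛ G (0 ◂ bs)) e ≡ Σ[ ν ← M° (sum as + sum bs) as bs ] G (0 ◂ ν) e
G-product {as} {bs} e ps qs = begin
  (G (0 ◂ as) ⊛ G (0 ◂ bs)) e
    ≡⟨ 𝓜-G n e (0◂-valid ps) (0◂-valid qs) (ℕ.≤-reflexive (cong₂ _+_ (sum-0◂ as) (sum-0◂ bs))) ⟨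
  𝓜 n (0 ◂ as) (0 ◂ bs) (λ ν → G ν e)
    ≡⟨ Σ-slot-◂ 0 as (λ i s′ → Σ[ j , t′ ← slot (0 ◂ bs) ] Σ[ ν ← M° n s′ t′ ] G ((i + j) ◂ ν) e) ⟩
  Σ[ j , t′ ← slot (0 ◂ bs) ] Σ[ ν ← M° n as t′ ] G (j ◂ ν) e +ℤ 0ℤ
    ≡⟨ ℤ.+-identityʳ _ ⟩
  _ ≡⟨ Σ-slot-◂ 0 bs (λ j t′ → Σ[ ν ← M° n as t′ ] G (j ◂ ν) e) ⟩
  _ ≡⟨ ℤ.+-identityʳ _ ⟩
  Σ[ ν ← M° n as bs ] G (0 ◂ ν) e ∎
  where
  n = sum as + sum bs
  0◂-valid : ∀ {as} → All NonZero as → Valid (0 ◂ as)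
  0◂-valid []       = [] , refl
  0◂-valid (p ∷ ps) = p ∷ ps , refl
  sum-0◂ : ∀ as → sum (0 ◂ as) ≡ sum as
  sum-0◂ []      = refl
  sum-0◂ (_ ∷ _) = refl

-- Positivity and rank of superpositions

splits-∈ : ∀ a {i r} → (i , r) ∈ splits a → i + r ≡ a
splits-∈ zero    (here refl) = refl
splits-∈ (suc a) p∈ with ∈-++⁻ (map (map₁ suc) (splits a)) p∈
... | inj₁ q∈ with _ , r∈ , refl ← ∈-map⁻ (map₁ suc) q∈ = cong suc (splits-∈ a r∈)
... | inj₂ q∈ with _ , r∈ , refl ← ∈-map⁻ (map₂ suc) q∈ = trans (ℕ.+-suc _ _) (cong suc (splits-∈ a r∈))

-- Positions in a state are relative to the current slot, so passing a slot exchanges the two sums.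
slot-oddSum : ∀ s {i s′} → (i , s′) ∈ slot s → oddSum s ≡ i + evenSum s′ × evenSum s ≡ oddSum s′
slot-oddSum []       (here refl) = refl , refl
slot-oddSum (a ∷ as) p∈ with ∈-map⁻ (map₂ (λ r → advance r as)) p∈
... | (i , zero)  , q∈ , refl =
  cong (_+ evenSum as) (trans (sym (splits-∈ a q∈)) (ℕ.+-identityʳ i)) , refl
... | (i , suc r) , q∈ , refl =
  trans (cong (_+ evenSum as) (sym (splits-∈ a q∈))) (ℕ.+-assoc i (suc r) _) , refl

grow-∈ : ∀ k {νs ν} → ν ∈ grow k νs → ∃ λ ν′ → ν′ ∈ νs × NonZero k × ν ≡ k ∷ ν′
grow-∈ (suc k) ν∈ with ν′ , ν′∈ , eq ← ∈-map⁻ (suc k ∷_) ν∈ = ν′ , ν′∈ , _ , eq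

M⁺-∈ : ∀ n s t {ν} → ν ∈ M⁺ (suc n) s t → ∃ λ i → ∃ λ s′ → ∃ λ j → ∃ λ t′ →
  (i , s′) ∈ slot s × (j , t′) ∈ slot t × ν ∈ grow (i + j) (M° n s′ t′)
M⁺-∈ n s t ν∈ with (i , s′) , s′∈ , ν∈′ ← find (∈-concatMap⁻ _ {slot s} ν∈)
              with (j , t′) , t′∈ , ν∈″ ← find (∈-concatMap⁻ _ {slot t} ν∈′) =
  i , s′ , j , t′ , s′∈ , t′∈ , ν∈″

mutual
  M°-positive : ∀ n s t {ν} → ν ∈ M° n s t → All NonZero ν
  M°-positive n s t ν∈ with bothEmpty s t
  M°-positive n s t (here refl) | true  = []
  M°-positive n s t ν∈          | false = M⁺-positive n s t ν∈

  M⁺-positive : ∀ n s t {ν} → ν ∈ M⁺ n s t → All NonZero ν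
  M⁺-positive (suc n) s t ν∈
    with i , s′ , j , t′ , s′∈ , t′∈ , ν∈′ ← M⁺-∈ n s t ν∈
    with ν′ , ν′∈ , i+j≢0 , refl ← grow-∈ (i + j) ν∈′ = i+j≢0 ∷ M°-positive n s′ t′ ν′∈

mutual
  -- Superposing unites only elements of equal parity. Both sums are carried because each slot
  -- exchanges them; the odd one is the rank.
  M°-oddSum : ∀ n s t {ν} → ν ∈ M° n s t →
    oddSum ν ≡ oddSum s + oddSum t × evenSum ν ≡ evenSum s + evenSum t
  M°-oddSum n []      []      (here refl) = refl , refl
  M°-oddSum n (a ∷ s) t       ν∈ = M⁺-oddSum n (a ∷ s) t ν∈
  M°-oddSum n []      (b ∷ t) ν∈ = M⁺-oddSum n [] (b ∷ t) ν∈

  M⁺-oddSum : ∀ n s t {ν} → ν ∈ M⁺ n s t →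
    oddSum ν ≡ oddSum s + oddSum t × evenSum ν ≡ evenSum s + evenSum t
  M⁺-oddSum (suc n) s t ν∈
    with i , s′ , j , t′ , s′∈ , t′∈ , ν∈′ ← M⁺-∈ n s t ν∈
    with ν′ , ν′∈ , _ , refl ← grow-∈ (i + j) ν∈′
    with so , se ← slot-oddSum s s′∈ | to , te ← slot-oddSum t t′∈ | odd , even ← M°-oddSum n s′ t′ ν′∈ =
      (begin
        i + j + evenSum ν′                    ≡⟨ cong (i + j +_) even ⟩
        i + j + (evenSum s′ + evenSum t′)     ≡⟨ +-interchange i j _ _ ⟩
        (i + evenSum s′) + (j + evenSum t′)   ≡⟨ cong₂ _+_ so to ⟨
        oddSum s + oddSum t                   ∎)
    , trans odd (sym (cong₂ _+_ se te))

-- Binomial coefficients from splittings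

nC0≡1 : ∀ n → n choose 0 ≡ 1
nC0≡1 n = trans (nCk≡nC[n∸k] {0} {n} ℕ.z≤n) (nCn≡1 n)

≡ᵇ-false : ∀ {i k} → i ≢ k → (i ≡ᵇ k) ≡ false
≡ᵇ-false {i} {k} i≢k = dec-false (i ℕ.≟ k) i≢k

≡ᵇ-+ : ∀ b i j → (b + i ≡ᵇ b + j) ≡ (i ≡ᵇ j)
≡ᵇ-+ zero    i j = refl
≡ᵇ-+ (suc b) i j = ≡ᵇ-+ b i j

Σ-splits-choose : ∀ a k (φ : ℕ → ℤ) →
  Σ[ i , r ← splits a ] (⟦ i ≡ᵇ k ⟧ *ℤ φ r) ≡ +ℕ (a choose k) *ℤ φ (a ∸ k)
Σ-splits-choose a zero φ = trans (Σ-splits-zero a φ)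
  (sym (trans (cong (λ c → +ℕ c *ℤ φ a) (nC0≡1 a)) (ℤ.*-identityˡ (φ a))))
Σ-splits-choose zero    (suc k) φ = refl
Σ-splits-choose (suc a) (suc k) φ = begin
  Σ[ i , r ← splits (suc a) ] (⟦ i ≡ᵇ suc k ⟧ *ℤ φ r)
    ≡⟨ Σ-splits-suc a _ ⟩
  Σ[ i , r ← splits a ] (⟦ i ≡ᵇ k ⟧ *ℤ φ r) +ℤ
  Σ[ i , r ← splits a ] (⟦ i ≡ᵇ suc k ⟧ *ℤ φ (suc r))
    ≡⟨ cong₂ _+ℤ_ (Σ-splits-choose a k φ) (trans (Σ-splits-choose a (suc k) (φ ∘ suc)) unshift) ⟩
  +ℕ (a choose k) *ℤ φ (a ∸ k) +ℤ +ℕ (a choose suc k) *ℤ φ (a ∸ k)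
    ≡⟨ ℤ.*-distribʳ-+ (φ (a ∸ k)) (+ℕ (a choose k)) (+ℕ (a choose suc k)) ⟨
  +ℕ (a choose k + a choose suc k) *ℤ φ (a ∸ k)
    ≡⟨ cong (λ c → +ℕ c *ℤ φ (a ∸ k)) (nCk+nC[k+1]≡[n+1]C[k+1] a k) ⟩
  +ℕ (suc a choose suc k) *ℤ φ (a ∸ k) ∎
  where
  -- The truncated differences disagree only for `a ≤ k`, where the binomial coefficient is 0.
  unshift : +ℕ (a choose suc k) *ℤ φ (suc (a ∸ suc k)) ≡ +ℕ (a choose suc k) *ℤ φ (a ∸ k)
  unshift with ℕ.<-≤-connex k a
  ... | inj₁ k<a = cong (λ r → +ℕ (a choose suc k) *ℤ φ r) (sym (ℕ.+-∸-assoc 1 k<a))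
  ... | inj₂ a≤k = subst (λ c → +ℕ c *ℤ φ (suc (a ∸ suc k)) ≡ +ℕ c *ℤ φ (a ∸ k))
                     (sym (k>n⇒nCk≡0 (ℕ.s≤s a≤k))) refl

-- Drops the value at `r = 0`: an exhausted even block opens the odd slot of the same variable and
-- is counted apart.
pos : (ℕ → ℤ) → ℕ → ℤ
pos φ zero    = 0ℤ
pos φ (suc r) = φ (suc r)

Σ-splits-pos : ∀ a (φ : ℕ → ℕ → ℤ) →
  Σ₂ (splits a) φ ≡ φ a 0 +ℤ Σ[ i , r ← splits a ] pos (φ i) r
Σ-splits-pos zero    φ = refl
Σ-splits-pos (suc a) φ = begin
  Σ₂ (splits (suc a)) φ
    ≡⟨ Σ-splits-suc a φ ⟩
  _ ≡⟨ cong (_+ℤ Σ[ i , r ← splits a ] φ i (suc r)) (Σ-splits-pos a (φ ∘ suc)) ⟩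
  _ ≡⟨ ℤ.+-assoc (φ (suc a) 0) _ _ ⟩
  _ ≡⟨ cong (φ (suc a) 0 +ℤ_) (Σ-splits-suc a (λ i → pos (φ i))) ⟨
  φ (suc a) 0 +ℤ Σ[ i , r ← splits (suc a) ] pos (φ i) r ∎

-- Values of G

Σ-slotPair-odd : ∀ as (φ : ℕ → List ℕ → ℤ) → Σ₂ (slotPair (0 ◂ as)) φ ≡ Σ₂ (slot as) φ
Σ-slotPair-odd []       φ = refl
Σ-slotPair-odd (a ∷ as) φ = trans (Σ-slotPair (0 ∷ a ∷ as) φ) (ℤ.+-identityʳ _)

G-odd : ∀ a as k e → G (0 ∷ a ∷ as) (k ∷ e) ≡
  Σ[ i , r ← splits a ] (⟦ i ≡ᵇ k ⟧ *ℤ G (advance r as) e)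
G-odd a as k e = trans (Σ-slotPair-odd (a ∷ as) _) (Σ-slot (a ∷ as) _)

G-odd-full : ∀ a as e → G (0 ∷ a ∷ as) (a ∷ e) ≡ G as e
G-odd-full a as e = begin
  G (0 ∷ a ∷ as) (a ∷ e)
    ≡⟨ G-odd a as a e ⟩
  _ ≡⟨ Σ-splits-choose a a (λ r → G (advance r as) e) ⟩
  _ ≡⟨ cong₂ (λ c r → +ℕ c *ℤ G (advance r as) e) (nCn≡1 a) (ℕ.n∸n≡0 a) ⟩
  _ ≡⟨ ℤ.*-identityˡ _ ⟩
  G as e ∎

-- The odd slot is the last one of its variable, so the next even block cannot contribute to the
-- exponent.
G-odd-over : ∀ {a k} as e → a ℕ.< k → G (0 ∷ a ∷ as) (k ∷ e) ≡ 0ℤ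
G-odd-over {a} {k} as e a<k = begin
  G (0 ∷ a ∷ as) (k ∷ e)
    ≡⟨ G-odd a as k e ⟩
  _ ≡⟨ Σ-splits-choose a k (λ r → G (advance r as) e) ⟩
  _ ≡⟨ cong (λ c → +ℕ c *ℤ G (advance (a ∸ k) as) e) (k>n⇒nCk≡0 a<k) ⟩
  0ℤ ∎

G-odd-0∷ : ∀ {as} e → All NonZero as → G (0 ◂ as) (0 ∷ e) ≡ G (0 ◂ as) e
G-odd-0∷ e [] = trans (ℤ.+-identityʳ _) (ℤ.*-identityˡ _)
G-odd-0∷ e (_∷_ {x = suc a} {xs = as} p ps) = begin
  G (0 ∷ suc a ∷ as) (0 ∷ e) ≡⟨ G-odd (suc a) as 0 e ⟩
  _                          ≡⟨ Σ-splits-zero (suc a) (λ r → G (advance r as) e) ⟩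
  G (0 ∷ suc a ∷ as) e       ∎

-- If the even slot exhausts its block, the odd slot may take from the next one (first sum);
-- otherwise the remainder blocks it and the odd slot stays empty (second sum).
G-even′ : ∀ a as k e → G (a ∷ as) (k ∷ e) ≡
  Σ[ j , s ← slot as ] (⟦ a + j ≡ᵇ k ⟧ *ℤ G s e) +ℤ
  Σ[ i , r ← splits a ] (⟦ i ≡ᵇ k ⟧ *ℤ pos (λ r → G (r ∷ as) e) r)
G-even′ a as k e = begin
  G (a ∷ as) (k ∷ e)
    ≡⟨ Σ-slotPair (a ∷ as) _ ⟩
  _ ≡⟨ Σ-slot (a ∷ as) _ ⟩
  Σ[ i , r ← splits a ] φ i r
    ≡⟨ Σ-splits-pos a φ ⟩
  φ a 0 +ℤ Σ[ i , r ← splits a ] pos (φ i) r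
    ≡⟨ cong (φ a 0 +ℤ_) (Σ₂-cong (splits a) later) ⟩
  φ a 0 +ℤ Σ[ i , r ← splits a ] (⟦ i ≡ᵇ k ⟧ *ℤ pos (λ r → G (r ∷ as) e) r) ∎
  where
  φ : ℕ → ℕ → ℤ
  φ i r = Σ[ j , s ← slot (advance r as) ] (⟦ i + j ≡ᵇ k ⟧ *ℤ G s e)
  later : ∀ i r → pos (φ i) r ≡ ⟦ i ≡ᵇ k ⟧ *ℤ pos (λ r → G (r ∷ as) e) r
  later i zero    = sym (ℤ.*-zeroʳ ⟦ i ≡ᵇ k ⟧)
  later i (suc r) = trans (ℤ.+-identityʳ _)
    (cong (λ i → ⟦ i ≡ᵇ k ⟧ *ℤ G (suc r ∷ as) e) (ℕ.+-identityʳ i))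

G-even : ∀ a as k e → G (a ∷ as) (k ∷ e) ≡
  Σ[ j , s ← slot as ] (⟦ a + j ≡ᵇ k ⟧ *ℤ G s e) +ℤ +ℕ (a choose k) *ℤ pos (λ r → G (r ∷ as) e) (a ∸ k)
G-even a as k e = trans (G-even′ a as k e)
  (cong (Σ[ j , s ← slot as ] (⟦ a + j ≡ᵇ k ⟧ *ℤ G s e) +ℤ_) (Σ-splits-choose a k (pos λ r → G (r ∷ as) e)))

-- The even block can supply at most `a`, and the odd slot opens only once it is exhausted, so it is
-- taken whole, in one way.
G-even-over : ∀ a as j e → G (a ∷ as) (a + j ∷ e) ≡ G (0 ◂ as) (j ∷ e)
G-even-over a as j e = begin
  G (a ∷ as) (a + j ∷ e)
    ≡⟨ G-even a as (a + j) e ⟩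
  _ ≡⟨ cong₂ _+ℤ_ (Σ₂-cong (slot as) λ i s → cong (λ b → ⟦ b ⟧ *ℤ G s e) (≡ᵇ-+ a i j))
         (cong (λ r → +ℕ (a choose (a + j)) *ℤ pos (λ r → G (r ∷ as) e) r) (ℕ.m≤n⇒m∸n≡0 (ℕ.m≤m+n a j))) ⟩
  _ ≡⟨ cong (Σ[ i , s ← slot as ] (⟦ i ≡ᵇ j ⟧ *ℤ G s e) +ℤ_) (ℤ.*-zeroʳ (+ℕ (a choose (a + j)))) ⟩
  _ ≡⟨ ℤ.+-identityʳ _ ⟩
  _ ≡⟨ Σ-slotPair-odd as _ ⟨
  G (0 ◂ as) (j ∷ e) ∎

Σ-slot-+≢ : ∀ {a k} as e → k ℕ.< a → Σ[ j , s ← slot as ] (⟦ a + j ≡ᵇ k ⟧ *ℤ G s e) ≡ 0ℤ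
Σ-slot-+≢ {a} {k} as e k<a = Σ-zero (slot as) λ { {j , s} _ → cong (λ b → ⟦ b ⟧ *ℤ G s e)
  (≡ᵇ-false {a + j} {k} λ { refl → ℕ.m+n≮m a j k<a }) }

G-even-under : ∀ k d as e → G (k + suc d ∷ as) (k ∷ e) ≡ +ℕ ((k + suc d) choose k) *ℤ G (suc d ∷ as) e
G-even-under k d as e = begin
  G (k + suc d ∷ as) (k ∷ e)
    ≡⟨ G-even (k + suc d) as k e ⟩
  _ ≡⟨ cong₂ _+ℤ_ (Σ-slot-+≢ as e (ℕ.m<m+n k ℕ.z<s))
         (cong (λ r → +ℕ ((k + suc d) choose k) *ℤ pos (λ r → G (r ∷ as) e) r) (ℕ.m+n∸m≡n k (suc d))) ⟩
  _ ≡⟨ ℤ.+-identityˡ _ ⟩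
  +ℕ ((k + suc d) choose k) *ℤ G (suc d ∷ as) e ∎

-- Triangular functionals

record Linear (Φ : Series → ℤ) : Set where
  field
    resp    : ∀ {f g} → f ≈ g → Φ f ≡ Φ g
    combine : ∀ c f g → Φ (λ e → c *ℤ f e +ℤ g e) ≡ c *ℤ Φ f +ℤ Φ g

  zeroˢ : ∀ {f} → (∀ e → f e ≡ 0ℤ) → Φ f ≡ 0ℤ
  zeroˢ {f} f≡0 = ∙-cancelˡ ℤ.+-0-abelianGroup (Φ f) _ _ (begin
    Φ f +ℤ Φ f           ≡⟨ cong (_+ℤ Φ f) (ℤ.*-identityˡ (Φ f)) ⟨
    1ℤ *ℤ Φ f +ℤ Φ f     ≡⟨ combine 1ℤ f f ⟨
    Φ (λ e → 1ℤ *ℤ f e +ℤ f e)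
      ≡⟨ resp (λ e → trans (cong (λ x → 1ℤ *ℤ x +ℤ f e) (f≡0 e)) (ℤ.+-identityˡ (f e))) ⟩
    Φ f                  ≡⟨ ℤ.+-identityʳ _ ⟨
    Φ f +ℤ 0ℤ            ∎)

  scale : ∀ c f → Φ (λ e → c *ℤ f e) ≡ c *ℤ Φ f
  scale c f = begin
    Φ (λ e → c *ℤ f e)          ≡⟨ resp (λ e → sym (ℤ.+-identityʳ _)) ⟩
    Φ (λ e → c *ℤ f e +ℤ 0ℤ)    ≡⟨ combine c f _ ⟩
    c *ℤ Φ f +ℤ Φ (λ _ → 0ℤ)    ≡⟨ cong (c *ℤ Φ f +ℤ_) (zeroˢ (λ _ → refl)) ⟩
    c *ℤ Φ f +ℤ 0ℤ              ≡⟨ ℤ.+-identityʳ _ ⟩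
    c *ℤ Φ f                    ∎

  sums : ∀ {A : Set} (xs : List A) (c : A → ℤ) (f : A → Series) →
         Φ (λ e → Σ[ x ← xs ] (c x *ℤ f x e)) ≡ Σ[ x ← xs ] (c x *ℤ Φ (f x))
  sums []       c f = zeroˢ (λ _ → refl)
  sums (x ∷ xs) c f = trans (combine (c x) (f x) _) (cong (c x *ℤ Φ (f x) +ℤ_) (sums xs c f))

open Linear

∘-linear : ∀ {Φ} → Linear Φ → (h : Monomial → Monomial) → Linear (λ f → Φ (f ∘ h))
∘-linear L h .resp f≈g      = L .resp (f≈g ∘ h)
∘-linear L h .combine c f g = L .combine c (f ∘ h) (g ∘ h)

−-linear : ∀ {Φ Ψ} → Linear Φ → Linear Ψ → Linear (λ f → Φ f -ℤ Ψ f)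
−-linear L M .resp f≈g = cong₂ _-ℤ_ (L .resp f≈g) (M .resp f≈g)
−-linear {Φ} {Ψ} L M .combine c f g = begin
  Φ _ -ℤ Ψ _
    ≡⟨ cong₂ _-ℤ_ (L .combine c f g) (M .combine c f g) ⟩
  c *ℤ Φ f +ℤ Φ g +ℤ -ℤ (c *ℤ Ψ f +ℤ Ψ g)
    ≡⟨ cong (c *ℤ Φ f +ℤ Φ g +ℤ_) (trans (ℤ.neg-distrib-+ (c *ℤ Ψ f) (Ψ g))
         (cong (_+ℤ -ℤ Ψ g) (ℤ.neg-distribʳ-* c (Ψ f)))) ⟩
  c *ℤ Φ f +ℤ Φ g +ℤ (c *ℤ -ℤ Ψ f +ℤ -ℤ Ψ g)
    ≡⟨ +ℤ-interchange (c *ℤ Φ f) _ _ _ ⟩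
  c *ℤ Φ f +ℤ c *ℤ -ℤ Ψ f +ℤ (Φ g -ℤ Ψ g)
    ≡⟨ cong (_+ℤ (Φ g -ℤ Ψ g)) (ℤ.*-distribˡ-+ c (Φ f) _) ⟨
  c *ℤ (Φ f -ℤ Ψ f) +ℤ (Φ g -ℤ Ψ g) ∎

-- Joins a pending segment to the one after it: this imposes the ascent from the last even entry to
-- the next odd antichain.
shift : ℕ → Monomial → Monomial
shift k []      = k ∷ []
shift k (j ∷ e) = k + j ∷ e

-- desc k d reads off a segment of length k that is continued by d descents.  A
-- descent is a cut that is not an ascent, whence the inclusion-exclusion.
mutual
  Λᵒ Λᵉ : List ℕ → Series → ℤ
  Λᵒ []       f = f []
  Λᵒ (a ∷ as) f = Λᵉ as (f ∘ (a ∷_))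

  Λᵉ []       f = f []
  Λᵉ (a ∷ as) f = desc 1 (ℕ.pred a) as f

  desc : ℕ → ℕ → List ℕ → Series → ℤ
  desc k zero    as f = Λᵒ as (f ∘ shift k)
  desc k (suc d) as f = desc 1 d as (f ∘ (k ∷_)) -ℤ desc (suc k) d as f

mutual
  Λᵒ-linear : ∀ as → Linear (Λᵒ as)
  Λᵒ-linear []       = record { resp = λ f≈g → f≈g [] ; combine = λ _ _ _ → refl }
  Λᵒ-linear (a ∷ as) = ∘-linear (Λᵉ-linear as) (a ∷_)

  Λᵉ-linear : ∀ as → Linear (Λᵉ as)
  Λᵉ-linear []       = record { resp = λ f≈g → f≈g [] ; combine = λ _ _ _ → refl }
  Λᵉ-linear (a ∷ as) = desc-linear 1 (ℕ.pred a) as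

  desc-linear : ∀ k d as → Linear (desc k d as)
  desc-linear k zero    as = ∘-linear (Λᵒ-linear as) (shift k)
  desc-linear k (suc d) as =
    −-linear (∘-linear (desc-linear 1 d as) (k ∷_)) (desc-linear (suc k) d as)

-- The step from an even block to the next odd one always ascends, so a segment containing the whole
-- block is as good as its part beyond it.
desc-G-over : ∀ b bs j d as → desc (b + j) d as (G (b ∷ bs)) ≡ desc j d as (G (0 ◂ bs))
desc-G-over b bs j zero    as = Λᵒ-linear as .resp λ where
  []      → G-even-over b bs j []
  (i ∷ e) → trans (cong (λ k → G (b ∷ bs) (k ∷ e)) (ℕ.+-assoc b j i)) (G-even-over b bs (j + i) e)
desc-G-over b bs j (suc d) as = cong₂ _-ℤ_
  (desc-linear 1 d as .resp (G-even-over b bs j))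
  (trans (cong (λ k → desc k d as (G (b ∷ bs))) (sym (ℕ.+-suc b j))) (desc-G-over b bs (suc j) d as))

-- Behind an exhausted even block, cutting and continuing count the same extensions, so their
-- difference, the number with a descent there, is 0.
desc-G-0 : ∀ b {bs} d as → All NonZero bs → desc b (suc d) as (G (b ∷ bs)) ≡ 0ℤ
desc-G-0 b {bs} d as ps = ℤ.i≡j⇒i-j≡0 (begin
  desc 1 d as (G (b ∷ bs) ∘ (b ∷_))
    ≡⟨ desc-linear 1 d as .resp (λ e → trans (cong (λ k → G (b ∷ bs) (k ∷ e)) (sym (ℕ.+-identityʳ b)))
         (trans (G-even-over b bs 0 e) (G-odd-0∷ e ps))) ⟩
  desc 1 d as (G (0 ◂ bs))
    ≡⟨ desc-G-over b bs 1 d as ⟨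
  desc (b + 1) d as (G (b ∷ bs))
    ≡⟨ cong (λ k → desc k d as (G (b ∷ bs))) (ℕ.+-comm b 1) ⟩
  desc (suc b) d as (G (b ∷ bs)) ∎)

desc-G-under : ∀ k c d bs as → desc k (suc d) as (G (k + suc c ∷ bs)) ≡
  +ℕ ((k + suc c) choose k) *ℤ desc 1 d as (G (suc c ∷ bs)) -ℤ desc (suc k) d as (G (k + suc c ∷ bs))
desc-G-under k c d bs as = cong (_-ℤ desc (suc k) d as (G (k + suc c ∷ bs)))
  (trans (desc-linear 1 d as .resp (G-even-under k c bs))
         (scale (desc-linear 1 d as) (+ℕ ((k + suc c) choose k)) (G (suc c ∷ bs))))

-- Both terms of the inclusion-exclusion have one descent and one spare entry fewer; the spare
-- entries run out first, and `desc-G-0` applies.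
desc-G-long : ∀ k d r {bs} as → All NonZero bs → r ℕ.< d → desc k d as (G (k + r ∷ bs)) ≡ 0ℤ
desc-G-long k (suc d) zero {bs} as ps _ =
  subst (λ b → desc k (suc d) as (G (b ∷ bs)) ≡ 0ℤ) (sym (ℕ.+-identityʳ k)) (desc-G-0 k d as ps)
desc-G-long k (suc d) (suc r) {bs} as ps (ℕ.s≤s r<d) = begin
  desc k (suc d) as (G (k + suc r ∷ bs))
    ≡⟨ desc-G-under k r d bs as ⟩
  _ ≡⟨ cong₂ (λ x y → c *ℤ x -ℤ y) (desc-G-long 1 d r as ps r<d)
        (trans (cong (λ b → desc (suc k) d as (G (b ∷ bs))) (ℕ.+-suc k r))
               (desc-G-long (suc k) d r as ps r<d)) ⟩
  c *ℤ 0ℤ -ℤ 0ℤ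
    ≡⟨ cong (_-ℤ 0ℤ) (ℤ.*-zeroʳ c) ⟩
  0ℤ ∎
  where c = +ℕ ((k + suc r) choose k)

-- The coefficient counts the arrangements of an even block that ascend through `suc k` entries and
-- then descend `d` times: the largest entry sits at the turn, and `k` of the other `k + d` precede
-- it. Inclusion-exclusion is Pascal's rule.
desc-G-exact : ∀ k d {bs} as → All NonZero bs →
  desc (suc k) d as (G (suc k + d ∷ bs)) ≡ +ℕ ((k + d) choose k) *ℤ Λᵒ as (G (0 ◂ bs))
desc-G-exact k zero {bs} as ps = begin
  desc (suc k) 0 as (G (suc k + 0 ∷ bs))
    ≡⟨ cong (λ k′ → desc k′ 0 as (G (suc k + 0 ∷ bs))) (ℕ.+-identityʳ (suc k)) ⟨
  desc (suc k + 0) 0 as (G (suc k + 0 ∷ bs))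
    ≡⟨ cong (λ k′ → desc k′ 0 as (G (suc k + 0 ∷ bs))) (ℕ.+-identityʳ (suc k + 0)) ⟨
  desc (suc k + 0 + 0) 0 as (G (suc k + 0 ∷ bs))
    ≡⟨ desc-G-over (suc k + 0) bs 0 0 as ⟩
  Λᵒ as (G (0 ◂ bs) ∘ shift 0)
    ≡⟨ Λᵒ-linear as .resp (λ { [] → G-odd-0∷ [] ps ; (_ ∷ _) → refl }) ⟩
  Λᵒ as (G (0 ◂ bs))
    ≡⟨ ℤ.*-identityˡ _ ⟨
  1ℤ *ℤ Λᵒ as (G (0 ◂ bs))
    ≡⟨ cong (λ c → +ℕ c *ℤ Λᵒ as (G (0 ◂ bs))) (trans (cong (_choose k) (ℕ.+-identityʳ k)) (nCn≡1 k)) ⟨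
  +ℕ ((k + 0) choose k) *ℤ Λᵒ as (G (0 ◂ bs)) ∎
desc-G-exact k (suc d) {bs} as ps = begin
  desc (suc k) (suc d) as (G (suc k + suc d ∷ bs))
    ≡⟨ desc-G-under (suc k) d d bs as ⟩
  _ ≡⟨ cong₂ (λ x y → +ℕ (suc n choose suc k) *ℤ x -ℤ y)
         (trans (desc-G-exact 0 d as ps) (trans (cong (λ c → +ℕ c *ℤ Z) (nC0≡1 d)) (ℤ.*-identityˡ Z)))
         (trans (cong (λ b → desc (suc (suc k)) d as (G (suc b ∷ bs))) (ℕ.+-suc k d))
           (trans (desc-G-exact (suc k) d as ps)
                  (cong (λ m → +ℕ (m choose suc k) *ℤ Z) (sym (ℕ.+-suc k d))))) ⟩
  +ℕ (suc n choose suc k) *ℤ Z -ℤ +ℕ (n choose suc k) *ℤ Z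
    ≡⟨ cong (λ c → +ℕ c *ℤ Z -ℤ +ℕ (n choose suc k) *ℤ Z) (nCk+nC[k+1]≡[n+1]C[k+1] n k) ⟨
  +ℕ (n choose k + n choose suc k) *ℤ Z -ℤ +ℕ (n choose suc k) *ℤ Z
    ≡⟨ cong (_-ℤ +ℕ (n choose suc k) *ℤ Z) (ℤ.*-distribʳ-+ Z (+ℕ (n choose k)) (+ℕ (n choose suc k))) ⟩
  +ℕ (n choose k) *ℤ Z +ℤ +ℕ (n choose suc k) *ℤ Z -ℤ +ℕ (n choose suc k) *ℤ Z
    ≡⟨ trans (ℤ.+-assoc (+ℕ (n choose k) *ℤ Z) _ _)
         (trans (cong (+ℕ (n choose k) *ℤ Z +ℤ_) (ℤ.+-inverseʳ (+ℕ (n choose suc k) *ℤ Z))) (ℤ.+-identityʳ _)) ⟩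
  +ℕ (n choose k) *ℤ Z ∎
  where
  n = k + suc d
  Z = Λᵒ as (G (0 ◂ bs))

Λᵉ-G-∷ : ∀ a as {bs} → All NonZero bs → Λᵉ (suc a ∷ as) (G (suc a ∷ bs)) ≡ Λᵒ as (G (0 ◂ bs))
Λᵉ-G-∷ a as {bs} ps = trans (desc-G-exact 0 a as ps)
  (trans (cong (λ c → +ℕ c *ℤ Λᵒ as (G (0 ◂ bs))) (nC0≡1 a)) (ℤ.*-identityˡ _))

Λᵒ-G-∷ : ∀ a as bs → Λᵒ (a ∷ as) (G (0 ∷ a ∷ bs)) ≡ Λᵉ as (G bs)
Λᵒ-G-∷ a as bs = Λᵉ-linear as .resp (G-odd-full a bs)

mutual
  Λᵒ-diagonal : ∀ {as} → All NonZero as → Λᵒ as (G (0 ◂ as)) ≡ 1ℤ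
  Λᵒ-diagonal [] = refl
  Λᵒ-diagonal (_∷_ {x = a} {xs = as} p ps) = trans (Λᵒ-G-∷ a as as) (Λᵉ-diagonal ps)

  Λᵉ-diagonal : ∀ {as} → All NonZero as → Λᵉ as (G as) ≡ 1ℤ
  Λᵉ-diagonal [] = refl
  Λᵉ-diagonal (_∷_ {x = suc a} {xs = as} p ps) = trans (Λᵉ-G-∷ a as ps) (Λᵒ-diagonal ps)

infix 4 _<ˡᵉˣ_
_<ˡᵉˣ_ : List ℕ → List ℕ → Set
_<ˡᵉˣ_ = Lex-< _≡_ ℕ._<_

G-[]-suc : ∀ k e → G [] (suc k ∷ e) ≡ 0ℤ
G-[]-suc k e = refl

desc-G-[] : ∀ k d as → desc (suc k) d as (G []) ≡ 0ℤ
desc-G-[] k zero    as = zeroˢ (Λᵒ-linear as) λ { [] → refl ; (_ ∷ _) → refl }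
desc-G-[] k (suc d) as = cong₂ _-ℤ_ (zeroˢ (desc-linear 1 d as) (G-[]-suc k)) (desc-G-[] (suc k) d as)

mutual
  Λᵒ-triangular : ∀ {as bs} → All NonZero as → All NonZero bs → bs <ˡᵉˣ as → Λᵒ as (G (0 ◂ bs)) ≡ 0ℤ
  Λᵒ-triangular (_∷_ {x = suc a} {xs = as} _ _) [] halt = zeroˢ (Λᵉ-linear as) (G-[]-suc a)
  Λᵒ-triangular (_∷_ {xs = as} _ _) (_∷_ {xs = bs} _ _) (this b<a) =
    zeroˢ (Λᵉ-linear as) (λ e → G-odd-over bs e b<a)
  Λᵒ-triangular (_∷_ {x = a} {xs = as} _ ps) (_∷_ {xs = bs} _ qs) (next refl lt) =
    trans (Λᵒ-G-∷ a as bs) (Λᵉ-triangular ps qs lt)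

  Λᵉ-triangular : ∀ {as bs} → All NonZero as → All NonZero bs → bs <ˡᵉˣ as → Λᵉ as (G bs) ≡ 0ℤ
  Λᵉ-triangular (_∷_ {x = suc a} {xs = as} _ _) [] halt = desc-G-[] 0 a as
  Λᵉ-triangular (_∷_ {x = suc a} {xs = as} _ _) (_∷_ {x = suc b} {xs = bs} _ qs) (this (ℕ.s≤s b<a)) =
    desc-G-long 1 a b as qs b<a
  Λᵉ-triangular (_∷_ {x = suc a} {xs = as} _ ps) (_∷_ {xs = bs} _ qs) (next refl lt) =
    trans (Λᵉ-G-∷ a as qs) (Λᵒ-triangular ps qs lt)

-- Fundamental quasisymmetric functions

-- run x k e π: the last entry read is x, and k more belong to its segment.
mutual
  cut : Monomial → List ℕ → Bool
  cut []          []      = true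
  cut []          (_ ∷ _) = false
  cut (zero ∷ e)  π       = cut e π
  cut (suc k ∷ e) []      = false
  cut (suc k ∷ e) (x ∷ π) = run x k e π

  run : ℕ → ℕ → Monomial → List ℕ → Bool
  run x zero    e π       = cut e π
  run x (suc k) e []      = false
  run x (suc k) e (y ∷ π) = does (x ℕ.<? y) ∧ run y k e π

nonzeros : Monomial → List ℕ
nonzeros = filter (λ k → ¬? (k ℕ.≟ 0))

nonzeros-positive : ∀ e → All NonZero (nonzeros e)
nonzeros-positive []          = []
nonzeros-positive (zero ∷ e)  = nonzeros-positive e
nonzeros-positive (suc k ∷ e) = _ ∷ nonzeros-positive e

mutual
  cut-nonzeros : ∀ e π → cut (nonzeros e) π ≡ cut e π
  cut-nonzeros []          π       = refl
  cut-nonzeros (zero ∷ e)  π       = cut-nonzeros e π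
  cut-nonzeros (suc k ∷ e) []      = refl
  cut-nonzeros (suc k ∷ e) (x ∷ π) = run-nonzeros x k e π

  run-nonzeros : ∀ x k e π → run x k (nonzeros e) π ≡ run x k e π
  run-nonzeros x zero    e π       = cut-nonzeros e π
  run-nonzeros x (suc k) e []      = refl
  run-nonzeros x (suc k) e (y ∷ π) = cong (_ ∧_) (run-nonzeros y k e π)

compositions-suc-nonempty : ∀ n {γ} → γ ∈ compositions (suc n) → ∃ λ c → ∃ λ cs → parts γ ≡ suc c ∷ cs
compositions-suc-nonempty zero    (here refl) = 0 , [] , refl
compositions-suc-nonempty (suc n) γ∈ with ∈-++⁻ (map one∷ (compositions (suc n))) γ∈
... | inj₁ γ∈ˡ with _ , _ , refl ← ∈-map⁻ one∷ γ∈ˡ = 0 , _ , refl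
... | inj₂ γ∈ʳ with (_ , _) , γ′∈ , refl ← ∈-map⁻ incr γ∈ʳ
               with c , cs , refl ← compositions-suc-nonempty n γ′∈ = suc c , cs , refl

_≡ˡ?_ : (as bs : List ℕ) → Dec (as ≡ bs)
_≡ˡ?_ = ≡-dec ℕ._≟_

-- `compositions n` contains every composition of `n` once and no other, so the coefficients of L
-- are 0 or 1.
Σ-compositions : ∀ n {as} → All NonZero as →
  Σ[ γ ← compositions n ] ⟦ does (as ≡ˡ? parts γ) ⟧ ≡ ⟦ sum as ≡ᵇ n ⟧
Σ-compositions 0 []                                          = refl
Σ-compositions 0 (_∷_ {x = suc a} _ _)                       = refl
Σ-compositions 1 []                                          = refl
Σ-compositions 1 (_∷_ {x = 1} _ [])                          = refl
Σ-compositions 1 (_∷_ {x = 1} _ (_∷_ {x = suc b} _ _))       = refl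
Σ-compositions 1 (_∷_ {x = suc (suc a)} _ _)                 = refl
Σ-compositions (suc (suc n)) {as} ps = begin
  Σ[ γ ← compositions (suc (suc n)) ] ⟦ does (as ≡ˡ? parts γ) ⟧
    ≡⟨ Σ-++ (map one∷ (compositions (suc n))) _ ⟩
  _ ≡⟨ cong₂ _+ℤ_ (Σ-map one∷ (compositions (suc n)) _) (Σ-map incr (compositions (suc n)) _) ⟩
  Σ[ γ ← compositions (suc n) ] ⟦ does (as ≡ˡ? parts (one∷ γ)) ⟧ +ℤ
  Σ[ γ ← compositions (suc n) ] ⟦ does (as ≡ˡ? parts (incr γ)) ⟧
    ≡⟨ byFirstPart ps ⟩
  ⟦ sum as ≡ᵇ suc (suc n) ⟧ ∎
  where
  ends : List ℕ → ℤ
  ends as = Σ[ γ ← compositions (suc n) ] ⟦ does (as ≡ˡ? parts (incr γ)) ⟧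
  byFirstPart : ∀ {as} → All NonZero as →
    Σ[ γ ← compositions (suc n) ] ⟦ does (as ≡ˡ? parts (one∷ γ)) ⟧ +ℤ ends as ≡
    ⟦ sum as ≡ᵇ suc (suc n) ⟧
  byFirstPart [] = cong₂ _+ℤ_ (Σ-zero (compositions (suc n)) λ _ → refl)
    (Σ-zero (compositions (suc n)) λ { {_ , _} γ∈ → case-[] (compositions-suc-nonempty n γ∈) })
    where
    case-[] : ∀ {cs} .{ps : All NonZero cs} → (∃ λ c → ∃ λ cs′ → cs ≡ suc c ∷ cs′) →
      ⟦ does ([] ≡ˡ? parts (incr (cs , ps))) ⟧ ≡ 0ℤ
    case-[] (_ , _ , refl) = refl
  byFirstPart (_∷_ {x = 1} {xs = as} _ ps) = trans
    (cong₂ _+ℤ_ (Σ-compositions (suc n) ps)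
      (Σ-zero (compositions (suc n)) λ { {_ , _} γ∈ → case-1 (compositions-suc-nonempty n γ∈) }))
    (ℤ.+-identityʳ _)
    where
    case-1 : ∀ {cs} .{ps : All NonZero cs} → (∃ λ c → ∃ λ cs′ → cs ≡ suc c ∷ cs′) →
      ⟦ does ((1 ∷ as) ≡ˡ? parts (incr (cs , ps))) ⟧ ≡ 0ℤ
    case-1 (_ , _ , refl) = refl
  byFirstPart (_∷_ {x = suc (suc a)} {xs = as} _ ps) = trans
    (cong₂ _+ℤ_ (Σ-zero (compositions (suc n)) λ _ → refl)
      (trans (Σ-cong∈ (compositions (suc n)) λ { {_ , _} γ∈ → case-suc (compositions-suc-nonempty n γ∈) })
        (Σ-compositions (suc n) {suc a ∷ as} (_ ∷ ps))))
    (ℤ.+-identityˡ _)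
    where
    case-suc : ∀ {cs} .{ps : All NonZero cs} → (∃ λ c → ∃ λ cs′ → cs ≡ suc c ∷ cs′) →
      ⟦ does ((suc (suc a) ∷ as) ≡ˡ? parts (incr (cs , ps))) ⟧ ≡ ⟦ does ((suc a ∷ as) ≡ˡ? cs) ⟧
    case-suc (_ , _ , refl) = refl

-- The test `_≼?_` on a bare list, so that it applies to `nonzeros e`; on `parts δ` the two agree by
-- computation.
refines? : (as : List ℕ) (γ : Composition) →
  Dec (sum as ≡ weight γ × properPartialSums (parts γ) Subset.⊆ properPartialSums as)
refines? as γ = (sum as ℕ.≟ weight γ) ×-dec (properPartialSums (parts γ) Subset.⊆? properPartialSums as)

L-refines : ∀ γ e → L γ e ≡ ⟦ does (refines? (nonzeros e) γ) ⟧
L-refines γ e = begin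
  L γ e
    ≡⟨ Σ-filter (_≼? γ) (compositions (weight γ)) (λ δ → 𝐱^ δ e) ⟩
  Σ[ δ ← compositions (weight γ) ] (⟦ does (refines? (parts δ) γ) ⟧ *ℤ ⟦ does (nonzeros e ≡ˡ? parts δ) ⟧)
    ≡⟨ Σ-cong (compositions (weight γ)) (λ δ → pointwise (parts δ) (nonzeros e ≡ˡ? parts δ)) ⟩
  Σ[ δ ← compositions (weight γ) ] (⟦ does (refines? (nonzeros e) γ) ⟧ *ℤ ⟦ does (nonzeros e ≡ˡ? parts δ) ⟧)
    ≡⟨ Σ-*ˡ ⟦ does (refines? (nonzeros e) γ) ⟧ (compositions (weight γ)) _ ⟨
  ⟦ does (refines? (nonzeros e) γ) ⟧ *ℤ Σ[ δ ← compositions (weight γ) ] ⟦ does (nonzeros e ≡ˡ? parts δ) ⟧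
    ≡⟨ cong (⟦ does (refines? (nonzeros e) γ) ⟧ *ℤ_) (Σ-compositions (weight γ) (nonzeros-positive e)) ⟩
  ⟦ (sum (nonzeros e) ≡ᵇ weight γ) ∧ c ⟧ *ℤ ⟦ sum (nonzeros e) ≡ᵇ weight γ ⟧
    ≡⟨ absorb (sum (nonzeros e) ≡ᵇ weight γ) ⟩
  ⟦ does (refines? (nonzeros e) γ) ⟧ ∎
  where
  c = does (properPartialSums (parts γ) Subset.⊆? properPartialSums (nonzeros e))
  pointwise : ∀ ds (d : Dec (nonzeros e ≡ ds)) →
    ⟦ does (refines? ds γ) ⟧ *ℤ ⟦ does d ⟧ ≡ ⟦ does (refines? (nonzeros e) γ) ⟧ *ℤ ⟦ does d ⟧
  pointwise ds (yes refl) = refl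
  pointwise ds (no _)     = trans (ℤ.*-zeroʳ ⟦ does (refines? ds γ) ⟧)
                              (sym (ℤ.*-zeroʳ ⟦ does (refines? (nonzeros e) γ) ⟧))
  absorb : ∀ b → ⟦ b ∧ c ⟧ *ℤ ⟦ b ⟧ ≡ ⟦ b ∧ c ⟧
  absorb true  = ℤ.*-identityʳ _
  absorb false = refl

pps : List ℕ → List ℕ
pps = properPartialSums

pps-suc : ∀ a as → pps (suc a ∷ as) ≡ map suc (pps (a ∷ as))
pps-suc a []       = refl
pps-suc a (b ∷ as) = cong (suc a ∷_) (map-∘ (pps (b ∷ as)))

0∉map-suc : ∀ {as} → ¬ 0 ∈ map suc as
0∉map-suc 0∈ with ∈-map⁻ suc 0∈
... | _ , _ , ()

0∉pps : ∀ {as} → All NonZero as → ¬ 0 ∈ pps as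
0∉pps (_∷_ {x = suc a} {xs = as} _ _) 0∈ = 0∉map-suc (subst (0 ∈_) (pps-suc a as) 0∈)

∈-map-suc⁻ : ∀ {x as} → suc x ∈ map suc as → x ∈ as
∈-map-suc⁻ sx∈ with _ , x∈ , refl ← ∈-map⁻ suc sx∈ = x∈

C-∷ : ∀ x π → ∃ λ c → ∃ λ cs → parts (C (x ∷ π)) ≡ suc c ∷ cs × suc c + sum cs ≡ suc (length π)
C-∷ x []      = 0 , [] , refl , refl
C-∷ x (y ∷ π) with C (y ∷ π) | C-∷ y π
... | (_ , _) | c , cs , refl , eq with does (x ℕ.<? y)
...   | true  = suc c , cs , refl , cong suc eq
...   | false = 0 , suc c ∷ cs , refl , cong suc eq

weight-C : ∀ x π → weight (C (x ∷ π)) ≡ suc (length π)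
weight-C x π with C (x ∷ π) | C-∷ x π
... | (_ , _) | c , cs , refl , eq = eq

-- The proper partial sums of C are the descent positions; a new first entry shifts them by one.
pps-C : ∀ x y π → pps (parts (C (x ∷ y ∷ π))) ≡
  (if does (x ℕ.<? y) then map suc (pps (parts (C (y ∷ π)))) else 1 ∷ map suc (pps (parts (C (y ∷ π)))))
pps-C x y π with C (y ∷ π) | C-∷ y π
... | (_ , _) | c , cs , refl , _ with does (x ℕ.<? y)
...   | true  = pps-suc (suc c) cs
...   | false = refl

0∉pps-C : ∀ x π → ¬ 0 ∈ pps (parts (C (x ∷ π)))
0∉pps-C x π 0∈ with C (x ∷ π) | C-∷ x π
... | (_ , _) | c , cs , refl , _ = 0∉map-suc (subst (0 ∈_) (pps-suc c cs) 0∈)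

∧-true : ∀ {b c} → b ∧ c ≡ true → b ≡ true × c ≡ true
∧-true {true} eq = refl , eq

Refined : ℕ → Monomial → ℕ → List ℕ → Set
Refined k e x π = suc k + sum e ≡ suc (length π) × pps (parts (C (x ∷ π))) ⊆ pps (suc k ∷ e)

-- Each entry read shifts the descent positions and the cut positions by one, so the inclusion
-- between the two sets passes to the rest of the permutation.
Refined⇒run : ∀ x k {e} π → All NonZero e → Refined k e x π → run x k e π ≡ true
Refined⇒run x zero [] [] _ = refl
Refined⇒run x zero [] (_∷_ {x = suc b} _ _) (() , _)
Refined⇒run x (suc k) [] _ (() , _)
Refined⇒run x zero (y ∷ π) [] (() , _)
Refined⇒run x zero (y ∷ π) (_∷_ {x = suc b} {xs = e} _ ps) (eq , sub) =
  Refined⇒run y b π ps (ℕ.suc-injective eq , λ {a} a∈ →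
    strip a∈ (sub (subst (suc a ∈_) (sym (pps-C x y π)) (weaken (does (x ℕ.<? y)) (∈-map⁺ suc a∈)))))
  where
  D = pps (parts (C (y ∷ π)))
  weaken : ∀ b {z} → z ∈ map suc D → z ∈ (if b then map suc D else 1 ∷ map suc D)
  weaken true  z∈ = z∈
  weaken false z∈ = there z∈
  strip : ∀ {a} → a ∈ D → suc a ∈ pps (1 ∷ suc b ∷ e) → a ∈ pps (suc b ∷ e)
  -- After the shift, `here` is the boundary itself at position 0, which is never a descent position
  -- of the rest.
  strip 0∈ (here refl) = contradiction 0∈ (0∉pps-C y π)
  strip _  (there sa∈) = ∈-map-suc⁻ sa∈
Refined⇒run x (suc k) {e} (y ∷ π) ps (eq , sub)
  with does (x ℕ.<? y) | pps-C x y π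
... | true  | eqC = Refined⇒run y k π ps (ℕ.suc-injective eq , λ {a} a∈ →
  ∈-map-suc⁻ (subst (suc a ∈_) (pps-suc (suc k) e) (sub (subst (suc a ∈_) (sym eqC) (∈-map⁺ suc a∈)))))
-- A descent after `x` is position 1, but the segment has at least two entries, so its first cut
-- comes later.
... | false | eqC = contradiction
  (∈-map-suc⁻ (subst (1 ∈_) (pps-suc (suc k) e) (sub (subst (1 ∈_) (sym eqC) (here refl)))))
  (0∉pps {suc k ∷ e} (_ ∷ ps))

run⇒Refined : ∀ x k {e} π → All NonZero e → run x k e π ≡ true → Refined k e x π
run⇒Refined x zero [] [] _ = refl , λ ()
run⇒Refined x zero [] (_∷_ {x = suc b} _ _) ()
run⇒Refined x zero (y ∷ π) (_∷_ {x = suc b} {xs = e} _ ps) r with run⇒Refined y b π ps r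
... | eq , sub = cong suc eq , λ {a} a∈ → extend (does (x ℕ.<? y)) (subst (a ∈_) (pps-C x y π) a∈)
  where
  D = pps (parts (C (y ∷ π)))
  extend : ∀ c {a} → a ∈ (if c then map suc D else 1 ∷ map suc D) → a ∈ pps (1 ∷ suc b ∷ e)
  extend true  a∈ with _ , z∈ , refl ← ∈-map⁻ suc a∈ = there (∈-map⁺ suc (sub z∈))
  extend false (here refl) = here refl
  extend false (there a∈)  = extend true a∈
run⇒Refined x (suc k) {e} (y ∷ π) ps r with does (x ℕ.<? y) | pps-C x y π
... | true | eqC with run⇒Refined y k π ps r
...   | eq , sub = cong suc eq , λ {a} a∈ →
  subst (a ∈_) (sym (pps-suc (suc k) e)) (extend (subst (a ∈_) eqC a∈))
  where
  extend : ∀ {a} → a ∈ map suc (pps (parts (C (y ∷ π)))) → a ∈ map suc (pps (suc k ∷ e))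
  extend a∈ with _ , z∈ , refl ← ∈-map⁻ suc a∈ = ∈-map⁺ suc (sub z∈)

does≡ : ∀ {P : Set} (P? : Dec P) b → (P → b ≡ true) → (b ≡ true → P) → does P? ≡ b
does≡ P? true  f g = dec-true P? (g refl)
does≡ P? false f g = dec-false P? λ p → contradiction (f p) λ ()

refines-C : ∀ {as} π → All NonZero as → does (refines? as (C π)) ≡ cut as π
refines-C []      []       = refl
refines-C []      (_∷_ {x = suc a} _ _) = refl
refines-C (x ∷ π) []       = dec-false (refines? [] (C (x ∷ π))) λ { (eq , _) →
  contradiction (trans eq (weight-C x π)) λ () }
refines-C (x ∷ π) (_∷_ {x = suc k} {xs = e} p ps) =
  does≡ (refines? (suc k ∷ e) (C (x ∷ π))) (run x k e π)
    (λ { (eq , sub) → Refined⇒run x k π ps (trans eq (weight-C x π) , sub) })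
    (λ r → let (eq , sub) = run⇒Refined x k π ps r in trans eq (sym (weight-C x π)) , sub)

L-C : ∀ π e → L (C π) e ≡ ⟦ cut e π ⟧
L-C π e = trans (L-refines (C π) e)
  (cong ⟦_⟧ (trans (refines-C π (nonzeros-positive e)) (cut-nonzeros e π)))

insertions-↭ : ∀ x ys {π} → π ∈ insertions x ys → π ↭ x ∷ ys
insertions-↭ x []       (here refl) = ↭-refl
insertions-↭ x (y ∷ ys) (here refl) = ↭-refl
insertions-↭ x (y ∷ ys) (there π∈) with _ , ρ∈ , refl ← ∈-map⁻ (y ∷_) π∈ =
  ↭-trans (prep y (insertions-↭ x ys ρ∈)) (swap y x ↭-refl)

permutations-↭ : ∀ xs {π} → π ∈ permutations xs → π ↭ xs
permutations-↭ []       (here refl) = ↭-refl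
permutations-↭ (x ∷ xs) π∈ with ρ , ρ∈ , π∈′ ← find (∈-concatMap⁻ (insertions x) {permutations xs} π∈) =
  ↭-trans (insertions-↭ x ρ π∈′) (prep x (permutations-↭ xs ρ∈))

Σ-permutations-∷ : ∀ x xs (φ : List ℕ → ℤ) →
  Σ (permutations (x ∷ xs)) φ ≡ Σ[ π ← permutations xs ] Σ (insertions x π) φ
Σ-permutations-∷ x xs φ = Σ-concatMap (insertions x) (permutations xs) φ

-- Permutations of ordinal sums

Admissible : (ℕ → ℕ → Bool) → List ℕ → Set
Admissible R = AllPairs (λ x y → R x y ≡ true)

admissible : (ℕ → ℕ → Bool) → List ℕ → Bool
admissible R []      = true
admissible R (x ∷ π) = all (R x) π ∧ admissible R π

all⇒All : ∀ (f : ℕ → Bool) π → all f π ≡ true → All (λ x → f x ≡ true) π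
all⇒All f []      _  = []
all⇒All f (x ∷ π) eq = let (p , q) = ∧-true eq in p ∷ all⇒All f π q

All⇒all : ∀ {f : ℕ → Bool} {π} → All (λ x → f x ≡ true) π → all f π ≡ true
All⇒all []       = refl
All⇒all (p ∷ ps) = cong₂ _∧_ p (All⇒all ps)

admissible⇒ : ∀ R π → admissible R π ≡ true → Admissible R π
admissible⇒ R []      _  = []
admissible⇒ R (x ∷ π) eq = let (p , q) = ∧-true eq in all⇒All (R x) π p ∷ admissible⇒ R π q

⇒admissible : ∀ {R π} → Admissible R π → admissible R π ≡ true
⇒admissible []       = refl
⇒admissible (p ∷ ps) = cong₂ _∧_ (All⇒all p) (⇒admissible ps)

Admissible-insertion : ∀ R x ys {π} → π ∈ insertions x ys → Admissible R π → Admissible R ys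
Admissible-insertion R x []       _           _        = []
Admissible-insertion R x (y ∷ ys) (here refl) (_ ∷ ps) = ps
Admissible-insertion R x (y ∷ ys) (there π∈) ps with _ , ρ∈ , refl ← ∈-map⁻ (y ∷_) π∈ with q ∷ qs ← ps =
  All.tail (All-resp-↭ (insertions-↭ x ys ρ∈) q) ∷ Admissible-insertion R x ys ρ∈ qs

-- Deleting an entry preserves admissibility. The extra factor lets the sum over all insertions of
-- `x` serve as the weight in the induction hypothesis.
admissible-insertion : ∀ R x ys {π} → π ∈ insertions x ys →
  admissible R π ≡ admissible R ys ∧ admissible R π
admissible-insertion R x ys {π} π∈ with admissible R π in eq
... | true  = sym (cong (_∧ true) (⇒admissible (Admissible-insertion R x ys π∈ (admissible⇒ R π eq))))
... | false = sym (∧-zeroʳ (admissible R ys))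

module _ (R R′ : ℕ → ℕ → Bool) (X Y : List ℕ)
  (before : ∀ {x z} → x ∈ X → z ∈ X ⊎ z ∈ Y → R x z ≡ true)
  (after  : ∀ {y x} → y ∈ Y → x ∈ X → R y x ≡ false)
  (within : ∀ {y z} → y ∈ Y → z ∈ Y → R y z ≡ R′ y z) where

  all-before : ∀ {x π} → x ∈ X → All (λ z → z ∈ X ⊎ z ∈ Y) π → all (R x) π ≡ true
  all-before x∈ zs = All⇒all (All.map (before x∈) zs)

  all-within : ∀ {y π} → y ∈ Y → All (_∈ Y) π → all (R y) π ≡ all (R′ y) π
  all-within y∈ []       = refl
  all-within y∈ (p ∷ ps) = cong₂ _∧_ (within y∈ p) (all-within y∈ ps)

  admissible-within : ∀ {π} → All (_∈ Y) π → admissible R π ≡ admissible R′ π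
  admissible-within []       = refl
  admissible-within (p ∷ ps) = cong₂ _∧_ (all-within p ps) (admissible-within ps)

  admissible-++ : ∀ {π ρ} → All (_∈ X) π → All (_∈ Y) ρ → admissible R (π ++ ρ) ≡ admissible R ρ
  admissible-++ []             qs = refl
  admissible-++ {_ ∷ π} (p ∷ ps) qs = cong₂ _∧_ (all-before p (mixed ps)) (admissible-++ ps qs)
    where
    mixed : ∀ {π} → All (_∈ X) π → All (λ z → z ∈ X ⊎ z ∈ Y) (π ++ _)
    mixed []       = All.map inj₂ qs
    mixed (p ∷ ps) = inj₁ p ∷ mixed ps

  -- An element of `X` may not follow one of `Y`, so every admissible insertion takes place within
  -- `π` or at its end.
  Σ-insertions-++ : ∀ {x} → x ∈ X → ∀ {π ρ} → All (_∈ X) π → All (_∈ Y) ρ → admissible R ρ ≡ true →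
    (φ : List ℕ → ℤ) →
    Σ[ τ ← insertions x (π ++ ρ) ] (⟦ admissible R τ ⟧ *ℤ φ τ) ≡ Σ[ τ ← insertions x π ] φ (τ ++ ρ)
  Σ-insertions-++ {x} x∈ [] [] _ φ = cong (_+ℤ 0ℤ) (ℤ.*-identityˡ (φ (x ∷ [])))
  Σ-insertions-++ {x} x∈ {ρ = y ∷ ρ} [] (q ∷ qs) ad φ = cong₂ _+ℤ_
    (trans (cong (λ b → ⟦ b ⟧ *ℤ φ (x ∷ y ∷ ρ)) (cong₂ _∧_ (all-before x∈ (All.map inj₂ (q ∷ qs))) ad))
           (ℤ.*-identityˡ (φ (x ∷ y ∷ ρ))))
    (trans (Σ-map (y ∷_) (insertions x ρ) _) (Σ-zero (insertions x ρ) λ {τ} τ∈ →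
      cong (λ b → ⟦ b ⟧ *ℤ φ (y ∷ τ)) (blocked τ∈)))
    where
    blocked : ∀ {τ} → τ ∈ insertions x ρ → admissible R (y ∷ τ) ≡ false
    blocked {τ} τ∈ with admissible R (y ∷ τ) in eq
    ... | false = refl
    ... | true with p ∷ _ ← admissible⇒ R (y ∷ τ) eq =
      trans (sym (All.lookup p (∈-resp-↭ (↭-sym (insertions-↭ x ρ τ∈)) (here refl)))) (after q x∈)
  Σ-insertions-++ {x} x∈ {z ∷ π} {ρ} (p ∷ ps) qs ad φ = cong₂ _+ℤ_
    (trans (cong (λ b → ⟦ b ⟧ *ℤ φ (x ∷ z ∷ π ++ ρ))
             (trans (admissible-++ (x∈ ∷ p ∷ ps) qs) ad))
           (ℤ.*-identityˡ (φ (x ∷ z ∷ π ++ ρ))))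
    (begin
      _ ≡⟨ Σ-map (z ∷_) (insertions x (π ++ ρ)) _ ⟩
      Σ[ τ ← insertions x (π ++ ρ) ] (⟦ admissible R (z ∷ τ) ⟧ *ℤ φ (z ∷ τ))
        ≡⟨ Σ-cong∈ (insertions x (π ++ ρ)) (λ {τ} τ∈ → cong (λ b → ⟦ b ∧ admissible R τ ⟧ *ℤ φ (z ∷ τ))
             (all-before p (All-resp-↭ (↭-sym (insertions-↭ x (π ++ ρ) τ∈)) (inj₁ x∈ ∷ mixed ps)))) ⟩
      Σ[ τ ← insertions x (π ++ ρ) ] (⟦ admissible R τ ⟧ *ℤ φ (z ∷ τ))
        ≡⟨ Σ-insertions-++ x∈ ps qs ad (φ ∘ (z ∷_)) ⟩
      Σ[ τ ← insertions x π ] φ (z ∷ τ ++ ρ)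
        ≡⟨ Σ-map (z ∷_) (insertions x π) _ ⟨
      _ ∎)
    where
    mixed : ∀ {π} → All (_∈ X) π → All (λ z → z ∈ X ⊎ z ∈ Y) (π ++ ρ)
    mixed []       = All.map inj₂ qs
    mixed (p ∷ ps) = inj₁ p ∷ mixed ps

  -- `Z` stands for the part of `X` inserted so far: the induction removes its head while the
  -- hypotheses on `X` stay fixed.
  Σ-permutations-++ : ∀ Z → All (_∈ X) Z → (φ : List ℕ → ℤ) →
    Σ[ π ← permutations (Z ++ Y) ] (⟦ admissible R π ⟧ *ℤ φ π) ≡
    Σ[ π ← permutations Z ] Σ[ ρ ← permutations Y ] (⟦ admissible R′ ρ ⟧ *ℤ φ (π ++ ρ))
  Σ-permutations-++ [] _ φ = sym (trans (ℤ.+-identityʳ _)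
    (Σ-cong∈ (permutations Y) λ {ρ} ρ∈ → cong (λ b → ⟦ b ⟧ *ℤ φ ρ) (sym (admissible-within (elements Y ρ∈)))))
    where
    elements : ∀ xs {π} → π ∈ permutations xs → All (_∈ xs) π
    elements xs π∈ = All.tabulate (∈-resp-↭ (permutations-↭ xs π∈))
  Σ-permutations-++ (x ∷ Z) (p ∷ ps) φ = begin
    Σ[ π ← permutations (x ∷ Z ++ Y) ] (⟦ admissible R π ⟧ *ℤ φ π)
      ≡⟨ Σ-permutations-∷ x (Z ++ Y) _ ⟩
    Σ[ π ← permutations (Z ++ Y) ] Σ[ τ ← insertions x π ] (⟦ admissible R τ ⟧ *ℤ φ τ)
      ≡⟨ Σ-cong (permutations (Z ++ Y)) (λ π → begin
           _ ≡⟨ Σ-cong∈ (insertions x π) (λ {τ} τ∈ → begin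
                  ⟦ admissible R τ ⟧ *ℤ φ τ
                    ≡⟨ cong (λ b → ⟦ b ⟧ *ℤ φ τ) (admissible-insertion R x π τ∈) ⟩
                  ⟦ admissible R π ∧ admissible R τ ⟧ *ℤ φ τ
                    ≡⟨ cong (_*ℤ φ τ) (⟦∧⟧ (admissible R π) (admissible R τ)) ⟩
                  ⟦ admissible R π ⟧ *ℤ ⟦ admissible R τ ⟧ *ℤ φ τ
                    ≡⟨ ℤ.*-assoc ⟦ admissible R π ⟧ _ _ ⟩
                  ⟦ admissible R π ⟧ *ℤ (⟦ admissible R τ ⟧ *ℤ φ τ) ∎) ⟩
           _ ≡⟨ Σ-*ˡ ⟦ admissible R π ⟧ (insertions x π) _ ⟨
           ⟦ admissible R π ⟧ *ℤ ψ π ∎) ⟩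
    Σ[ π ← permutations (Z ++ Y) ] (⟦ admissible R π ⟧ *ℤ ψ π)
      ≡⟨ Σ-permutations-++ Z ps ψ ⟩
    Σ[ π ← permutations Z ] Σ[ ρ ← permutations Y ] (⟦ admissible R′ ρ ⟧ *ℤ ψ (π ++ ρ))
      ≡⟨ Σ-cong∈ (permutations Z) (λ π∈ → Σ-cong∈ (permutations Y) λ ρ∈ → pointwise π∈ ρ∈) ⟩
    Σ[ π ← permutations Z ] Σ[ ρ ← permutations Y ] Σ[ τ ← insertions x π ] (⟦ admissible R′ ρ ⟧ *ℤ φ (τ ++ ρ))
      ≡⟨ Σ-cong (permutations Z) (λ π → Σ-swap (permutations Y) (insertions x π) _) ⟩
    Σ[ π ← permutations Z ] Σ[ τ ← insertions x π ] Σ[ ρ ← permutations Y ] (⟦ admissible R′ ρ ⟧ *ℤ φ (τ ++ ρ))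
      ≡⟨ Σ-permutations-∷ x Z _ ⟨
    Σ[ π ← permutations (x ∷ Z) ] Σ[ ρ ← permutations Y ] (⟦ admissible R′ ρ ⟧ *ℤ φ (π ++ ρ)) ∎
    where
    ψ : List ℕ → ℤ
    ψ π = Σ[ τ ← insertions x π ] (⟦ admissible R τ ⟧ *ℤ φ τ)
    pointwise : ∀ {π ρ} → π ∈ permutations Z → ρ ∈ permutations Y →
      ⟦ admissible R′ ρ ⟧ *ℤ ψ (π ++ ρ) ≡ Σ[ τ ← insertions x π ] (⟦ admissible R′ ρ ⟧ *ℤ φ (τ ++ ρ))
    pointwise {π} {ρ} π∈ ρ∈ with admissible R′ ρ in eq
    ... | false = sym (Σ-zero (insertions x π) {λ τ → 0ℤ *ℤ φ (τ ++ ρ)} λ _ → refl)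
    ... | true  = begin
      1ℤ *ℤ ψ (π ++ ρ)
        ≡⟨ ℤ.*-identityˡ _ ⟩
      ψ (π ++ ρ)
        ≡⟨ Σ-insertions-++ p
             (All-resp-↭ (↭-sym (permutations-↭ Z π∈)) ps) ρ⊆Y
             (trans (admissible-within ρ⊆Y) eq) φ ⟩
      Σ[ τ ← insertions x π ] φ (τ ++ ρ)
        ≡⟨ Σ-cong (insertions x π) (λ τ → ℤ.*-identityˡ _) ⟨
      Σ[ τ ← insertions x π ] (1ℤ *ℤ φ (τ ++ ρ)) ∎
      where
      ρ⊆Y : All (_∈ Y) ρ
      ρ⊆Y = All.tabulate (∈-resp-↭ (permutations-↭ Y ρ∈))

-- Linear extensions

⊑-antisym : ∀ {x y : ℕ} {π} → Unique π → x ∷ y ∷ [] ⊑ π → y ∷ x ∷ [] ⊑ π → ⊥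
⊑-antisym (_ ∷ u) (_ ∷ʳ p)   (_ ∷ʳ q)   = ⊑-antisym u p q
⊑-antisym (n ∷ u) (_ ∷ʳ p)   (refl ∷ q) = All.lookup n (to∈ (∷ˡ⁻ p)) refl
⊑-antisym (n ∷ u) (refl ∷ p) (_ ∷ʳ q)   = All.lookup n (to∈ (∷ˡ⁻ q)) refl
⊑-antisym (n ∷ u) (refl ∷ p) (refl ∷ q) = All.lookup n (to∈ p) refl

⊑-total : ∀ {x y : ℕ} {π} → x ≢ y → x ∈ π → y ∈ π → x ∷ y ∷ [] ⊑ π ⊎ y ∷ x ∷ [] ⊑ π
⊑-total x≢y (here refl) (here refl) = contradiction refl x≢y
⊑-total x≢y (here refl) (there y∈)  = inj₁ (refl ∷ from∈ y∈)
⊑-total x≢y (there x∈)  (here refl) = inj₂ (refl ∷ from∈ x∈)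
⊑-total x≢y (there x∈)  (there y∈) with ⊑-total x≢y x∈ y∈
... | inj₁ p = inj₁ (_ ∷ʳ p)
... | inj₂ p = inj₂ (_ ∷ʳ p)

AllPairs⇒⊑ : ∀ {Q : ℕ → ℕ → Set} {x y π} → AllPairs Q π → x ∷ y ∷ [] ⊑ π → Q x y
AllPairs⇒⊑ (_ ∷ qs) (_ ∷ʳ p)   = AllPairs⇒⊑ qs p
AllPairs⇒⊑ (q ∷ _)  (refl ∷ p) = All.lookup q (to∈ p)

⊑⇒AllPairs : ∀ {Q : ℕ → ℕ → Set} π → (∀ {x y} → x ∷ y ∷ [] ⊑ π → Q x y) → AllPairs Q π
⊑⇒AllPairs []      h = []
⊑⇒AllPairs (x ∷ π) h = All.tabulate (λ y∈ → h (refl ∷ from∈ y∈)) ∷ ⊑⇒AllPairs π (h ∘ (x ∷ʳ_))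

mayPrecede : LabeledPoset → ℕ → ℕ → Bool
mayPrecede P x y = not (does (LabeledPoset._≺?_ P y x))

-- In a permutation any two labels occur in exactly one order, so asking that smaller elements come
-- first is asking that no later entry lies below an earlier one.
does-isLinearExtension : ∀ P {π} → π ∈ permutations (labels P) →
  does (LabeledPoset.isLinearExtension? P π) ≡ admissible (mayPrecede P) π
does-isLinearExtension P {π} π∈ = does≡ (isLinearExtension? π) _ to from
  where
  open LabeledPoset P using (_≺_; _≺?_; isStrictPartialOrder; isLinearExtension?; unique; support)
  π↭ = permutations-↭ (labels P) π∈
  uniqueπ : Unique π
  uniqueπ = Permutation.Unique-resp-↭ (setoid ℕ) (↭⇒↭ₛ (↭-sym π↭)) unique

  to : IsLinearExtension P π → admissible (mayPrecede P) π ≡ true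
  to le = ⇒admissible (⊑⇒AllPairs π λ {x} {y} xy⊑π →
    cong not (dec-false (y ≺? x) λ y≺x → ⊑-antisym uniqueπ xy⊑π (le y≺x)))

  from : admissible (mayPrecede P) π ≡ true → IsLinearExtension P π
  from ad {x} {y} x≺y with ⊑-total (λ x≡y → IsStrictPartialOrder.irrefl isStrictPartialOrder x≡y x≺y)
      (∈-resp-↭ (↭-sym π↭) (proj₁ (support x≺y))) (∈-resp-↭ (↭-sym π↭) (proj₂ (support x≺y)))
  ... | inj₁ xy⊑π = xy⊑π
  ... | inj₂ yx⊑π = contradiction
    (trans (sym (cong not (dec-true (x ≺? y) x≺y))) (AllPairs⇒⊑ (admissible⇒ _ π ad) yx⊑π)) λ ()

Σ-linearExtensions : ∀ P (φ : List ℕ → ℤ) → Σ (linearExtensions P) φ ≡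
  Σ[ π ← permutations (labels P) ] (⟦ admissible (mayPrecede P) π ⟧ *ℤ φ π)
Σ-linearExtensions P φ = trans (Σ-filter (LabeledPoset.isLinearExtension? P) (permutations (labels P)) φ)
  (Σ-cong∈ (permutations (labels P)) λ {π} π∈ → cong (λ b → ⟦ b ⟧ *ℤ φ π) (does-isLinearExtension P π∈))

IsAntichain : LabeledPoset → Set
IsAntichain P = ∀ x y → ¬ LabeledPoset._≺_ P x y

Σ-linearExtensions-⊕ : ∀ P Q (P#Q : DisjointLabels P Q) → IsAntichain P → (φ : List ℕ → ℤ) →
  Σ (linearExtensions (P ⊕ Q [ P#Q ])) φ ≡
  Σ[ π ← permutations (labels P) ] Σ[ ρ ← linearExtensions Q ] φ (π ++ ρ)
Σ-linearExtensions-⊕ P Q P#Q antichain φ = begin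
  Σ (linearExtensions PQ) φ
    ≡⟨ Σ-linearExtensions PQ φ ⟩
  Σ[ π ← permutations (labels P ++ labels Q) ] (⟦ admissible (mayPrecede PQ) π ⟧ *ℤ φ π)
    ≡⟨ Σ-permutations-++ (mayPrecede PQ) (mayPrecede Q) (labels P) (labels Q) before after within
         (labels P) (All.tabulate λ x∈ → x∈) φ ⟩
  Σ[ π ← permutations (labels P) ] Σ[ ρ ← permutations (labels Q) ]
    (⟦ admissible (mayPrecede Q) ρ ⟧ *ℤ φ (π ++ ρ))
    ≡⟨ Σ-cong (permutations (labels P)) (λ π → Σ-linearExtensions Q (λ ρ → φ (π ++ ρ))) ⟨
  Σ[ π ← permutations (labels P) ] Σ[ ρ ← linearExtensions Q ] φ (π ++ ρ) ∎
  where
  PQ = P ⊕ Q [ P#Q ]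
  module Q = LabeledPoset Q
  open LabeledPoset PQ using (_≺_; _≺?_)

  before : ∀ {x z} → x ∈ labels P → z ∈ labels P ⊎ z ∈ labels Q → mayPrecede PQ x z ≡ true
  before {x} {z} x∈ _ = cong not (dec-false (z ≺? x) λ where
    (inj₁ z≺x)             → antichain z x z≺x
    (inj₂ (inj₁ z≺x))      → P#Q (x∈ , proj₂ (Q.support z≺x))
    (inj₂ (inj₂ (_ , x∈′))) → P#Q (x∈ , x∈′))

  after : ∀ {y x} → y ∈ labels Q → x ∈ labels P → mayPrecede PQ y x ≡ false
  after {y} {x} y∈ x∈ = cong not (dec-true (x ≺? y) (inj₂ (inj₂ (x∈ , y∈))))

  within : ∀ {y z} → y ∈ labels Q → z ∈ labels Q → mayPrecede PQ y z ≡ mayPrecede Q y z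
  within {y} {z} y∈ z∈ = cong not (does≡ (z ≺? y) _
    (λ where
      (inj₁ z≺y)             → contradiction z≺y (antichain z y)
      (inj₂ (inj₁ z≺y))      → dec-true (z Q.≺? y) z≺y
      (inj₂ (inj₂ (z∈′ , _))) → contradiction (z∈′ , z∈) P#Q)
    (λ eq → inj₂ (inj₁ (decided (z Q.≺? y) eq))))
    where
    decided : ∀ {A : Set} (d : Dec A) → does d ≡ true → A
    decided (yes a) _ = a

concatenations : List (List ℕ) → (List ℕ → ℤ) → ℤ
concatenations []       φ = φ []
concatenations (X ∷ Xs) φ = Σ[ π ← permutations X ] concatenations Xs (λ ρ → φ (π ++ ρ))

Σ-linearExtensions-⨁ : ∀ Ps (ds : AllPairs DisjointLabels Ps) → All IsAntichain Ps → (φ : List ℕ → ℤ) →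
  Σ (linearExtensions (⨁ Ps ds)) φ ≡ concatenations (map labels Ps) φ
Σ-linearExtensions-⨁ []       []       []       φ = ℤ.+-identityʳ _
Σ-linearExtensions-⨁ (P ∷ Ps) (d ∷ ds) (a ∷ as) φ = begin
  Σ (linearExtensions (⨁ (P ∷ Ps) (d ∷ ds))) φ
    ≡⟨ Σ-linearExtensions-⊕ P (⨁ Ps ds) (⨁-disjoint P Ps d ds) a φ ⟩
  Σ[ π ← permutations (labels P) ] Σ[ ρ ← linearExtensions (⨁ Ps ds) ] φ (π ++ ρ)
    ≡⟨ Σ-cong (permutations (labels P)) (λ π → Σ-linearExtensions-⨁ Ps ds as (λ ρ → φ (π ++ ρ))) ⟩
  concatenations (map labels (P ∷ Ps)) φ ∎

-- Increasing prefixes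

ascendsFrom : ℕ → ℕ → List ℕ → Bool
ascendsFrom x zero    π       = true
ascendsFrom x (suc k) []      = false
ascendsFrom x (suc k) (y ∷ π) = does (x ℕ.<? y) ∧ ascendsFrom y k π

ascends : ℕ → List ℕ → Bool
ascends zero    π       = true
ascends (suc k) []      = false
ascends (suc k) (x ∷ π) = ascendsFrom x k π

-- `x` is smaller than everything in a prefix ascending from `y`, so only insertions behind that
-- prefix survive.
Σ-insertions-ascendsFrom : ∀ {x y} k ys → x ℕ.< y → (χ : List ℕ → List ℕ → ℤ) →
  Σ[ τ ← insertions x ys ] (⟦ ascendsFrom y k τ ⟧ *ℤ χ (take k τ) (drop k τ)) ≡
  ⟦ ascendsFrom y k ys ⟧ *ℤ Σ[ τ ← insertions x (drop k ys) ] χ (take k ys) τ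
Σ-insertions-ascendsFrom {x} zero ys x<y χ = sym (Σ-*ˡ 1ℤ (insertions x ys) (χ []))
Σ-insertions-ascendsFrom {x} {y} (suc k) [] x<y χ =
  trans (ℤ.+-identityʳ _)
    (cong (λ b → ⟦ b ∧ ascendsFrom x k [] ⟧ *ℤ χ (x ∷ take k []) (drop k []))
      (dec-false (y ℕ.<? x) (ℕ.<⇒≯ x<y)))
Σ-insertions-ascendsFrom {x} {y} (suc k) (z ∷ zs) x<y χ = begin
  _ ≡⟨ cong₂ _+ℤ_
         (cong (λ b → ⟦ b ∧ ascendsFrom x k (z ∷ zs) ⟧ *ℤ χ (x ∷ take k (z ∷ zs)) (drop k (z ∷ zs)))
           (dec-false (y ℕ.<? x) (ℕ.<⇒≯ x<y)))
         (Σ-map (z ∷_) (insertions x zs) _) ⟩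
  _ ≡⟨ ℤ.+-identityˡ _ ⟩
  Σ[ τ ← insertions x zs ] (⟦ does (y ℕ.<? z) ∧ ascendsFrom z k τ ⟧ *ℤ χ (z ∷ take k τ) (drop k τ))
    ≡⟨ step (y ℕ.<? z) ⟩
  ⟦ does (y ℕ.<? z) ∧ ascendsFrom z k zs ⟧ *ℤ Σ[ τ ← insertions x (drop k zs) ] χ (z ∷ take k zs) τ ∎
  where
  step : (d : Dec (y ℕ.< z)) →
    Σ[ τ ← insertions x zs ] (⟦ does d ∧ ascendsFrom z k τ ⟧ *ℤ χ (z ∷ take k τ) (drop k τ)) ≡
    ⟦ does d ∧ ascendsFrom z k zs ⟧ *ℤ Σ[ τ ← insertions x (drop k zs) ] χ (z ∷ take k zs) τ
  step (yes y<z) = Σ-insertions-ascendsFrom k zs (ℕ.<-trans x<y y<z) (χ ∘ (z ∷_))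
  step (no _)    = Σ-zero (insertions x zs) λ _ → refl

ascendsFrom-minimum : ∀ {x} k {π} → All (x ℕ.<_) π → ascendsFrom x k π ≡ ascends k π
ascendsFrom-minimum zero    _        = refl
ascendsFrom-minimum (suc k) []       = refl
ascendsFrom-minimum {x} (suc k) {y ∷ π} (p ∷ _) = cong (_∧ ascendsFrom y k π) (dec-true (x ℕ.<? y) p)

-- A new minimum either opens the ascending prefix or comes after it.
Σ-insertions-ascends-suc : ∀ {x} k {π} → All (x ℕ.<_) π → (ψ : List ℕ → List ℕ → ℤ) →
  Σ[ τ ← insertions x π ] (⟦ ascends (suc k) τ ⟧ *ℤ ψ (take (suc k) τ) (drop (suc k) τ)) ≡
  ⟦ ascends k π ⟧ *ℤ ψ (x ∷ take k π) (drop k π) +ℤ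
  ⟦ ascends (suc k) π ⟧ *ℤ Σ[ τ ← insertions x (drop (suc k) π) ] ψ (take (suc k) π) τ
Σ-insertions-ascends-suc {x} k {[]} [] ψ =
  cong (λ b → ⟦ b ⟧ *ℤ ψ (x ∷ take k []) (drop k []) +ℤ 0ℤ) (ascendsFrom-minimum k [])
Σ-insertions-ascends-suc {x} k {y ∷ π} ps@(p ∷ _) ψ = cong₂ _+ℤ_
  (cong (λ b → ⟦ b ⟧ *ℤ ψ (x ∷ take k (y ∷ π)) (drop k (y ∷ π))) (ascendsFrom-minimum k ps))
  (trans (Σ-map (y ∷_) (insertions x π) _) (Σ-insertions-ascendsFrom k π p (ψ ∘ (y ∷_))))

Sorted : List ℕ → Set
Sorted = AllPairs ℕ._<_

-- An ascending prefix is determined by its set of entries, and a selection from a sorted list is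
-- already in ascending order.
Σ-permutations-ascends : ∀ k {X} → Sorted X → (ψ : List ℕ → List ℕ → ℤ) →
  Σ[ π ← permutations X ] (⟦ ascends k π ⟧ *ℤ ψ (take k π) (drop k π)) ≡
  Σ[ Y , Z ← selections X ] (⟦ length Y ≡ᵇ k ⟧ *ℤ Σ[ ρ ← permutations Z ] ψ Y ρ)
Σ-permutations-ascends zero    [] ψ = cong (λ x → 1ℤ *ℤ x +ℤ 0ℤ) (sym (ℤ.+-identityʳ (ψ [] [])))
Σ-permutations-ascends (suc k) [] ψ = refl
Σ-permutations-ascends zero {x ∷ X} (p ∷ ps) ψ = begin
  Σ[ π ← permutations (x ∷ X) ] (1ℤ *ℤ ψ [] π)
    ≡⟨ Σ-permutations-∷ x X _ ⟩
  Σ[ π ← permutations X ] Σ[ τ ← insertions x π ] (1ℤ *ℤ ψ [] τ)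
    ≡⟨ Σ-cong (permutations X) (λ π → Σ-*ˡ 1ℤ (insertions x π) (ψ [])) ⟨
  Σ[ π ← permutations X ] (1ℤ *ℤ Σ[ τ ← insertions x π ] ψ [] τ)
    ≡⟨ Σ-permutations-ascends zero ps (λ Y ρ → Σ[ τ ← insertions x ρ ] ψ Y τ) ⟩
  Σ[ Y , Z ← selections X ] (⟦ length Y ≡ᵇ 0 ⟧ *ℤ Σ[ ρ ← permutations Z ] Σ[ τ ← insertions x ρ ] ψ Y τ)
    ≡⟨ Σ₂-cong (selections X) (λ Y Z → cong (⟦ length Y ≡ᵇ 0 ⟧ *ℤ_) (Σ-permutations-∷ x Z (ψ Y))) ⟨
  rest
    ≡⟨ ℤ.+-identityˡ rest ⟨
  0ℤ +ℤ rest
    ≡⟨ cong (_+ℤ rest) (Σ-zero (selections X) λ _ → refl) ⟨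
  _ ≡⟨ Σ-selections-∷ x X (λ Y Z → ⟦ length Y ≡ᵇ 0 ⟧ *ℤ Σ[ ρ ← permutations Z ] ψ Y ρ) ⟨
  Σ[ Y , Z ← selections (x ∷ X) ] (⟦ length Y ≡ᵇ 0 ⟧ *ℤ Σ[ ρ ← permutations Z ] ψ Y ρ) ∎
  where
  rest = Σ[ Y , Z ← selections X ] (⟦ length Y ≡ᵇ 0 ⟧ *ℤ Σ[ ρ ← permutations (x ∷ Z) ] ψ Y ρ)
Σ-permutations-ascends (suc k) {x ∷ X} (p ∷ ps) ψ = begin
  Σ[ π ← permutations (x ∷ X) ] (⟦ ascends (suc k) π ⟧ *ℤ ψ (take (suc k) π) (drop (suc k) π))
    ≡⟨ Σ-permutations-∷ x X _ ⟩
  _ ≡⟨ Σ-cong∈ (permutations X) (λ π∈ →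
         Σ-insertions-ascends-suc k (All-resp-↭ (↭-sym (permutations-↭ X π∈)) p) ψ) ⟩
  _ ≡⟨ Σ-+ (permutations X) _ _ ⟩
  _ ≡⟨ cong₂ _+ℤ_ (Σ-permutations-ascends k ps (λ Y → ψ (x ∷ Y)))
         (Σ-permutations-ascends (suc k) ps (λ Y ρ → Σ[ τ ← insertions x ρ ] ψ Y τ)) ⟩
  _ ≡⟨ cong (Σ[ Y , Z ← selections X ] (⟦ length Y ≡ᵇ k ⟧ *ℤ Σ[ ρ ← permutations Z ] ψ (x ∷ Y) ρ) +ℤ_)
         (Σ₂-cong (selections X) λ Y Z → cong (⟦ length Y ≡ᵇ suc k ⟧ *ℤ_) (Σ-permutations-∷ x Z (ψ Y))) ⟨
  _ ≡⟨ Σ-selections-∷ x X (λ Y Z → ⟦ length Y ≡ᵇ suc k ⟧ *ℤ Σ[ ρ ← permutations Z ] ψ Y ρ) ⟨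
  Σ[ Y , Z ← selections (x ∷ X) ] (⟦ length Y ≡ᵇ suc k ⟧ *ℤ Σ[ ρ ← permutations Z ] ψ Y ρ) ∎

run-++ : ∀ x k {e} π ρ → k ℕ.≤ length π → run x k e (π ++ ρ) ≡ ascendsFrom x k π ∧ cut e (drop k π ++ ρ)
run-++ x zero    π       ρ _          = refl
run-++ x (suc k) (y ∷ π) ρ (ℕ.s≤s le) =
  trans (cong (does (x ℕ.<? y) ∧_) (run-++ y k π ρ le)) (sym (∧-assoc (does (x ℕ.<? y)) _ _))

cut-++ : ∀ k {e} π ρ → k ℕ.≤ length π → cut (k ∷ e) (π ++ ρ) ≡ ascends k π ∧ cut e (drop k π ++ ρ)
cut-++ zero    π       ρ _          = refl
cut-++ (suc k) (x ∷ π) ρ (ℕ.s≤s le) = run-++ x k π ρ le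

-- For an odd block `x ∷ π`: a segment that overruns it has to step down into the next even block.
run-stuck : ∀ x k e π {ρ} → length π ℕ.< k → (∀ {z} → z ∈ x ∷ π → ∀ {y ρ′} → ρ ≡ y ∷ ρ′ → y ℕ.< z) →
  run x k e (π ++ ρ) ≡ false
run-stuck x (suc k) e [] {[]}    _ _ = refl
run-stuck x (suc k) e [] {y ∷ ρ} _ h =
  cong (_∧ run y k e ρ) (dec-false (x ℕ.<? y) (ℕ.<⇒≯ (h (here refl) refl)))
run-stuck x (suc k) e (z ∷ π) (ℕ.s≤s lt) h =
  trans (cong (does (x ℕ.<? z) ∧_) (run-stuck z k e π lt (h ∘ there))) (∧-zeroʳ _)

-- For an even block `x ∷ π`: the step into the next odd block ascends of itself, so the segment may
-- be cut there.
run-full : ∀ x j e π {ρ} → (∀ {z} → z ∈ x ∷ π → ∀ {y ρ′} → ρ ≡ y ∷ ρ′ → z ℕ.< y) →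
  run x (length π + j) e (π ++ ρ) ≡ ascendsFrom x (length π) π ∧ cut (j ∷ e) ρ
run-full x zero    e [] _ = refl
run-full x (suc j) e [] {[]}    _ = refl
run-full x (suc j) e [] {y ∷ ρ} h = cong (_∧ run y j e ρ) (dec-true (x ℕ.<? y) (h (here refl) refl))
run-full x j e (z ∷ π) h =
  trans (cong (does (x ℕ.<? z) ∧_) (run-full z j e π (h ∘ there))) (sym (∧-assoc (does (x ℕ.<? z)) _ _))

-- Alternating blocks

first : List (List ℕ) → List ℕ
first []      = []
first (X ∷ _) = X

mutual
  -- Blocks are nonempty, so neighbouring entries of a concatenation come from the same or from
  -- neighbouring blocks; hence only the latter are compared.
  data OddFirst : List (List ℕ) → Set where
    []    : OddFirst []
    block : ∀ {x X Xs} → Sorted (x ∷ X) → (∀ {z y} → z ∈ x ∷ X → y ∈ first Xs → y ℕ.< z) →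
            EvenFirst Xs → OddFirst ((x ∷ X) ∷ Xs)

  data EvenFirst : List (List ℕ) → Set where
    []    : EvenFirst []
    block : ∀ {x X Xs} → Sorted (x ∷ X) → (∀ {z y} → z ∈ x ∷ X → y ∈ first Xs → z ℕ.< y) →
            OddFirst Xs → EvenFirst ((x ∷ X) ∷ Xs)

sizes : List (List ℕ) → List ℕ
sizes = map length

concatenations-cong : ∀ Xs {φ ψ : List ℕ → ℤ} → (∀ ρ → φ ρ ≡ ψ ρ) →
  concatenations Xs φ ≡ concatenations Xs ψ
concatenations-cong []       eq = eq []
concatenations-cong (X ∷ Xs) eq = Σ-cong (permutations X) λ π → concatenations-cong Xs λ ρ → eq (π ++ ρ)

concatenations-*ˡ : ∀ c Xs (φ : List ℕ → ℤ) → concatenations Xs (λ ρ → c *ℤ φ ρ) ≡ c *ℤ concatenations Xs φ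
concatenations-*ˡ c []       φ = refl
concatenations-*ˡ c (X ∷ Xs) φ = trans
  (Σ-cong (permutations X) λ π → concatenations-*ˡ c Xs (λ ρ → φ (π ++ ρ)))
  (sym (Σ-*ˡ c (permutations X) _))

concatenations-zero : ∀ Xs {φ : List ℕ → ℤ} → (∀ ρ → φ ρ ≡ 0ℤ) → concatenations Xs φ ≡ 0ℤ
concatenations-zero []       eq = eq []
concatenations-zero (X ∷ Xs) eq = Σ-zero (permutations X) λ {π} _ → concatenations-zero Xs λ ρ → eq (π ++ ρ)

HeadIn : List ℕ → List ℕ → Set
HeadIn Y ρ = ∀ {y ρ′} → ρ ≡ y ∷ ρ′ → y ∈ Y

headIn-++ : ∀ {x X π} ρ → π ∈ permutations (x ∷ X) → HeadIn (x ∷ X) (π ++ ρ)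
headIn-++ {x} {X} {[]}    ρ π∈ eq with () ← ↭-length (permutations-↭ (x ∷ X) π∈)
headIn-++ {x} {X} {y ∷ π} ρ π∈ refl = ∈-resp-↭ (permutations-↭ (x ∷ X) π∈) (here refl)

module _ {φ ψ : List ℕ → ℤ} where
  odd-cong : ∀ {Xs} → OddFirst Xs → (∀ ρ → HeadIn (first Xs) ρ → φ ρ ≡ ψ ρ) →
    concatenations Xs φ ≡ concatenations Xs ψ
  odd-cong []                              eq = eq [] λ ()
  odd-cong (block {x} {X} {Xs} _ _ _) eq = Σ-cong∈ (permutations (x ∷ X)) λ {π} π∈ →
    concatenations-cong Xs λ ρ → eq (π ++ ρ) (headIn-++ ρ π∈)

  even-cong : ∀ {Xs} → EvenFirst Xs → (∀ ρ → HeadIn (first Xs) ρ → φ ρ ≡ ψ ρ) →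
    concatenations Xs φ ≡ concatenations Xs ψ
  even-cong []                              eq = eq [] λ ()
  even-cong (block {x} {X} {Xs} _ _ _) eq = Σ-cong∈ (permutations (x ∷ X)) λ {π} π∈ →
    concatenations-cong Xs λ ρ → eq (π ++ ρ) (headIn-++ ρ π∈)

cuts : List (List ℕ) → Monomial → ℤ
cuts Xs e = concatenations Xs (λ π → ⟦ cut e π ⟧)

selections-∈ : ∀ (X : List ℕ) {Y Z} → (Y , Z) ∈ selections X → length Y + length Z ≡ length X × Z ⊑ X
selections-∈ []      (here refl) = refl , []
selections-∈ (x ∷ X) p∈ with ∈-++⁻ (map (map₁ (x ∷_)) (selections X)) p∈
... | inj₁ q∈ with _ , r∈ , refl ← ∈-map⁻ (map₁ (x ∷_)) q∈ with eq , sub ← selections-∈ X r∈ =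
  cong suc eq , x ∷ʳ sub
... | inj₂ q∈ with _ , r∈ , refl ← ∈-map⁻ (map₂ (x ∷_)) q∈ with eq , sub ← selections-∈ X r∈ =
  trans (ℕ.+-suc _ _) (cong suc eq) , refl ∷ sub

Sorted-⊑ : ∀ {X Z} → Z ⊑ X → Sorted X → Sorted Z
Sorted-⊑ []         []       = []
Sorted-⊑ (_ ∷ʳ p)   (_ ∷ ss) = Sorted-⊑ p ss
Sorted-⊑ (refl ∷ p) (s ∷ ss) = All-resp-⊆ p s ∷ Sorted-⊑ p ss

cuts-within : ∀ {X} Xs k e → Sorted X → k ℕ.≤ length X →
  cuts (X ∷ Xs) (k ∷ e) ≡ Σ[ Y , Z ← selections X ] (⟦ length Y ≡ᵇ k ⟧ *ℤ cuts (Z ∷ Xs) e)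
cuts-within {X} Xs k e sorted k≤ = begin
  Σ[ π ← permutations X ] concatenations Xs (λ ρ → ⟦ cut (k ∷ e) (π ++ ρ) ⟧)
    ≡⟨ Σ-cong∈ (permutations X) (λ {π} π∈ → trans
         (concatenations-cong Xs λ ρ → trans
           (cong ⟦_⟧ (cut-++ k π ρ (subst (k ℕ.≤_) (sym (↭-length (permutations-↭ X π∈))) k≤)))
           (⟦∧⟧ (ascends k π) (cut e (drop k π ++ ρ))))
         (concatenations-*ˡ ⟦ ascends k π ⟧ Xs _)) ⟩
  Σ[ π ← permutations X ] (⟦ ascends k π ⟧ *ℤ concatenations Xs (λ ρ → ⟦ cut e (drop k π ++ ρ) ⟧))
    ≡⟨ Σ-permutations-ascends k sorted (λ _ τ → concatenations Xs (λ ρ → ⟦ cut e (τ ++ ρ) ⟧)) ⟩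
  Σ[ Y , Z ← selections X ] (⟦ length Y ≡ᵇ k ⟧ *ℤ cuts (Z ∷ Xs) e) ∎

-- The induction hypothesis for one more exponent, for both parities at once. `even-∷` also uses
-- `odd-∷` with the same `e`, since a variable may pass from its even to its odd slot.
record Counted (e : Monomial) : Set where
  field
    odd  : ∀ {Xs} → OddFirst Xs → cuts Xs e ≡ G (0 ◂ sizes Xs) e
    even : ∀ {Xs} → EvenFirst Xs → cuts Xs e ≡ G (sizes Xs) e

  odd-sub : ∀ {x X Xs Z} → OddFirst ((x ∷ X) ∷ Xs) → Z ⊑ x ∷ X →
            cuts (Z ∷ Xs) e ≡ G (advance (length Z) (sizes Xs)) e
  odd-sub {Z = []}    (block _ _ evens)       _   = trans (ℤ.+-identityʳ _) (even evens)
  odd-sub {Z = z ∷ Z} (block sorted gt evens) sub =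
    odd (block (Sorted-⊑ sub sorted) (gt ∘ lookup sub) evens)

  even-sub : ∀ {x X Xs z Z} → EvenFirst ((x ∷ X) ∷ Xs) → z ∷ Z ⊑ x ∷ X →
             cuts ((z ∷ Z) ∷ Xs) e ≡ G (suc (length Z) ∷ sizes Xs) e
  even-sub (block sorted lt odds) sub = even (block (Sorted-⊑ sub sorted) (lt ∘ lookup sub) odds)

  odd-∷ : ∀ k {Xs} → OddFirst Xs → cuts Xs (k ∷ e) ≡ G (0 ◂ sizes Xs) (k ∷ e)
  odd-∷ zero [] = sym (trans (ℤ.+-identityʳ _) (trans (ℤ.*-identityˡ _) (sym (odd []))))
  odd-∷ (suc k) [] = refl
  odd-∷ k {Xs = X ∷ Xs} blocks@(block {x} {X′} sorted gt evens) with k ℕ.≤? length X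
  ... | yes k≤ = begin
    cuts (X ∷ Xs) (k ∷ e)
      ≡⟨ cuts-within Xs k e sorted k≤ ⟩
    Σ[ Y , Z ← selections X ] (⟦ length Y ≡ᵇ k ⟧ *ℤ cuts (Z ∷ Xs) e)
      ≡⟨ Σ-cong∈ (selections X) (λ { {Y , Z} YZ∈ → cong (⟦ length Y ≡ᵇ k ⟧ *ℤ_)
           (odd-sub blocks (proj₂ (selections-∈ X YZ∈))) }) ⟩
    Σ[ Y , Z ← selections X ] (⟦ length Y ≡ᵇ k ⟧ *ℤ G (advance (length Z) (sizes Xs)) e)
      ≡⟨ Σ-selections-length X (λ i r → ⟦ i ≡ᵇ k ⟧ *ℤ G (advance r (sizes Xs)) e) ⟩
    Σ[ i , r ← splits (length X) ] (⟦ i ≡ᵇ k ⟧ *ℤ G (advance r (sizes Xs)) e)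
      ≡⟨ G-odd (length X) (sizes Xs) k e ⟨
    G (0 ∷ length X ∷ sizes Xs) (k ∷ e) ∎
  ... | no k≰ = begin
    cuts (X ∷ Xs) (k ∷ e)
      ≡⟨ Σ-zero (permutations X) (λ {π} π∈ → trans
           (even-cong evens λ ρ ρ∈ → cong ⟦_⟧ (stuck k π ρ (permutations-↭ X π∈) (ℕ.≰⇒> k≰) ρ∈))
           (concatenations-zero Xs λ _ → refl)) ⟩
    0ℤ
      ≡⟨ G-odd-over (sizes Xs) e (ℕ.≰⇒> k≰) ⟨
    G (0 ∷ length X ∷ sizes Xs) (k ∷ e) ∎
    where
    stuck : ∀ k π ρ → π ↭ X → length X ℕ.< k → HeadIn (first Xs) ρ → cut (k ∷ e) (π ++ ρ) ≡ false
    stuck k       []      ρ π↭ _  _  with () ← ↭-length π↭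
    stuck (suc k) (z ∷ π) ρ π↭ lt ρ∈ = run-stuck z k e π
      (ℕ.s<s⁻¹ (subst (ℕ._< suc k) (sym (↭-length π↭)) lt))
      λ z∈ eq → gt (∈-resp-↭ π↭ z∈) (ρ∈ eq)

  even-∷ : ∀ k {Xs} → EvenFirst Xs → cuts Xs (k ∷ e) ≡ G (sizes Xs) (k ∷ e)
  even-∷ k [] = odd-∷ k []
  even-∷ k {Xs = X ∷ Xs} blocks@(block {x} {X′} sorted lt odds) with ℕ.<-≤-connex k (length X)
  ... | inj₁ k< = begin
    cuts (X ∷ Xs) (k ∷ e)
      ≡⟨ cuts-within Xs k e sorted (ℕ.<⇒≤ k<) ⟩
    Σ[ Y , Z ← selections X ] (⟦ length Y ≡ᵇ k ⟧ *ℤ cuts (Z ∷ Xs) e)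
      ≡⟨ Σ-cong∈ (selections X) (λ { {Y , Z} YZ∈ → rest Y Z (selections-∈ X YZ∈) }) ⟩
    Σ[ Y , Z ← selections X ] (⟦ length Y ≡ᵇ k ⟧ *ℤ pos (λ r → G (r ∷ sizes Xs) e) (length Z))
      ≡⟨ Σ-selections-length X (λ i r → ⟦ i ≡ᵇ k ⟧ *ℤ pos (λ r → G (r ∷ sizes Xs) e) r) ⟩
    later
      ≡⟨ ℤ.+-identityˡ _ ⟨
    0ℤ +ℤ later
      ≡⟨ cong (_+ℤ later) (Σ-slot-+≢ (sizes Xs) e k<) ⟨
    _ ≡⟨ G-even′ (length X) (sizes Xs) k e ⟨
    G (length X ∷ sizes Xs) (k ∷ e) ∎
    where
    later = Σ[ i , r ← splits (length X) ] (⟦ i ≡ᵇ k ⟧ *ℤ pos (λ r → G (r ∷ sizes Xs) e) r)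
    rest : ∀ Y Z → length Y + length Z ≡ length X × Z ⊑ X →
      ⟦ length Y ≡ᵇ k ⟧ *ℤ cuts (Z ∷ Xs) e ≡
      ⟦ length Y ≡ᵇ k ⟧ *ℤ pos (λ r → G (r ∷ sizes Xs) e) (length Z)
    rest Y []      (eq , _)   = trans
      (cong (λ b → ⟦ b ⟧ *ℤ cuts ([] ∷ Xs) e) (dec-false (length Y ℕ.≟ k) λ
        y≡k → ℕ.<⇒≢ k< (trans (sym y≡k) (trans (sym (ℕ.+-identityʳ (length Y))) eq))))
      (sym (ℤ.*-zeroʳ ⟦ length Y ≡ᵇ k ⟧))
    rest Y (z ∷ Z) (_  , sub) = cong (⟦ length Y ≡ᵇ k ⟧ *ℤ_) (even-sub blocks sub)
  ... | inj₂ a≤k = subst (λ k → cuts (X ∷ Xs) (k ∷ e) ≡ G (a ∷ sizes Xs) (k ∷ e)) (ℕ.m+[n∸m]≡n a≤k) (begin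
    cuts (X ∷ Xs) (a + j ∷ e)
      ≡⟨ Σ-cong∈ (permutations X) (λ {π} π∈ → trans
           (odd-cong odds λ ρ ρ∈ → trans
             (cong ⟦_⟧ (full π ρ (permutations-↭ X π∈) ρ∈))
             (⟦∧⟧ (ascends a π) (cut (j ∷ e) ρ)))
           (concatenations-*ˡ ⟦ ascends a π ⟧ Xs _)) ⟩
    Σ[ π ← permutations X ] (⟦ ascends a π ⟧ *ℤ c)
      -- Ascending throughout leaves one arrangement of the block; the remaining steps evaluate the
      -- count to `a choose a`.
      ≡⟨ Σ-permutations-ascends a sorted (λ _ _ → c) ⟩
    Σ[ Y , Z ← selections X ] (⟦ length Y ≡ᵇ a ⟧ *ℤ Σ[ ρ ← permutations Z ] c)
      ≡⟨ Σ-cong∈ (selections X) (λ { {Y , Z} YZ∈ → exhausted Y Z (proj₁ (selections-∈ X YZ∈)) }) ⟩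
    Σ[ Y , Z ← selections X ] (⟦ length Y ≡ᵇ a ⟧ *ℤ c)
      ≡⟨ Σ-selections-length X (λ i r → ⟦ i ≡ᵇ a ⟧ *ℤ c) ⟩
    Σ[ i , r ← splits a ] (⟦ i ≡ᵇ a ⟧ *ℤ c)
      ≡⟨ Σ-splits-choose a a (λ _ → c) ⟩
    +ℕ (a choose a) *ℤ c
      ≡⟨ cong (λ n → +ℕ n *ℤ c) (nCn≡1 a) ⟩
    1ℤ *ℤ c
      ≡⟨ ℤ.*-identityˡ c ⟩
    c
      ≡⟨ odd-∷ j odds ⟩
    G (0 ◂ sizes Xs) (j ∷ e)
      ≡⟨ G-even-over a (sizes Xs) j e ⟨
    G (a ∷ sizes Xs) (a + j ∷ e) ∎)
    where
    a = length X
    j = k ∸ a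
    c = cuts Xs (j ∷ e)
    full : ∀ π ρ → π ↭ X → HeadIn (first Xs) ρ →
      cut (a + j ∷ e) (π ++ ρ) ≡ ascends a π ∧ cut (j ∷ e) ρ
    full []      ρ π↭ _  with () ← ↭-length π↭
    full (z ∷ π) ρ π↭ ρ∈ = subst
      (λ n → cut (n + j ∷ e) (z ∷ π ++ ρ) ≡ ascends n (z ∷ π) ∧ cut (j ∷ e) ρ) (↭-length π↭)
      (run-full z j e π λ z∈ eq → lt (∈-resp-↭ π↭ z∈) (ρ∈ eq))
    exhausted : ∀ Y Z → length Y + length Z ≡ a →
      ⟦ length Y ≡ᵇ a ⟧ *ℤ Σ[ ρ ← permutations Z ] c ≡ ⟦ length Y ≡ᵇ a ⟧ *ℤ c
    exhausted Y []      _  = cong (⟦ length Y ≡ᵇ a ⟧ *ℤ_) (ℤ.+-identityʳ c)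
    exhausted Y (z ∷ Z) eq with y≢a ← dec-false (length Y ℕ.≟ a) (λ y≡a →
      ℕ.m+1+n≢m (length Y) (trans eq (sym y≡a))) =
      trans (cong (λ b → ⟦ b ⟧ *ℤ Σ[ ρ ← permutations (z ∷ Z) ] c) y≢a) (sym (cong (λ b → ⟦ b ⟧ *ℤ c) y≢a))

counted : ∀ e → Counted e
counted [] = record
  { odd  = λ { [] → refl ; (block {x} {X} {Xs} _ _ _) → nonempty x X Xs }
  ; even = λ { [] → refl ; (block {x} {X} {Xs} _ _ _) → nonempty x X Xs }
  }
  where
  nonempty : ∀ x X Xs → cuts ((x ∷ X) ∷ Xs) [] ≡ 0ℤ
  nonempty x X Xs = Σ-zero (permutations (x ∷ X)) λ {π} π∈ →
    concatenations-zero Xs λ ρ → cong ⟦_⟧ (uncut π ρ (permutations-↭ (x ∷ X) π∈))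
    where
    uncut : ∀ π ρ → π ↭ x ∷ X → cut [] (π ++ ρ) ≡ false
    uncut []      ρ π↭ with () ← ↭-length π↭
    uncut (_ ∷ _) ρ _  = refl
counted (k ∷ e) = record { odd = Counted.odd-∷ (counted e) k ; even = Counted.even-∷ (counted e) k }

-- The posets P_α as alternating blocks

antichain-labels : ∀ s k → Sorted (labels (antichain s (suc k)))
antichain-labels s k = AllPairs.applyUpTo⁺₁ _ (suc k) λ i<j _ → ℕ.s<s (ℕ.+-monoʳ-< s i<j)

mutual
  oddFirst-blocks : ∀ o e {as} → All NonZero as → e + evenSum as ℕ.≤ o →
    OddFirst (map labels (oddFirst o e as))
  oddFirst-blocks o e [] _ = []
  oddFirst-blocks o e (_∷_ {x = suc a} {xs = as} _ ps) le =
    block (antichain-labels o a) (λ z∈ y∈ → gt as le (proj₁ (∈-antichain z∈)) y∈)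
      (evenFirst-blocks (o + suc a) e ps (ℕ.≤-trans le (ℕ.m≤m+n o (suc a))))
    where
    gt : ∀ as {z y} → e + oddSum as ℕ.≤ o → o ℕ.< z →
      y ∈ first (map labels (evenFirst (o + suc a) e as)) → y ℕ.< z
    gt (b ∷ as) le o<z y∈ = ℕ.≤-<-trans
      (ℕ.≤-trans (proj₂ (∈-antichain {e} y∈)) (ℕ.≤-trans (ℕ.+-monoʳ-≤ e (ℕ.m≤m+n b _)) le)) o<z

  evenFirst-blocks : ∀ o e {as} → All NonZero as → e + oddSum as ℕ.≤ o →
    EvenFirst (map labels (evenFirst o e as))
  evenFirst-blocks o e [] _ = []
  evenFirst-blocks o e (_∷_ {x = suc a} {xs = as} _ ps) le =
    block (antichain-labels e a) (λ z∈ y∈ → lt as (proj₂ (∈-antichain {e} z∈)) y∈)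
      (oddFirst-blocks o (e + suc a) ps (ℕ.≤-trans (ℕ.≤-reflexive (ℕ.+-assoc e (suc a) _)) le))
    where
    lt : ∀ as {z y} → z ℕ.≤ e + suc a → y ∈ first (map labels (oddFirst o (e + suc a) as)) → z ℕ.< y
    lt (b ∷ as) z≤ y∈ = ℕ.≤-<-trans
      (ℕ.≤-trans z≤ (ℕ.≤-trans (ℕ.+-monoʳ-≤ e (ℕ.m≤m+n (suc a) _)) le)) (proj₁ (∈-antichain {o} y∈))

mutual
  oddFirst-sizes : ∀ o e as → sizes (map labels (oddFirst o e as)) ≡ as
  oddFirst-sizes o e []       = refl
  oddFirst-sizes o e (a ∷ as) = cong₂ _∷_ (length-applyUpTo _ a) (evenFirst-sizes (o + a) e as)

  evenFirst-sizes : ∀ o e as → sizes (map labels (evenFirst o e as)) ≡ as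
  evenFirst-sizes o e []       = refl
  evenFirst-sizes o e (a ∷ as) = cong₂ _∷_ (length-applyUpTo _ a) (oddFirst-sizes o (e + a) as)

mutual
  oddFirst-antichains : ∀ o e as → All IsAntichain (oddFirst o e as)
  oddFirst-antichains o e []       = []
  oddFirst-antichains o e (a ∷ as) = (λ _ _ ()) ∷ evenFirst-antichains (o + a) e as

  evenFirst-antichains : ∀ o e as → All IsAntichain (evenFirst o e as)
  evenFirst-antichains o e []       = []
  evenFirst-antichains o e (a ∷ as) = (λ _ _ ()) ∷ oddFirst-antichains o (e + a) as

positive′ : ∀ α → All NonZero (parts α)
positive′ (as , ps) = recompute (All.all? ℕ.nonZero? as) ps

N-G : ∀ α e → N α e ≡ G (0 ◂ parts α) e
N-G α e = begin
  Σ[ π ← linearExtensions (Poset α) ] L (C π) e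
    ≡⟨ Σ-cong (linearExtensions (Poset α)) (λ π → L-C π e) ⟩
  Σ[ π ← linearExtensions (Poset α) ] ⟦ cut e π ⟧
    ≡⟨ Σ-linearExtensions-⨁ Ps _ (oddFirst-antichains o 0 (parts α)) _ ⟩
  cuts (map labels Ps) e
    ≡⟨ Counted.odd (counted e) (oddFirst-blocks o 0 (positive′ α) ℕ.≤-refl) ⟩
  G (0 ◂ sizes (map labels Ps)) e
    ≡⟨ cong (λ as → G (0 ◂ as) e) (oddFirst-sizes o 0 (parts α)) ⟩
  G (0 ◂ parts α) e ∎
  where
  o  = evenSum (parts α)
  Ps = oddFirst o 0 (parts α)

-- Expansions in the family N

parts-injective : ∀ {α β} → parts α ≡ parts β → α ≡ β
parts-injective {_ , _} {_ , _} refl = refl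

infix 4 _≟ᶜ_
_≟ᶜ_ : DecidableEquality Composition
α ≟ᶜ β = map′ parts-injective (cong parts) (≡-dec ℕ._≟_ (parts α) (parts β))

δ : Composition → Composition → ℤ
δ α β = ⟦ does (α ≟ᶜ β) ⟧

δ-refl : ∀ α → δ α α ≡ 1ℤ
δ-refl α = cong ⟦_⟧ (dec-true (α ≟ᶜ α) refl)

δ-≢ : ∀ {α β} → α ≢ β → δ α β ≡ 0ℤ
δ-≢ {α} {β} α≢β = cong ⟦_⟧ (dec-false (α ≟ᶜ β) α≢β)

Σ-δ : ∀ {S ν} (φ : Composition → ℤ) → Unique S → ν ∈ S → Σ[ μ ← S ] (δ μ ν *ℤ φ μ) ≡ φ ν
Σ-δ {ν ∷ S} φ (ν∉S ∷ _) (here refl) = begin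
  δ ν ν *ℤ φ ν +ℤ Σ[ μ ← S ] (δ μ ν *ℤ φ μ)
    ≡⟨ cong₂ _+ℤ_ (trans (cong (_*ℤ φ ν) (δ-refl ν)) (ℤ.*-identityˡ (φ ν)))
         (Σ-zero S λ {μ} μ∈S → cong (_*ℤ φ μ) (δ-≢ λ μ≡ν → All.lookup ν∉S μ∈S (sym μ≡ν))) ⟩
  φ ν +ℤ 0ℤ
    ≡⟨ ℤ.+-identityʳ _ ⟩
  φ ν ∎
Σ-δ {μ ∷ S} {ν} φ (μ∉S ∷ u) (there ν∈S) = begin
  δ μ ν *ℤ φ μ +ℤ Σ[ μ ← S ] (δ μ ν *ℤ φ μ)
    ≡⟨ cong₂ _+ℤ_ (cong (_*ℤ φ μ) (δ-≢ (All.lookup μ∉S ν∈S))) (Σ-δ φ u ν∈S) ⟩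
  0ℤ +ℤ φ ν
    ≡⟨ ℤ.+-identityˡ _ ⟩
  φ ν ∎

Σ-nonneg : ∀ {A : Set} (xs : List A) {φ : A → ℤ} → (∀ x → 0ℤ ≤ φ x) → 0ℤ ≤ Σ xs φ
Σ-nonneg []       h = ℤ.≤-refl
Σ-nonneg (x ∷ xs) h = ℤ.+-mono-≤ (h x) (Σ-nonneg xs h)

⟦⟧-nonneg : ∀ b → 0ℤ ≤ ⟦ b ⟧
⟦⟧-nonneg true  = +≤+ ℕ.z≤n
⟦⟧-nonneg false = ℤ.≤-refl

module Lex = StrictTotalOrder (<-strictTotalOrder ℕ.<-strictTotalOrder)

maximal : ∀ {A : Set} (key : A → List ℕ) x xs →
  ∃ λ m → m ∈ x ∷ xs × (∀ {y} → y ∈ x ∷ xs → ¬ key m <ˡᵉˣ key y)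
maximal key x [] = x , here refl , λ { (here refl) → Lex.irrefl (≡⇒Pointwise-≡ refl) }
maximal key x (y ∷ ys) with maximal key y ys
... | m , m∈ , max with key m Lex.<? key x
...   | no m≮x  = m , there m∈ , λ { (here refl) → m≮x ; (there z∈) → max z∈ }
...   | yes m<x = x , here refl , λ
        { (here refl) → Lex.irrefl (≡⇒Pointwise-≡ refl)
        ; (there z∈)  → λ x<z → max z∈ (Lex.trans m<x x<z) }

-- Linear independence

Terms : Set
Terms = List (ℤ × Composition)

-- Repeated compositions add up, so an expansion and a product can be compared by mere concatenation
-- of terms.
coefficient : Terms → Composition → ℤ
coefficient xs ν = Σ[ k , μ ← xs ] (δ μ ν *ℤ k)

differs? : ∀ ν (p : ℤ × Composition) → Dec (proj₂ p ≢ ν)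
differs? ν (_ , μ) = ¬? (μ ≟ᶜ ν)

without : Composition → Terms → Terms
without ν = filter (differs? ν)

Σ-without : ∀ ν xs (φ : Composition → ℤ) → Σ[ k , μ ← xs ] (k *ℤ φ μ) ≡
  Σ[ k , μ ← without ν xs ] (k *ℤ φ μ) +ℤ coefficient xs ν *ℤ φ ν
Σ-without ν xs φ = sym (begin
  Σ[ k , μ ← without ν xs ] (k *ℤ φ μ) +ℤ coefficient xs ν *ℤ φ ν
    ≡⟨ cong₂ _+ℤ_ (Σ-filter (differs? ν) xs _) (Σ-*ʳ xs _ (φ ν)) ⟩
  _ ≡⟨ Σ-+ xs _ _ ⟨
  Σ[ k , μ ← xs ] (⟦ not (does (μ ≟ᶜ ν)) ⟧ *ℤ (k *ℤ φ μ) +ℤ δ μ ν *ℤ k *ℤ φ ν)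
    ≡⟨ Σ₂-cong xs (λ k μ → pointwise k μ (μ ≟ᶜ ν)) ⟩
  Σ[ k , μ ← xs ] (k *ℤ φ μ) ∎)
  where
  pointwise : ∀ k μ (μ≟ν : Dec (μ ≡ ν)) →
    ⟦ not (does μ≟ν) ⟧ *ℤ (k *ℤ φ μ) +ℤ ⟦ does μ≟ν ⟧ *ℤ k *ℤ φ ν ≡ k *ℤ φ μ
  pointwise k μ (yes refl) = trans (ℤ.+-identityˡ _) (cong (_*ℤ φ μ) (ℤ.*-identityˡ k))
  pointwise k μ (no _)     = trans (ℤ.+-identityʳ _) (ℤ.*-identityˡ _)

coefficient-without : ∀ μ xs ν → coefficient xs μ ≡ 0ℤ → coefficient (without μ xs) ν ≡ coefficient xs ν
coefficient-without μ xs ν c≡0 = sym (begin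
  coefficient xs ν
    ≡⟨ Σ₂-cong xs (λ k κ → ℤ.*-comm (δ κ ν) k) ⟩
  Σ[ k , κ ← xs ] (k *ℤ δ κ ν)
    ≡⟨ Σ-without μ xs (λ κ → δ κ ν) ⟩
  _ ≡⟨ cong (λ c → Σ[ k , κ ← without μ xs ] (k *ℤ δ κ ν) +ℤ c *ℤ δ μ ν) c≡0 ⟩
  _ ≡⟨ ℤ.+-identityʳ _ ⟩
  _ ≡⟨ Σ₂-cong (without μ xs) (λ k κ → ℤ.*-comm k (δ κ ν)) ⟩
  coefficient (without μ xs) ν ∎)

Λ-N : Composition → Composition → ℤ
Λ-N ν μ = Λᵒ (parts ν) (G (0 ◂ parts μ))

-- The functional of the lexicographically largest composition kills every other term and so
-- isolates its coefficient. Once that is 0, all terms with this composition can be removed.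
coefficient-zero : ∀ xs → Acc ℕ._<_ (length xs) →
  (∀ ν → Σ[ k , μ ← xs ] (k *ℤ Λ-N ν μ) ≡ 0ℤ) → ∀ ν → coefficient xs ν ≡ 0ℤ
coefficient-zero [] _ h ν = refl
coefficient-zero xs@(x ∷ xs′) (acc rs) h ν
  with (c , m) , m∈ , max ← maximal (parts ∘ proj₂) x xs′ =
  trans (sym (coefficient-without m xs ν coefficient-m))
    (coefficient-zero (without m xs) (rs shorter) rest ν)
  where
  diagonal : ∀ {k μ} → (k , μ) ∈ xs → k *ℤ Λ-N m μ ≡ δ μ m *ℤ k
  diagonal {k} {μ} μ∈ with Lex.compare (parts μ) (parts m)
  ... | tri< μ<m μ≢m _ = trans
    (cong (k *ℤ_) (Λᵒ-triangular (positive′ m) (positive′ μ) μ<m))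
    (trans (ℤ.*-zeroʳ k) (sym (cong (_*ℤ k) (δ-≢ {μ} {m} λ { refl → μ≢m (≡⇒Pointwise-≡ refl) }))))
  ... | tri≈ _ μ≈m _ with refl ← parts-injective {μ} {m} (Pointwise-≡⇒≡ μ≈m) = trans
    (cong (k *ℤ_) (Λᵒ-diagonal (positive′ m)))
    (trans (ℤ.*-comm k 1ℤ) (sym (cong (_*ℤ k) (δ-refl m))))
  ... | tri> _ _ m<μ = contradiction m<μ (max μ∈)

  coefficient-m : coefficient xs m ≡ 0ℤ
  coefficient-m = trans (sym (Σ-cong∈ xs diagonal)) (h m)

  shorter : length (without m xs) ℕ.< length xs
  shorter = filter-notAll (differs? m) xs (Any.map (λ { refl ne → ne refl }) m∈)

  rest : ∀ κ → Σ[ k , μ ← without m xs ] (k *ℤ Λ-N κ μ) ≡ 0ℤ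
  rest κ = begin
    Σ[ k , μ ← without m xs ] (k *ℤ Λ-N κ μ)
      ≡⟨ ℤ.+-identityʳ _ ⟨
    Σ[ k , μ ← without m xs ] (k *ℤ Λ-N κ μ) +ℤ 0ℤ *ℤ Λ-N κ m
      ≡⟨ cong (λ z → Σ[ k , μ ← without m xs ] (k *ℤ Λ-N κ μ) +ℤ z *ℤ Λ-N κ m) coefficient-m ⟨
    _ ≡⟨ Σ-without m xs (Λ-N κ) ⟨
    Σ[ k , μ ← xs ] (k *ℤ Λ-N κ μ)
      ≡⟨ h κ ⟩
    0ℤ ∎

N-independent : ∀ xs → (∀ e → Σ[ k , μ ← xs ] (k *ℤ N μ e) ≡ 0ℤ) → ∀ ν → coefficient xs ν ≡ 0ℤ
N-independent xs h = coefficient-zero xs (<-wellFounded _) λ ν → begin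
  Σ[ k , μ ← xs ] (k *ℤ Λ-N ν μ)
    ≡⟨ Linear.sums (Λᵒ-linear (parts ν)) xs proj₁ (λ p → G (0 ◂ parts (proj₂ p))) ⟨
  Λᵒ (parts ν) (λ e → Σ[ k , μ ← xs ] (k *ℤ G (0 ◂ parts μ) e))
    ≡⟨ Linear.zeroˢ (Λᵒ-linear (parts ν)) (λ e →
         trans (Σ₂-cong xs λ k μ → cong (k *ℤ_) (sym (N-G μ e))) (h e)) ⟩
  0ℤ ∎

-- The expansion of a product and its uniqueness

toCompositions : ∀ {νs} → All (All NonZero) νs → List Composition
toCompositions = All.reduce (λ {ν} ps → ν , ps)

Σ-toCompositions : ∀ {νs} (ps : All (All NonZero) νs) (φ : List ℕ → ℤ) →
  Σ (toCompositions ps) (φ ∘ parts) ≡ Σ νs φ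
Σ-toCompositions {[]}     []       φ = refl
Σ-toCompositions {ν ∷ νs} (p ∷ ps) φ = cong (φ ν +ℤ_) (Σ-toCompositions ps φ)

∈-toCompositions : ∀ {νs μ} (ps : All (All NonZero) νs) → μ ∈ toCompositions ps → parts μ ∈ νs
∈-toCompositions (p ∷ ps) (here refl) = here refl
∈-toCompositions (p ∷ ps) (there μ∈)  = there (∈-toCompositions ps μ∈)

productParts : Composition → Composition → List (List ℕ)
productParts α β = M° (weight α + weight β) (parts α) (parts β)

productParts-positive : ∀ α β → All (All NonZero) (productParts α β)
productParts-positive α β = All.tabulate (M°-positive (weight α + weight β) (parts α) (parts β))

product : Composition → Composition → List Composition
product α β = toCompositions (productParts-positive α β)

N-product : ∀ α β → N α ⊛ N β ≈ λ e → Σ[ ν ← product α β ] N ν e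
N-product α β e = begin
  (N α ⊛ N β) e
    ≡⟨ Σ-cong (factorizations e) (λ { (a , b) → cong₂ _*ℤ_ (N-G α a) (N-G β b) }) ⟩
  (G (0 ◂ parts α) ⊛ G (0 ◂ parts β)) e
    ≡⟨ G-product e (positive′ α) (positive′ β) ⟩
  Σ[ ν ← productParts α β ] G (0 ◂ ν) e
    ≡⟨ Σ-toCompositions (productParts-positive α β) (λ ν → G (0 ◂ ν) e) ⟨
  Σ[ ν ← product α β ] G (0 ◂ parts ν) e
    ≡⟨ Σ-cong (product α β) (λ ν → N-G ν e) ⟨
  Σ[ ν ← product α β ] N ν e ∎

product-rank : ∀ α β {ν} → ν ∈ product α β → rank ν ≡ rank α + rank β
product-rank α β ν∈ = proj₁ (M°-oddSum (weight α + weight β) (parts α) (parts β)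
  (∈-toCompositions (productParts-positive α β) ν∈))

multiplicity : Composition → List Composition → ℤ
multiplicity ν μs = Σ[ μ ← μs ] δ ν μ

multiplicity-∉ : ∀ {ν} μs → ¬ ν ∈ μs → multiplicity ν μs ≡ 0ℤ
multiplicity-∉ {ν} μs ν∉μs = Σ-zero μs λ {μ} μ∈μs → δ-≢ {ν} {μ} λ { refl → ν∉μs μ∈μs }

Σ-multiplicity : ∀ μs {S} (φ : Composition → ℤ) → Unique S → (∀ {μ} → μ ∈ μs → μ ∈ S) →
  Σ μs φ ≡ Σ[ ν ← S ] (multiplicity ν μs *ℤ φ ν)
Σ-multiplicity μs {S} φ u μs⊆S = sym (begin
  Σ[ ν ← S ] (multiplicity ν μs *ℤ φ ν)           ≡⟨ Σ-cong S (λ ν → Σ-*ʳ μs (δ ν) (φ ν)) ⟩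
  Σ[ ν ← S ] Σ[ μ ← μs ] (δ ν μ *ℤ φ ν)           ≡⟨ Σ-swap S μs _ ⟩
  Σ[ μ ← μs ] Σ[ ν ← S ] (δ ν μ *ℤ φ ν)           ≡⟨ Σ-cong∈ μs (λ μ∈ → Σ-δ φ u (μs⊆S μ∈)) ⟩
  Σ μs φ                                         ∎)

product-span : ∀ α β → Span (λ ν → rank ν ≡ rank α + rank β) (N α ⊛ N β)
product-span α β =
  (λ ν → multiplicity ν μs) ,
  (deduplicate _≟ᶜ_ μs , deduplicate-! _≟ᶜ_ μs , (λ ν c≢0 → ∈-deduplicate⁺ _≟ᶜ_ (support ν c≢0)) ,
    λ e → trans (N-product α β e)
      (Σ-multiplicity μs (λ ν → N ν e) (deduplicate-! _≟ᶜ_ μs) (∈-deduplicate⁺ _≟ᶜ_))) ,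
  λ ν c≢0 → product-rank α β (support ν c≢0)
  where
  μs = product α β
  support : ∀ ν → multiplicity ν μs ≢ 0ℤ → ν ∈ μs
  support ν c≢0 with DecMembership._∈?_ _≟ᶜ_ ν μs
  ... | yes ν∈ = ν∈
  ... | no  ν∉ = contradiction (multiplicity-∉ μs ν∉) c≢0

δ-sym : ∀ α β → δ α β ≡ δ β α
δ-sym α β = cong ⟦_⟧ (does-⇔ (mk⇔ sym sym) (α ≟ᶜ β) (β ≟ᶜ α))

-- Independence applied to the given expansion minus the known one. `c ν ≢ 0ℤ` places ν in `S`, so
-- that the coefficient of ν collected over `S` is `c ν`.
expansion-multiplicity : ∀ α β {c} → IsExpansion (N α ⊛ N β) c → ∀ {ν} → c ν ≢ 0ℤ →
  c ν ≡ multiplicity ν (product α β)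
expansion-multiplicity α β {c} (S , u , supp , eq) {ν} cν≢0 = ℤ.i-j≡0⇒i≡j _ _ (begin
  c ν -ℤ multiplicity ν μs
    ≡⟨ cong₂ _+ℤ_ (Σ-δ c u (supp ν cν≢0)) (begin
         Σ[ μ ← μs ] (δ μ ν *ℤ -1ℤ) ≡⟨ Σ-*ʳ μs (λ μ → δ μ ν) -1ℤ ⟨
         Σ[ μ ← μs ] δ μ ν *ℤ -1ℤ   ≡⟨ ℤ.*-comm _ -1ℤ ⟩
         -1ℤ *ℤ Σ[ μ ← μs ] δ μ ν   ≡⟨ ℤ.-1*i≡-i _ ⟩
         -ℤ Σ[ μ ← μs ] δ μ ν       ≡⟨ cong -ℤ_ (Σ-cong μs λ μ → δ-sym μ ν) ⟩
         -ℤ multiplicity ν μs       ∎) ⟨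
  Σ[ μ ← S ] (δ μ ν *ℤ c μ) +ℤ Σ[ μ ← μs ] (δ μ ν *ℤ -1ℤ)
    ≡⟨ Σ-terms (λ k μ → δ μ ν *ℤ k) ⟨
  coefficient terms ν
    ≡⟨ N-independent terms vanishes ν ⟩
  0ℤ ∎)
  where
  μs = product α β
  terms : Terms
  terms = map (λ μ → c μ , μ) S ++ map (-1ℤ ,_) μs

  Σ-terms : ∀ φ → Σ₂ terms φ ≡ Σ[ μ ← S ] φ (c μ) μ +ℤ Σ[ μ ← μs ] φ -1ℤ μ
  Σ-terms φ = trans (Σ-++ (map _ S) _) (cong₂ _+ℤ_ (Σ-map _ S _) (Σ-map _ μs _))

  vanishes : ∀ e → Σ[ k , μ ← terms ] (k *ℤ N μ e) ≡ 0ℤ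
  vanishes e = begin
    Σ[ k , μ ← terms ] (k *ℤ N μ e)
      ≡⟨ Σ-terms (λ k μ → k *ℤ N μ e) ⟩
    Σ[ μ ← S ] (c μ *ℤ N μ e) +ℤ Σ[ μ ← μs ] (-1ℤ *ℤ N μ e)
      ≡⟨ cong₂ _+ℤ_ (trans (sym (eq e)) (N-product α β e))
           (trans (sym (Σ-*ˡ -1ℤ μs _)) (ℤ.-1*i≡-i _)) ⟩
    Σ[ μ ← μs ] N μ e -ℤ Σ[ μ ← μs ] N μ e
      ≡⟨ ℤ.+-inverseʳ (Σ[ μ ← μs ] N μ e) ⟩
    0ℤ ∎

theorem4p5 : (∀ α β → Span (λ ν → rank ν ≡ rank α + rank β) (N α ⊛ N β))
    × (∀ α β (c : Composition → ℤ) → IsExpansion (N α ⊛ N β) c → ∀ ν → 0ℤ ≤ c ν)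
theorem4p5 = product-span , nonnegative
  where
  nonnegative : ∀ α β (c : Composition → ℤ) → IsExpansion (N α ⊛ N β) c → ∀ ν → 0ℤ ≤ c ν
  nonnegative α β c expansion ν with c ν ℤ.≟ 0ℤ
  ... | yes cν≡0 = ℤ.≤-reflexive (sym cν≡0)
  ... | no  cν≢0 = subst (0ℤ ≤_) (sym (expansion-multiplicity α β expansion cν≢0))
                     (Σ-nonneg (product α β) λ μ → ⟦⟧-nonneg (does (ν ≟ᶜ μ)))
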